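{- Let $p$ be a prime of the form $p=2\pi+1$ with $\pi$ a prime. Then $\mathscr{A}(p)=\mathscr{B}(p)$.
   Context: Let $p$ be a prime and $r\ge 2$. Let $x_1,\dots,x_r$ be independent indeterminates over $\mathbb{F}_p$ and $f(x)=(x-x_1)\cdots(x-x_r)=x^r+s_1x^{r-1}+\cdots+s_r\in\mathbb{F}_p[x_1,\dots,x_r][x]$. For an integer $e\ge 0$ write $f(x)^e=\sum_{i\ge0}c_ix^i$, and for an integer $0\le d\le p$ let $M_d(f(x)^e)$ be the $d\times d$ matrix whose $(i,j)$ entry is $c_{ip+j-d-1}$ ($1\le i,j\le d$). Put $\delta(x_1,\dots,x_r)=\prod_{1\le i<j\le r}(x_i-x_j)$. $\mathscr{A}(p)$ is the set of $(r,e,d)\in\mathbb{Z}^3$ with $r\ge2$, $e\ge1$, $1\le d\le p$, such that there exist $\varepsilon\in\mathbb{F}_p^{\times}$ and a positive integer $g$ with $\det M_d(f(x)^e)=\varepsilon\,\delta(x_1,\dots,x_r)^g$. $\mathscr{B}_+(p)=\{(r,e,d): 2\le r\le p,\ e=p-1,\ d=r\}$, $\mathscr{B}_0(p)=\{(r,e,d): 2\le r\le p+1,\ (p-1)/2<e\le p-1,\ r(p-1-e)\le p-1,\ d=r-1\}$, $\mathscr{B}_-(p)=\{(r,e,d): r\ge2,\ (p-1)/2<e\le p-1,\ r(p-1-e)=p-1,\ d=r-2\}$ (all subsets of $\mathbb{Z}^3$), and $\mathscr{B}(p)=\mathscr{B}_+(p)\cup\mathscr{B}_0(p)\cup\mathscr{B}_-(p)$.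 -}

module Defs where

open import Data.Nat as ℕ using (ℕ; zero; suc; _≤_; _<_; _∸_)
open import Data.Nat.Primality using (Prime)
open import Data.Integer as ℤ using (ℤ; +_; 0ℤ; 1ℤ)
open import Data.Integer.Divisibility using () renaming (_∣_ to _∣ℤ_)
open import Data.Fin using (Fin; zero; suc; toℕ; punchIn)
open import Data.List using (List; []; _∷_; map; foldr; allFin)
open import Data.Unit using (⊤)
open import Data.Product using (_×_; Σ; ∃; _,_)
open import Data.Sum using (_⊎_)
open import Data.Bool using (if_then_else_)
open import Relation.Nullary.Decidable using (⌊_⌋)
open import Relation.Binary.PropositionalEquality using (_≡_)

-- Polynomials with integer coefficients in n variables, in recursive
-- (Horner) form: Poly (suc n) = polynomials in the outermost variable
-- (variable index 0) with coefficients in Poly n, as coefficient lists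
-- (constant term first).  Polynomials over F_p are handled by working
-- over ℤ and comparing modulo p (reduction mod p is a ring morphism).

Poly : ℕ → Set
Poly zero    = ℤ
Poly (suc n) = List (Poly n)

zeroP : ∀ {n} → Poly n
zeroP {zero}  = 0ℤ
zeroP {suc n} = []

constP : ∀ {n} → ℤ → Poly n
constP {zero}  c = c
constP {suc n} c = constP c ∷ []

oneP : ∀ {n} → Poly n
oneP = constP 1ℤ

infixl 6 _⊕_
infixl 7 _⊗_

_⊕_ : ∀ {n} → Poly n → Poly n → Poly n
_⊕_ {zero}  a        b        = a ℤ.+ b
_⊕_ {suc n} []       q        = q
_⊕_ {suc n} (a ∷ as) []       = a ∷ as
_⊕_ {suc n} (a ∷ as) (b ∷ bs) = (a ⊕ b) ∷ (as ⊕ bs)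

negP : ∀ {n} → Poly n → Poly n
negP {zero}  a = ℤ.- a
negP {suc n} q = map negP q

_⊖_ : ∀ {n} → Poly n → Poly n → Poly n
a ⊖ b = a ⊕ negP b

_⊗_ : ∀ {n} → Poly n → Poly n → Poly n
_⊗_ {zero}  a        b = a ℤ.* b
_⊗_ {suc n} []       q = []
_⊗_ {suc n} (a ∷ as) q = map (a ⊗_) q ⊕ (zeroP ∷ (as ⊗ q))

_^P_ : ∀ {n} → Poly n → ℕ → Poly n
q ^P zero  = oneP
q ^P suc e = q ⊗ (q ^P e)

var : ∀ {n} → Fin n → Poly n
var {suc n} zero    = zeroP ∷ oneP ∷ []
var {suc n} (suc i) = var i ∷ []

sumP : ∀ {n k} → (Fin k → Poly n) → Poly n
sumP {k = k} f = foldr _⊕_ zeroP (map f (allFin k))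

prodP : ∀ {n k} → (Fin k → Poly n) → Poly n
prodP {k = k} f = foldr _⊗_ oneP (map f (allFin k))

coeff : ∀ {n} → Poly (suc n) → ℕ → Poly n
coeff []       k       = zeroP
coeff (a ∷ as) zero    = a
coeff (a ∷ as) (suc k) = coeff as k

EqMod : ℕ → ∀ {n} → Poly n → Poly n → Set
EqMod p {zero}  a        b        = (+ p) ∣ℤ (a ℤ.- b)
EqMod p {suc n} []       []       = ⊤
EqMod p {suc n} (a ∷ as) []       = EqMod p a zeroP × EqMod p as []
EqMod p {suc n} []       (b ∷ bs) = EqMod p zeroP b × EqMod p [] bs
EqMod p {suc n} (a ∷ as) (b ∷ bs) = EqMod p a b × EqMod p as bs

alt : ∀ {n} → ℕ → Poly n → Poly n
alt zero    t = t
alt (suc k) t = negP (alt k t)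

det : ∀ {m k} → (Fin k → Fin k → Poly m) → Poly m
det {k = zero}  M = oneP
det {k = suc k} M =
  sumP (λ j → alt (toℕ j) (M zero j ⊗ det (λ a b → M (suc a) (punchIn j b))))

-- The objects of the paper, for r roots x_1..x_r (here var 0 .. var (r-1)
-- of Poly r).  In Poly (suc r), var zero is x and var (suc i) is x_{i+1}.

fpoly : (r : ℕ) → Poly (suc r)
fpoly r = prodP (λ (i : Fin r) → var zero ⊖ var (suc i))

-- M_d(f(x)^e): entry (i,j) (1-based) is c_{ip+j-d-1}; with 0-based
-- a = i-1, b = j-1 this is c_{(a+1)p + b - d} (the index is ≥ 0 as d ≤ p)
Mat : (p r e d : ℕ) → Fin d → Fin d → Poly r
Mat p r e d a b = coeff (fpoly r ^P e) ((suc (toℕ a) ℕ.* p ℕ.+ toℕ b) ∸ d)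

δ : (r : ℕ) → Poly r
δ r = prodP (λ (i : Fin r) → prodP (λ (j : Fin r) →
        if ⌊ toℕ i ℕ.<? toℕ j ⌋ then var i ⊖ var j else oneP))

-- The sets 𝒜(p) and ℬ(p) (all members have nonnegative coordinates,
-- so they are described as predicates on ℕ³).

𝒜 : ℕ → ℕ → ℕ → ℕ → Set
𝒜 p r e d =
  2 ≤ r × 1 ≤ e × 1 ≤ d × d ≤ p ×
  Σ ℕ (λ ε → 1 ≤ ε × ε < p ×
    Σ ℕ (λ g → 1 ≤ g ×
      EqMod p (det (Mat p r e d)) (constP (+ ε) ⊗ (δ r ^P g))))

-- (p-1)/2 < e is written p - 1 < 2e
ℬ₊ : ℕ → ℕ → ℕ → ℕ → Set
ℬ₊ p r e d = 2 ≤ r × r ≤ p × e ≡ p ∸ 1 × d ≡ r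

ℬ₀ : ℕ → ℕ → ℕ → ℕ → Set
ℬ₀ p r e d = 2 ≤ r × r ≤ suc p × p ∸ 1 < 2 ℕ.* e × e ≤ p ∸ 1 ×
             r ℕ.* (p ∸ 1 ∸ e) ≤ p ∸ 1 × d ≡ r ∸ 1

ℬ₋ : ℕ → ℕ → ℕ → ℕ → Set
ℬ₋ p r e d = 2 ≤ r × p ∸ 1 < 2 ℕ.* e × e ≤ p ∸ 1 ×
             r ℕ.* (p ∸ 1 ∸ e) ≡ p ∸ 1 × d ≡ r ∸ 2

ℬ : ℕ → ℕ → ℕ → ℕ → Set
ℬ p r e d = ℬ₊ p r e d ⊎ ℬ₀ p r e d ⊎ ℬ₋ p r e d

{-# OPTIONS --safe #-}

-- M_d(f^e) consists of the coefficients of index ip - 1 of x^{d-j} f^e, and the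
-- coefficients of index ip - 1 of a derivative vanish modulo p.
--
-- ℬ ⊆ 𝒜.  Let F = ∏ (x - xᵢ)^{eᵢ} with all eᵢ < p.  Using the derivative of
-- F ∏ (x - xᵢ) as a column, one gets up to sign
--   ∑ (eᵢ + 1) · det M_{r-1}((x - x₁)F) = (e₁ + 1) ∏_{j>1} (x₁ - xⱼ) · det M_{r-1}(F),
-- a characteristic p analogue of the Dixon–Anderson integral.  Raising e₁ from 0
-- to p - 1 gives the case e = p - 1 by induction on r, and lowering the exponents
-- one by one from p - 1 to e gives d = r - 1 in general.  When deg F = d(p - 1)
-- the last row of M_d is (1, 0, …, 0), so that d and d - 1 have the same
-- determinant up to sign; this covers d = r and d = r - 2.
--
-- 𝒜 ⊆ ℬ.  Substitute xᵢ = t^{wᵢ} with w₁ > … > w_r.  The order at t = 0 of the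
-- coefficient of index n of f^e is a convex function of n, so one term, the
-- antidiagonal, strictly dominates the expansion of det M_d(f^e).  Comparing its
-- order with that of δ^g for all choices of w gives
--   ∑_{i≤d} max(0, m e - i(p - 1)) = g m(m - 1)/2   for 1 ≤ m ≤ r,
-- and m = 2, r - 1, r leave only the members of ℬ.

module Submission where

open import Defs
open import Level using (0ℓ)
open import Algebra.Bundles using (CommutativeRing; RawRing)
open import Algebra.Structures using (IsCommutativeRing)
open import Algebra.Morphism.Structures using (IsRingHomomorphism; IsRingMonomorphism)
import Algebra.Construct.Pointwise as Pointwise
import Algebra.Morphism.RingMonomorphism as RingMonomorphism
import Algebra.Solver.Ring as RingSolver
open import Algebra.Solver.Ring.AlmostCommutativeRing using (fromCommutativeRing; _-Raw-AlmostCommutative⟶_)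
open import Data.Bool using (true; false; if_then_else_)
open import Data.Empty using (⊥; ⊥-elim)
open import Data.Fin using (Fin; toℕ; punchIn)
import Data.Fin.Properties as Fin
open import Data.Integer as ℤ using (ℤ; +_; -[1+_]; 0ℤ; 1ℤ)
import Data.Integer.Properties as ℤ
open import Data.Integer.Divisibility.Signed as Signed using (divides; ∣⇒∣ᵤ; ∣ᵤ⇒∣)
open import Data.List as List
  using (List; []; _∷_; _++_; [_]; length; map; foldr; tabulate; replicate; _ʳ++_)
import Data.List.Properties as List
open import Data.List.Membership.Propositional using (_∈_)
open import Data.List.Membership.Propositional.Properties using (∈-++⁺ˡ; ∈-++⁺ʳ; ∈-∃++)
open import Data.List.Relation.Binary.Permutation.Propositional as Perm
  using (_↭_; prep; swap; ↭-sym; ↭-reflexive; ↭-trans)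
open import Data.List.Relation.Binary.Permutation.Propositional.Properties
  using (shift; ∷↭∷ʳ; map⁺; ↭-reverse)
open import Data.List.Relation.Binary.Pointwise using (Pointwise; []; _∷_)
open import Data.List.Relation.Unary.All as All using (All; []; _∷_)
open import Data.List.Relation.Unary.AllPairs using (AllPairs; []; _∷_)
open import Data.List.Relation.Unary.Any using (here; there)
open import Data.Maybe as Maybe using ()
open import Data.Nat as ℕ using (ℕ; zero; suc; z≤n; s≤s; _∸_; _!)
import Data.Nat.Properties as ℕ
open import Data.Nat.Combinatorics.Specification using (nCk≡n!/k![n-k]!)
open import Data.Nat.Coprimality using (Coprime; coprime-Bézout)
open import Data.Nat.Divisibility
  using (_∣_; divides; ∣⇒≤; ∣-refl; ∣-trans; ∣m+n∣m⇒∣n; ∣m⇒∣m*n; n∣m*n; m/n∣m; m%n≡0⇒n∣m)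
open import Data.Nat.DivMod using (_%_; _/_; m≡m%n+[m/n]*n; m%n<n)
open import Data.Nat.GCD using (module Bézout)
open import Data.Nat.ListAction using (sum)
open import Data.Nat.Primality
  using (Prime; euclidsLemma; prime⇒irreducible; prime⇒nonTrivial; ¬prime[0])
open import Data.Nat.Tactic.RingSolver using (solve-∀)
open import Data.Product using (_×_; Σ; ∃; _,_; proj₁; proj₂)
open import Data.Sum using (_⊎_; inj₁; inj₂; [_,_]′)
open import Data.Unit using (tt)
open import Function using (_∘_; id)
open import Relation.Binary.Definitions using (tri<; tri≈; tri>)
open import Relation.Binary.PropositionalEquality as ≡ using (_≡_)
import Relation.Binary.Reasoning.Setoid as SetoidReasoning
open import Relation.Nullary using (¬_; Dec; yes; no)
open import Relation.Nullary.Decidable using (⌊_⌋; dec⇒maybe; isYes≗does)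

-- The recurrence multiplies by the sum of all eᵢ + 1, which must be prime to p. While one exponent
-- k is raised and the others are p - 1, the sum is k + 1 modulo p. While exponents are lowered to
-- e, it is r p minus a deficit of at most r(p - 1 - e), and r(p - 1 - e) ≤ p - 1 keeps this deficit
-- below p. Lowering leaves the factor Δ^(2(p - 1 - e)) beside the wanted determinant. It is
-- cancelled because differences of variables are not zero divisors; what remains is g = p - 1 - 2(p
-- - 1 - e), positive exactly when e > (p - 1)/2. In the other direction, dominance needs e < p, for
-- nonzero binomials and for strict convexity at distance p, and d(p - 1) ≤ r e, for antidiagonal
-- entries within the degree. Both are forced beforehand: otherwise a row vanishes (for e ≥ p after
-- setting one variable to 0) while δ does not. The exponents wᵢ are suffix sums of a list of
-- positive integers, so that both orders become linear forms in independent parameters and can be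
-- compared coefficient by coefficient.

-- Integer multiples in a commutative ring

module Integers (R : CommutativeRing 0ℓ 0ℓ) where
  open CommutativeRing R hiding (zero)
  open import Algebra.Properties.Ring ring
  open import Algebra.Properties.AbelianGroup +-abelianGroup using (⁻¹-∙-comm)
  open import Algebra.Properties.Semiring.Mult semiring using (×-homo-+; ×1-homo-*) renaming (_×_ to _×ₙ_)
  open SetoidReasoning setoid

  ι : ℕ → Carrier
  ι n = n ×ₙ 1#

  ι-+ : ∀ m n → ι (m ℕ.+ n) ≈ ι m + ι n
  ι-+ = ×-homo-+ 1#

  ι-* : ∀ m n → ι (m ℕ.* n) ≈ ι m * ι n
  ι-* = ×1-homo-*

  ιℤ : ℤ → Carrier
  ιℤ (+ n)    = ι n
  ιℤ -[1+ n ] = - ι (suc n)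

  private
    suc-suc : ∀ x y z → (x + y) - (x + z) ≈ y - z
    suc-suc x y z = begin
      (x + y) - (x + z)       ≈⟨ +-cong (+-comm _ _) (sym (⁻¹-∙-comm x z)) ⟩
      (y + x) + (- x + - z)   ≈⟨ +-assoc _ _ _ ⟩
      y + (x + (- x + - z))   ≈⟨ +-congˡ (+-assoc _ _ _) ⟨
      y + (x - x + - z)       ≈⟨ +-congˡ (+-congʳ (-‿inverseʳ x)) ⟩
      y + (0# + - z)          ≈⟨ +-congˡ (+-identityˡ _) ⟩
      y - z ∎

    ιℤ-⊖ : ∀ m n → ιℤ (m ℤ.⊖ n) ≈ ι m - ι n
    ιℤ-⊖ zero    zero    = sym (-‿inverseʳ _)
    ιℤ-⊖ zero    (suc n) = sym (+-identityˡ _)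
    ιℤ-⊖ (suc m) zero    = sym (trans (+-congˡ -0#≈0#) (+-identityʳ _))
    ιℤ-⊖ (suc m) (suc n) = begin
      ιℤ (suc m ℤ.⊖ suc n) ≡⟨ ≡.cong ιℤ (ℤ.[1+m]⊖[1+n]≡m⊖n m n) ⟩
      ιℤ (m ℤ.⊖ n)         ≈⟨ ιℤ-⊖ m n ⟩
      ι m - ι n            ≈⟨ suc-suc 1# (ι m) (ι n) ⟨
      ι (suc m) - ι (suc n) ∎

  ιℤ-neg : ∀ i → ιℤ (ℤ.- i) ≈ - ιℤ i
  ιℤ-neg (+ zero)  = sym -0#≈0#
  ιℤ-neg (+ suc n) = refl
  ιℤ-neg -[1+ n ]  = sym (-‿involutive _)

  ιℤ-+ : ∀ i j → ιℤ (i ℤ.+ j) ≈ ιℤ i + ιℤ j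
  ιℤ-+ (+ m)    (+ n)    = ι-+ m n
  ιℤ-+ (+ m)    -[1+ n ] = ιℤ-⊖ m (suc n)
  ιℤ-+ -[1+ m ] (+ n)    = trans (ιℤ-⊖ n (suc m)) (+-comm _ _)
  ιℤ-+ -[1+ m ] -[1+ n ] = trans (-‿cong (trans
    (reflexive (≡.cong (λ k → ι (suc k)) (≡.sym (ℕ.+-suc m n)))) (ι-+ (suc m) (suc n))))
    (sym (⁻¹-∙-comm _ _))
    where import Data.Nat.Properties as ℕ

  private
    ιℤ-*-+ : ∀ m j → ιℤ (+ m ℤ.* j) ≈ ι m * ιℤ j
    ιℤ-*-+ m (+ n)    = trans (reflexive (≡.cong ιℤ (≡.sym (ℤ.pos-* m n)))) (ι-* m n)
    ιℤ-*-+ m -[1+ n ] = begin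
      ιℤ (+ m ℤ.* -[1+ n ])        ≡⟨ ≡.cong ιℤ (ℤ.neg-distribʳ-* (+ m) (+ suc n)) ⟨
      ιℤ (ℤ.- (+ m ℤ.* + suc n))   ≈⟨ ιℤ-neg (+ m ℤ.* + suc n) ⟩
      - ιℤ (+ m ℤ.* + suc n)       ≈⟨ -‿cong (ιℤ-*-+ m (+ suc n)) ⟩
      - (ι m * ι (suc n))          ≈⟨ -‿distribʳ-* _ _ ⟩
      ι m * - ι (suc n) ∎

  ιℤ-* : ∀ i j → ιℤ (i ℤ.* j) ≈ ιℤ i * ιℤ j
  ιℤ-* (+ m)    j = ιℤ-*-+ m j
  ιℤ-* -[1+ m ] j = begin
    ιℤ (-[1+ m ] ℤ.* j)        ≡⟨ ≡.cong ιℤ (ℤ.neg-distribˡ-* (+ suc m) j) ⟨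
    ιℤ (ℤ.- (+ suc m ℤ.* j))   ≈⟨ ιℤ-neg (+ suc m ℤ.* j) ⟩
    - ιℤ (+ suc m ℤ.* j)       ≈⟨ -‿cong (ιℤ-*-+ (suc m) j) ⟩
    - (ι (suc m) * ιℤ j)       ≈⟨ -‿distribˡ-* _ _ ⟩
    - ι (suc m) * ιℤ j ∎

  ιℤ-morphism : ℤ.+-*-rawRing -Raw-AlmostCommutative⟶ fromCommutativeRing R
  ιℤ-morphism = record
    { ⟦_⟧ = ιℤ ; +-homo = ιℤ-+ ; *-homo = ιℤ-* ; -‿homo = ιℤ-neg ; 0-homo = refl ; 1-homo = +-identityʳ 1# }

  -- The integers are compared before they are mapped, since equality in the ring need not be
  -- decidable; accordingly the solver proves the identities that hold over ℤ.
  ιℤ≟ : ∀ i j → Maybe.Maybe (ιℤ i ≈ ιℤ j)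
  ιℤ≟ i j = Maybe.map (λ e → reflexive (≡.cong ιℤ e)) (dec⇒maybe (i ℤ.≟ j))

  open RingSolver ℤ.+-*-rawRing (fromCommutativeRing R) ιℤ-morphism ιℤ≟
    public using (solve; _:=_; _:+_; _:*_; _:-_; :-_)

-- Formal power series as coefficient sequences

module Convolution (R : CommutativeRing 0ℓ 0ℓ) where
  open CommutativeRing R
  open import Algebra.Properties.CommutativeSemigroup +-commutativeSemigroup
    using (interchange)
  open SetoidReasoning setoid

  Seq : Set
  Seq = ℕ → Carrier

  infix  4 _≋_
  infixl 7 _⊛_

  _≋_ : Seq → Seq → Set
  u ≋ v = ∀ n → u n ≈ v n

  const : Carrier → Seq
  const c zero    = c
  const c (suc n) = 0#

  -- The Cauchy product, by recursion on the index with the left factor shifted: the ring laws then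
  -- follow by induction, without reindexing finite sums.
  _⊛_ : Seq → Seq → Seq
  (u ⊛ v) zero    = u 0 * v 0
  (u ⊛ v) (suc n) = u 0 * v (suc n) + ((u ∘ suc) ⊛ v) n

  ⊛-cong : ∀ {u u′ v v′} → u ≋ u′ → v ≋ v′ → u ⊛ v ≋ u′ ⊛ v′
  ⊛-cong u≋ v≋ zero    = *-cong (u≋ 0) (v≋ 0)
  ⊛-cong u≋ v≋ (suc n) = +-cong (*-cong (u≋ 0) (v≋ (suc n))) (⊛-cong (u≋ ∘ suc) v≋ n)

  ⊛-distribʳ : ∀ w u v → (λ n → u n + v n) ⊛ w ≋ (λ n → (u ⊛ w) n + (v ⊛ w) n)
  ⊛-distribʳ w u v zero    = distribʳ _ _ _
  ⊛-distribʳ w u v (suc n) = trans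
    (+-cong (distribʳ _ _ _) (⊛-distribʳ w (u ∘ suc) (v ∘ suc) n)) (interchange _ _ _ _)

  ⊛-scaleˡ : ∀ c u v → (λ n → c * u n) ⊛ v ≋ (λ n → c * (u ⊛ v) n)
  ⊛-scaleˡ c u v zero    = *-assoc _ _ _
  ⊛-scaleˡ c u v (suc n) = trans
    (+-cong (*-assoc _ _ _) (⊛-scaleˡ c (u ∘ suc) v n)) (sym (distribˡ _ _ _))

  -- The definition peels off the constant term of the left factor; commutativity needs this mirror
  -- image, which peels off that of the right one.
  ⊛-sucʳ : ∀ u v n → (u ⊛ v) (suc n) ≈ (u ⊛ (v ∘ suc)) n + u (suc n) * v 0
  ⊛-sucʳ u v zero    = refl
  ⊛-sucʳ u v (suc n) = trans (+-congˡ (⊛-sucʳ (u ∘ suc) v n)) (sym (+-assoc _ _ _))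

  ⊛-comm : ∀ u v → u ⊛ v ≋ v ⊛ u
  ⊛-comm u v zero    = *-comm _ _
  ⊛-comm u v (suc n) = begin
    u 0 * v (suc n) + ((u ∘ suc) ⊛ v) n ≈⟨ +-cong (*-comm _ _) (⊛-comm (u ∘ suc) v n) ⟩
    v (suc n) * u 0 + (v ⊛ (u ∘ suc)) n ≈⟨ +-comm _ _ ⟩
    (v ⊛ (u ∘ suc)) n + v (suc n) * u 0 ≈⟨ ⊛-sucʳ v u n ⟨
    (v ⊛ u) (suc n)                     ∎

  ⊛-assoc : ∀ u v w → (u ⊛ v) ⊛ w ≋ u ⊛ (v ⊛ w)
  ⊛-assoc u v w zero    = *-assoc _ _ _
  ⊛-assoc u v w (suc n) = begin
    u 0 * v 0 * w (suc n) + (((u ⊛ v) ∘ suc) ⊛ w) n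
      ≈⟨ +-cong (*-assoc _ _ _) (⊛-distribʳ w (λ k → u 0 * v (suc k)) ((u ∘ suc) ⊛ v) n) ⟩
    u 0 * (v 0 * w (suc n)) + (((λ k → u 0 * v (suc k)) ⊛ w) n + (((u ∘ suc) ⊛ v) ⊛ w) n)
      ≈⟨ +-congˡ (+-cong (⊛-scaleˡ (u 0) (v ∘ suc) w n) (⊛-assoc (u ∘ suc) v w n)) ⟩
    u 0 * (v 0 * w (suc n)) + (u 0 * ((v ∘ suc) ⊛ w) n + ((u ∘ suc) ⊛ (v ⊛ w)) n)
      ≈⟨ +-assoc _ _ _ ⟨
    u 0 * (v 0 * w (suc n)) + u 0 * ((v ∘ suc) ⊛ w) n + ((u ∘ suc) ⊛ (v ⊛ w)) n
      ≈⟨ +-congʳ (distribˡ _ _ _) ⟨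
    u 0 * (v ⊛ w) (suc n) + ((u ∘ suc) ⊛ (v ⊛ w)) n ∎

  ⊛-zeroˡ : ∀ v → (λ _ → 0#) ⊛ v ≋ (λ _ → 0#)
  ⊛-zeroˡ v zero    = zeroˡ _
  ⊛-zeroˡ v (suc n) = trans (+-cong (zeroˡ _) (⊛-zeroˡ v n)) (+-identityˡ _)

  const-⊛ : ∀ c v → const c ⊛ v ≋ (λ n → c * v n)
  const-⊛ c v zero    = refl
  const-⊛ c v (suc n) = trans (+-congˡ (⊛-zeroˡ v n)) (+-identityʳ _)

  ⊛-identityˡ : ∀ v → const 1# ⊛ v ≋ v
  ⊛-identityˡ v n = trans (const-⊛ 1# v n) (*-identityˡ _)

  isCommutativeRing-⊛ : IsCommutativeRing _≋_ (λ u v n → u n + v n) _⊛_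
                          (λ u n → - u n) (λ _ → 0#) (const 1#)
  isCommutativeRing-⊛ = record
    { isRing = record
      { +-isAbelianGroup = Pointwise.isAbelianGroup ℕ +-isAbelianGroup
      ; *-cong           = ⊛-cong
      ; *-assoc          = ⊛-assoc
      ; *-identity       = ⊛-identityˡ , λ v n → trans (⊛-comm v _ n) (⊛-identityˡ v n)
      ; distrib          = (λ w u v n → trans (⊛-comm w _ n)
                             (trans (⊛-distribʳ w u v n) (+-cong (⊛-comm u w n) (⊛-comm v w n))))
                         , ⊛-distribʳ
      }
    ; *-comm = ⊛-comm
    }

powerSeries : CommutativeRing 0ℓ 0ℓ → CommutativeRing 0ℓ 0ℓ
powerSeries R = record { isCommutativeRing = Convolution.isCommutativeRing-⊛ R }

-- Determinants of lists of series, and equality up to sign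

module Signs (R : CommutativeRing 0ℓ 0ℓ) where
  open CommutativeRing R hiding (zero)
  open import Algebra.Properties.Ring ring using (-0#≈0#; -‿involutive; -‿distribʳ-*)

  infix 4 _≈±_

  -- Signs of column permutations are forgotten: the constant ε absorbs them, and the order of a
  -- series does not see them.
  _≈±_ : Carrier → Carrier → Set
  a ≈± b = a ≈ b ⊎ a ≈ - b

  ≈±-trans : ∀ {a b c} → a ≈± b → b ≈± c → a ≈± c
  ≈±-trans (inj₁ p) (inj₁ q) = inj₁ (trans p q)
  ≈±-trans (inj₁ p) (inj₂ q) = inj₂ (trans p q)
  ≈±-trans (inj₂ p) (inj₁ q) = inj₂ (trans p (-‿cong q))
  ≈±-trans (inj₂ p) (inj₂ q) = inj₁ (trans p (trans (-‿cong q) (-‿involutive _)))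

  ≈±-*ˡ : ∀ c {a b} → a ≈± b → c * a ≈± c * b
  ≈±-*ˡ c (inj₁ p) = inj₁ (*-congˡ p)
  ≈±-*ˡ c (inj₂ p) = inj₂ (trans (*-congˡ p) (sym (-‿distribʳ-* _ _)))

  ≈±-zero : ∀ {a b} → a ≈± b → b ≈ 0# → a ≈ 0#
  ≈±-zero (inj₁ p) q = trans p q
  ≈±-zero (inj₂ p) q = trans p (trans (-‿cong q) -0#≈0#)

module Determinants (R : CommutativeRing 0ℓ 0ℓ) where
  open CommutativeRing R hiding (zero)
  open Convolution R using (Seq; _≋_)
  open Signs R
  open import Algebra.Properties.Ring ring
    using (-0#≈0#; +-cancelˡ; x≈z//y)
  open Integers R using (solve; _:=_; _:+_; _:*_; :-_)
  open SetoidReasoning setoid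

  private
    0-0≈0 : ∀ {a b} → a ≈ 0# → b ≈ 0# → a - b ≈ 0#
    0-0≈0 p q = trans (+-cong p (trans (-‿cong q) -0#≈0#)) (+-identityˡ _)

  -- Laplace expansion over a list: `h` receives each chosen column with the others in their
  -- original order, and the nested subtraction produces the alternating signs.
  expand : (Seq → List Seq → Carrier) → List Seq → Carrier
  expand h []       = 0#
  expand h (u ∷ us) = h u us - expand (λ v vs → h v (u ∷ vs)) us

  -- The rows of the determinant are the coefficients of index ρ 0, ρ 1, …
  -- of the columns; it is 0 when there are not exactly n columns.
  D : ℕ → (ℕ → ℕ) → List Seq → Carrier
  D zero    ρ []      = 1#
  D zero    ρ (_ ∷ _) = 0#
  D (suc n) ρ us      = expand (λ v vs → v (ρ 0) * D n (ρ ∘ suc) vs) us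

  expand-cong : ∀ {h h′} → (∀ v vs → h v vs ≈ h′ v vs) → ∀ us → expand h us ≈ expand h′ us
  expand-cong p []       = refl
  expand-cong p (u ∷ us) = +-cong (p u us) (-‿cong (expand-cong (λ v vs → p v (u ∷ vs)) us))

  expand-congAll : ∀ {P : Seq → Set} {h h′} → (∀ {v vs} → P v → All P vs → h v vs ≈ h′ v vs) →
                   ∀ {us} → All P us → expand h us ≈ expand h′ us
  expand-congAll p []         = refl
  expand-congAll p (pu ∷ pus) =
    +-cong (p pu pus) (-‿cong (expand-congAll (λ pv pvs → p pv (pu ∷ pvs)) pus))

  expand-congPW : ∀ {h h′} → (∀ {v v′ vs vs′} → v ≋ v′ → Pointwise _≋_ vs vs′ → h v vs ≈ h′ v′ vs′) →
                  ∀ {us us′} → Pointwise _≋_ us us′ → expand h us ≈ expand h′ us′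
  expand-congPW p []       = refl
  expand-congPW p (e ∷ es) =
    +-cong (p e es) (-‿cong (expand-congPW (λ e′ es′ → p e′ (e ∷ es′)) es))

  expand-zero : ∀ us → expand (λ _ _ → 0#) us ≈ 0#
  expand-zero []       = refl
  expand-zero (u ∷ us) = 0-0≈0 refl (expand-zero us)

  expand-axpy : ∀ c g h us →
                expand (λ v vs → c * g v vs + h v vs) us ≈ c * expand g us + expand h us
  expand-axpy c g h []       = sym (trans (+-identityʳ _) (zeroʳ c))
  expand-axpy c g h (u ∷ us) = trans
    (+-congˡ (-‿cong (expand-axpy c _ _ us)))
    (solve 5 (λ c a b x y → ((c :* a :+ b) :+ :- (c :* x :+ y)) := (c :* (a :+ :- x) :+ (b :+ :- y)))
      refl c _ _ _ _)

  expand-linear : ∀ {h c u v w} →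
    (∀ x us vs → h x (us ++ w ∷ vs) ≈ c * h x (us ++ u ∷ vs) + h x (us ++ v ∷ vs)) →
    (∀ vs → h w vs ≈ c * h u vs + h v vs) →
    ∀ us vs → expand h (us ++ w ∷ vs) ≈ c * expand h (us ++ u ∷ vs) + expand h (us ++ v ∷ vs)
  expand-linear {h} {c} {u} {v} {w} p q [] vs = trans
    (+-cong (q vs) (-‿cong (trans (expand-cong (λ x xs → p x [] xs) vs) (expand-axpy c _ _ vs))))
    (solve 5 (λ c a b x y → ((c :* a :+ b) :+ :- (c :* x :+ y)) := (c :* (a :+ :- x) :+ (b :+ :- y)))
      refl c _ _ _ _)
  expand-linear {h} {c} p q (x ∷ us) vs = trans
    (+-cong (p x us vs)
      (-‿cong (expand-linear (λ y us vs → p y (x ∷ us) vs) (λ vs → q (x ∷ vs)) us vs)))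
    (solve 5 (λ c a b x y → ((c :* a :+ b) :+ :- (c :* x :+ y)) := (c :* (a :+ :- x) :+ (b :+ :- y)))
      refl c _ _ _ _)

  -- The two terms that choose one of the equal columns cancel; in every other term both copies
  -- survive into the minor.
  expand-repeated : ∀ {h u} → (∀ x us vs → h x (us ++ u ∷ u ∷ vs) ≈ 0#) →
                    ∀ us vs → expand h (us ++ u ∷ u ∷ vs) ≈ 0#
  expand-repeated {h} {u} p [] vs = begin
    h u (u ∷ vs) - (h u (u ∷ vs) - expand (λ x xs → h x (u ∷ u ∷ xs)) vs)
      ≈⟨ +-congˡ (-‿cong (+-congˡ (trans (-‿cong
           (trans (expand-cong (λ x xs → p x [] xs) vs) (expand-zero vs))) -0#≈0#))) ⟩
    h u (u ∷ vs) - (h u (u ∷ vs) + 0#) ≈⟨ +-congˡ (-‿cong (+-identityʳ _)) ⟩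
    h u (u ∷ vs) - h u (u ∷ vs)        ≈⟨ -‿inverseʳ _ ⟩
    0# ∎
  expand-repeated p (x ∷ us) vs = 0-0≈0 (p x us vs) (expand-repeated (λ y us vs → p y (x ∷ us) vs) us vs)

  D-cong : ∀ n {ρ us vs} → Pointwise _≋_ us vs → D n ρ us ≈ D n ρ vs
  D-cong zero    []       = refl
  D-cong zero    (_ ∷ _)  = refl
  D-cong (suc n) {ρ} es   = expand-congPW (λ e es → *-cong (e (ρ 0)) (D-cong n es)) es

  D-zero-nonempty : ∀ us {v vs ρ} → D zero ρ (us ++ v ∷ vs) ≈ 0#
  D-zero-nonempty []      = refl
  D-zero-nonempty (_ ∷ _) = refl

  -- The form c u + v covers additivity and homogeneity in one induction.
  D-linear : ∀ n {ρ c u v w} → w ≋ (λ k → c * u k + v k) → ∀ us vs →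
             D n ρ (us ++ w ∷ vs) ≈ c * D n ρ (us ++ u ∷ vs) + D n ρ (us ++ v ∷ vs)
  D-linear zero e us vs = trans (D-zero-nonempty us) (sym (trans
    (+-cong (trans (*-congˡ (D-zero-nonempty us)) (zeroʳ _)) (D-zero-nonempty us)) (+-identityʳ _)))
  D-linear (suc n) {ρ} {c} e us vs = expand-linear
    (λ x us vs → trans (*-congˡ (D-linear n e us vs))
      (solve 4 (λ x c a b → (x :* (c :* a :+ b)) := (c :* (x :* a) :+ x :* b)) refl (x (ρ 0)) c _ _))
    (λ vs → trans (*-congʳ (e (ρ 0)))
      (solve 4 (λ x c a b → ((c :* a :+ b) :* x) := (c :* (a :* x) :+ b :* x)) refl _ c _ _))
    us vs

  D-repeated : ∀ n {ρ u} us vs → D n ρ (us ++ u ∷ u ∷ vs) ≈ 0#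
  D-repeated zero    us vs = D-zero-nonempty us
  D-repeated (suc n) us vs = expand-repeated
    (λ x us vs → trans (*-congˡ (D-repeated n us vs)) (zeroʳ _)) us vs

  -- Polarisation: with s = u + v in both places the determinant vanishes, and so do the terms with
  -- u twice or v twice.
  D-swap : ∀ n {ρ} u v us vs → D n ρ (us ++ u ∷ v ∷ vs) ≈ - D n ρ (us ++ v ∷ u ∷ vs)
  D-swap n {ρ} u v us vs = x+y≈0 (begin
    E u v + E v u                                   ≈⟨ +-cong (+-identityˡ _) (+-identityʳ _) ⟨
    (0# + E u v) + (E v u + 0#)                     ≈⟨ +-cong (+-congʳ (D-repeated n us vs)) (+-congˡ
        (D-repeated n us vs)) ⟨
    (E u u + E u v) + (E v u + E v v)               ≈⟨ +-cong (lin₂ u) (lin₂ v) ⟨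
    E u s + E v s                                   ≈⟨ +-congʳ (*-identityˡ _) ⟨
    1# * E u s + E v s                              ≈⟨ D-linear n (λ k → +-congʳ (sym (*-identityˡ _))) us (s ∷ vs) ⟨
    E s s                                           ≈⟨ D-repeated n us vs ⟩
    0# ∎)
    where
    E : Seq → Seq → Carrier
    E a b = D n ρ (us ++ a ∷ b ∷ vs)
    s : Seq
    s k = u k + v k
    lin₂ : ∀ a → E a s ≈ E a u + E a v
    lin₂ a = begin
      E a s                             ≡⟨ ≡.cong (D n ρ) (List.++-assoc us [ a ] (s ∷ vs)) ⟨
      D n ρ ((us ++ [ a ]) ++ s ∷ vs)   ≈⟨ D-linear n (λ k → +-congʳ (sym (*-identityˡ _))) (us ++ [ a ]) vs ⟩
      1# * D n ρ ((us ++ [ a ]) ++ u ∷ vs) + D n ρ ((us ++ [ a ]) ++ v ∷ vs)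
        ≈⟨ +-cong (trans (*-identityˡ _) (reflexive (≡.cong (D n ρ) (List.++-assoc us [ a ] (u ∷ vs)))))
                  (reflexive (≡.cong (D n ρ) (List.++-assoc us [ a ] (v ∷ vs)))) ⟩
      E a u + E a v ∎
    x+y≈0 : ∀ {x y} → x + y ≈ 0# → x ≈ - y
    x+y≈0 e = trans (x≈z//y _ _ _ e) (+-identityˡ _)

  D-↭-prefix : ∀ n {ρ us vs} ws → us ↭ vs → D n ρ (ws ++ us) ≈± D n ρ (ws ++ vs)
  D-↭-prefix n ws Perm.refl = inj₁ refl
  D-↭-prefix n {ρ} ws (prep {us} {vs} x p) = ≡.subst₂ (λ a b → D n ρ a ≈± D n ρ b)
    (List.++-assoc ws [ x ] us) (List.++-assoc ws [ x ] vs) (D-↭-prefix n (ws ++ [ x ]) p)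
  D-↭-prefix n {ρ} ws (swap {us} {vs} x y p) = ≈±-trans (inj₂ (D-swap n x y ws us))
    (≡.subst₂ (λ a b → D n ρ a ≈± D n ρ b)
      (List.++-assoc ws (y ∷ x ∷ []) us) (List.++-assoc ws (y ∷ x ∷ []) vs)
      (D-↭-prefix n (ws ++ y ∷ x ∷ []) p))
  D-↭-prefix n ws (Perm.trans p q) = ≈±-trans (D-↭-prefix n ws p) (D-↭-prefix n ws q)

  D-↭ : ∀ n {ρ us vs} → us ↭ vs → D n ρ us ≈± D n ρ vs
  D-↭ n = D-↭-prefix n []

  D-∈ : ∀ n {ρ} us {u vs} → u ∈ us ++ vs → D n ρ (us ++ u ∷ vs) ≈ 0#
  D-∈ n us {u} {vs} u∈ with ∈-∃++ u∈
  ... | xs , ys , eq = ≈±-zero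
    (D-↭ n (↭-trans (shift u us vs) (prep u (↭-trans (↭-reflexive eq) (shift u xs ys)))))
    (D-repeated n [] (xs ++ ys))

  data Span (us : List Seq) : Seq → Set where
    zeroˢ : ∀ {v} → v ≋ (λ _ → 0#) → Span us v
    addˢ  : ∀ {c u v w} → u ∈ us → Span us v → w ≋ (λ k → c * u k + v k) → Span us w

  D-Span : ∀ n {ρ} us {v vs} → Span (us ++ vs) v → D n ρ (us ++ v ∷ vs) ≈ 0#
  -- A zero column satisfies v = 1 · v + v, so linearity gives D = D + D.
  D-Span n us {v} {vs} (zeroˢ e) = +-cancelˡ _ _ _ (trans
    (trans (+-congʳ (sym (*-identityˡ _))) (sym (D-linear n
      (λ k → trans (e k) (sym (trans (+-cong (trans (*-identityˡ _) (e k)) (e k)) (+-identityʳ _)))) us vs)))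
    (sym (+-identityʳ _)))
  D-Span n us {v} {vs} (addˢ {c} u∈ s e) = trans (D-linear n e us vs)
    (trans (+-cong (trans (*-congˡ (D-∈ n us u∈)) (zeroʳ c)) (D-Span n us s)) (+-identityʳ _))

  D-replace : ∀ n {ρ c u v w} us {vs} → Span (us ++ vs) v → w ≋ (λ k → c * u k + v k) →
              D n ρ (us ++ w ∷ vs) ≈ c * D n ρ (us ++ u ∷ vs)
  D-replace n us {vs} s e = trans (D-linear n e us vs) (trans (+-congˡ (D-Span n us s)) (+-identityʳ _))

  D-first-row : ∀ n {ρ u us} → All (λ v → v (ρ 0) ≈ 0#) us →
                D (suc n) ρ (u ∷ us) ≈ u (ρ 0) * D n (ρ ∘ suc) us
  D-first-row n {us = us} z = trans (+-congˡ (trans (-‿cong (trans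
    (expand-congAll (λ e _ → trans (*-congʳ e) (zeroˡ _)) z) (expand-zero us))) -0#≈0#)) (+-identityʳ _)

  D-zero-column : ∀ n {ρ u us} → (∀ i → u (ρ i) ≈ 0#) → D n ρ (u ∷ us) ≈ 0#
  D-zero-column zero    z = refl
  D-zero-column (suc n) {us = us} z = 0-0≈0 (trans (*-congʳ (z 0)) (zeroˡ _))
    (trans (expand-cong (λ v vs → trans (*-congˡ (D-zero-column n (z ∘ suc))) (zeroʳ _)) us)
           (expand-zero us))

  D-first-column : ∀ n {ρ u us} → (∀ i → u (ρ (suc i)) ≈ 0#) →
                   D (suc n) ρ (u ∷ us) ≈ u (ρ 0) * D n (ρ ∘ suc) us
  D-first-column n {us = us} z = trans (+-congˡ (trans (-‿cong (trans
    (expand-cong (λ v vs → trans (*-congˡ (D-zero-column n z)) (zeroʳ _)) us)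
    (expand-zero us))) -0#≈0#)) (+-identityʳ _)

  D-zero-first-row : ∀ n {ρ us} → All (λ v → v (ρ 0) ≈ 0#) us → D (suc n) ρ us ≈ 0#
  D-zero-first-row n {us = us} z =
    trans (expand-congAll (λ e _ → trans (*-congʳ e) (zeroˡ _)) z) (expand-zero us)

  D-zero-last-row : ∀ n {ρ us} → All (λ v → v (ρ n) ≈ 0#) us → D (suc n) ρ us ≈ 0#
  D-zero-last-row zero    {ρ} z = D-zero-first-row 0 {ρ} z
  D-zero-last-row (suc n) {ρ} {us} z = trans
    (expand-congAll (λ _ zs → trans (*-congˡ (D-zero-last-row n {ρ ∘ suc} zs)) (zeroʳ _)) z) (expand-zero us)

  expand-scale : ∀ c h us → expand (λ v vs → c * h v vs) us ≈ c * expand h us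
  expand-scale c h us = trans (expand-cong (λ _ _ → sym (+-identityʳ _)) us)
    (trans (expand-axpy c h (λ _ _ → 0#) us) (trans (+-congˡ (expand-zero us)) (+-identityʳ _)))

  private
    sign : ℕ → Carrier
    sign zero    = 1#
    sign (suc n) = - sign n

    sign-≈± : ∀ n a → sign n * a ≈± a
    sign-≈± zero    a = inj₁ (*-identityˡ a)
    sign-≈± (suc n) a = ≈±-trans (inj₂ (sym (-‿distribˡ-* _ _))) (sign-≈± n a)
      where open import Algebra.Properties.Ring ring using (-‿distribˡ-*)

    -- `D` expands along the first row only, so the last row is reached by induction: the minor
    -- without u has a zero last row, and the other minors keep u in front.
    D-last-row-sign : ∀ n {ρ u us} → All (λ v → v (ρ n) ≈ 0#) us →
                      D (suc n) ρ (u ∷ us) ≈ sign n * (u (ρ n) * D n ρ us)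
    D-last-row-sign zero {ρ} {u} {us} z = trans (D-first-row 0 {ρ} {u} z)
      (trans (*-congˡ (no-rows us)) (sym (*-identityˡ _)))
      where
      no-rows : ∀ us → D zero (ρ ∘ suc) us ≈ D zero ρ us
      no-rows []      = refl
      no-rows (_ ∷ _) = refl
    D-last-row-sign (suc n) {ρ} {u} {us} z = begin
      u (ρ 0) * D (suc n) (ρ ∘ suc) us - expand (λ v vs → v (ρ 0) * D (suc n) (ρ ∘ suc) (u ∷ vs)) us
        ≈⟨ +-cong (trans (*-congˡ (D-zero-last-row n {ρ ∘ suc} z)) (zeroʳ _)) (-‿cong
             (trans (expand-congAll (λ _ zs → trans (*-congˡ (D-last-row-sign n {ρ ∘ suc} zs))
                (solve 4 (λ x s y d → (x :* (s :* (y :* d))) := ((s :* y) :* (x :* d))) refl _ (sign n) (u (ρ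
                    (suc n))) _)) z)
               (expand-scale _ _ us))) ⟩
      0# - (sign n * u (ρ (suc n))) * D (suc n) ρ us
        ≈⟨ trans (+-identityˡ _) (solve 3 (λ s y d → (:- ((s :* y) :* d)) := (:- s :* (y :* d))) refl _ _ _) ⟩
      - sign n * (u (ρ (suc n)) * D (suc n) ρ us) ∎

  D-last-row : ∀ n {ρ u us} → All (λ v → v (ρ n) ≈ 0#) us →
               D (suc n) ρ (u ∷ us) ≈± u (ρ n) * D n ρ us
  D-last-row n {ρ} z = ≈±-trans (inj₁ (D-last-row-sign n {ρ} z)) (sign-≈± n _)

-- Products of powers of linear factors and their derivatives

module LinearFactors (R : CommutativeRing 0ℓ 0ℓ) where
  open CommutativeRing R hiding (zero)
  open Convolution R using (Seq; _≋_; const; _⊛_; const-⊛; ⊛-zeroˡ)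
  module S = CommutativeRing (powerSeries R)
  open Integers R
  open Integers (powerSeries R) using ()
    renaming (solve to solveˢ; _:=_ to _⊜_; _:+_ to _⊞_; _:*_ to _⊠_; :-_ to ⊟_)
  open import Algebra.Properties.Ring ring using (-0#≈0#)
  module SR = SetoidReasoning S.setoid
  open SetoidReasoning setoid

  X : Seq
  X zero    = 0#
  X (suc n) = const 1# n

  X-⊛-suc : ∀ u n → (X ⊛ u) (suc n) ≈ u n
  X-⊛-suc u n = trans (+-cong (zeroˡ _) (trans (const-⊛ 1# u n) (*-identityˡ _))) (+-identityˡ _)

  lin : Carrier → Seq
  lin a = X S.- const a

  lin-⊛ : ∀ a u → lin a ⊛ u ≋ (X ⊛ u) S.+ (λ n → - a * u n)
  lin-⊛ a u n = trans (S.distribʳ u X (S.- const a) n) (+-congˡ (begin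
    ((S.- const a) ⊛ u) n ≈⟨ solveˢ 2 (λ a u → ((⊟ a) ⊠ u) ⊜ (⊟ (a ⊠ u))) (λ _ → refl) (const a) u n ⟩
    - ((const a ⊛ u) n)   ≈⟨ -‿cong (const-⊛ a u n) ⟩
    - (a * u n)           ≈⟨ solve 2 (λ a u → (:- (a :* u)) := ((:- a) :* u)) refl a (u n) ⟩
    - a * u n ∎))

  lin-⊛-zero : ∀ a u → (lin a ⊛ u) 0 ≈ - a * u 0
  lin-⊛-zero a u = trans (lin-⊛ a u 0) (trans (+-congʳ (zeroˡ _)) (+-identityˡ _))

  lin-⊛-suc : ∀ a u n → (lin a ⊛ u) (suc n) ≈ u n + - a * u (suc n)
  lin-⊛-suc a u n = trans (lin-⊛ a u (suc n)) (+-congʳ (X-⊛-suc u n))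

  -- A polynomial is a series with vanishing tail, so degrees are asserted as bounds on the support
  -- instead of being computed.
  Monic : ℕ → Seq → Set
  Monic N u = u N ≈ 1# × (∀ n → N ℕ.< n → u n ≈ 0#)

  Deg< : ℕ → Seq → Set
  Deg< N u = ∀ n → N ℕ.≤ n → u n ≈ 0#

  Monic⇒Deg< : ∀ {N u} → Monic N u → Deg< (suc N) u
  Monic⇒Deg< (_ , z) n = z n

  Monic-cong : ∀ {N u v} → u ≋ v → Monic N u → Monic N v
  Monic-cong e (l , z) = trans (sym (e _)) l , λ n lt → trans (sym (e n)) (z n lt)

  private
    a+b0≈a : ∀ {a b c} → c ≈ 0# → a + b * c ≈ a
    a+b0≈a e = trans (+-congˡ (trans (*-congˡ e) (zeroʳ _))) (+-identityʳ _)

  Deg<-lin : ∀ {N u} a → Deg< N u → Deg< (suc N) (lin a ⊛ u)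
  Deg<-lin a z (suc n) (s≤s le) = trans (lin-⊛-suc a _ n)
    (trans (a+b0≈a (z (suc n) (ℕ.m≤n⇒m≤1+n le))) (z n le))

  Deg<-+ : ∀ {N u v} → Deg< N u → Deg< N v → Deg< N (u S.+ v)
  Deg<-+ y z n le = trans (+-cong (y n le) (z n le)) (+-identityˡ _)

  Deg<-const : ∀ {N u} c → Deg< N u → Deg< N (const c ⊛ u)
  Deg<-const c z n le = trans (const-⊛ c _ n) (trans (*-congˡ (z n le)) (zeroʳ c))

  Deg<-suc : ∀ {N u} → Deg< N u → Deg< (suc N) u
  Deg<-suc z n le = z n (ℕ.<⇒≤ le)

  Monic-lin : ∀ {N u} a → Monic N u → Monic (suc N) (lin a ⊛ u)
  Monic-lin {N} {u} a (l , z) = trans (lin-⊛-suc a u N) (trans (a+b0≈a (z _ ℕ.≤-refl)) l)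
                      , Deg<-lin a z

  pw : Carrier → ℕ → Seq
  pw a zero    = S.1#
  pw a (suc e) = lin a ⊛ pw a e

  Monic-pw : ∀ {N u} a e → Monic N u → Monic (e ℕ.+ N) (pw a e ⊛ u)
  Monic-pw a zero    m = Monic-cong (S.sym (S.*-identityˡ _)) m
  Monic-pw a (suc e) m = Monic-cong (S.sym (S.*-assoc _ _ _)) (Monic-lin a (Monic-pw a e m))

  xpow : ℕ → Seq → Seq
  xpow zero    u = u
  xpow (suc j) u = X ⊛ xpow j u

  xpow-X : ∀ j u → xpow j (X ⊛ u) ≡ xpow (suc j) u
  xpow-X zero    u = ≡.refl
  xpow-X (suc j) u = ≡.cong (X ⊛_) (xpow-X j u)

  xpow-+ : ∀ j u n → xpow j u (j ℕ.+ n) ≈ u n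
  xpow-+ zero    u n = refl
  xpow-+ (suc j) u n = trans (X-⊛-suc (xpow j u) (j ℕ.+ n)) (xpow-+ j u n)

  xpow-cong : ∀ j {u v} → u ≋ v → xpow j u ≋ xpow j v
  xpow-cong zero    e = e
  xpow-cong (suc j) e = S.*-congˡ (xpow-cong j e)

  xpow-Deg< : ∀ j {N u} → Deg< N u → Deg< (j ℕ.+ N) (xpow j u)
  xpow-Deg< zero    z = z
  xpow-Deg< (suc j) z (suc n) (s≤s le) = trans (X-⊛-suc _ n) (xpow-Deg< j z n le)

  xpow-lin : ∀ j a u → xpow j (lin a ⊛ u) ≋ xpow (suc j) u S.+ (λ n → - a * xpow j u n)
  xpow-lin zero    a u = lin-⊛ a u
  xpow-lin (suc j) a u = SR.begin
    X ⊛ xpow j (lin a ⊛ u)                                       SR.≈⟨ S.*-congˡ (xpow-lin j a u) ⟩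
    X ⊛ (xpow (suc j) u S.+ (λ n → - a * xpow j u n))            SR.≈⟨ S.distribˡ X _ _ ⟩
    X ⊛ xpow (suc j) u S.+ X ⊛ (λ n → - a * xpow j u n)          SR.≈⟨ S.+-congˡ (S.*-congˡ (S.sym (const-⊛
        (- a) _))) ⟩
    X ⊛ xpow (suc j) u S.+ X ⊛ (const (- a) ⊛ xpow j u)          SR.≈⟨ S.+-congˡ
      (solveˢ 3 (λ x a u → (x ⊠ (a ⊠ u)) ⊜ (a ⊠ (x ⊠ u))) (λ _ → refl) X (const (- a)) (xpow j u)) ⟩
    X ⊛ xpow (suc j) u S.+ const (- a) ⊛ (X ⊛ xpow j u)          SR.≈⟨ S.+-congˡ (const-⊛ (- a) _) ⟩
    xpow (suc (suc j)) u S.+ (λ n → - a * xpow (suc j) u n) SR.∎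

  pows : ℕ → Seq → List Seq
  pows zero    u = []
  pows (suc d) u = xpow d u ∷ pows d u

  pows-cong : ∀ d {u v} → u ≋ v → Pointwise _≋_ (pows d u) (pows d v)
  pows-cong zero    e = []
  pows-cong (suc d) e = xpow-cong d e ∷ pows-cong d e

  pows-suc : ∀ d u → pows (suc d) u ≡ pows d (X ⊛ u) ++ [ u ]
  pows-suc zero    u = ≡.refl
  pows-suc (suc d) u = ≡.cong₂ _∷_ (≡.sym (xpow-X d u)) (pows-suc d u)

  ∈-pows : ∀ {j d} u → j ℕ.< d → xpow j u ∈ pows d u
  ∈-pows {j} {suc d} u (s≤s le) with ℕ.m≤n⇒m<n∨m≡n le
  ... | inj₁ lt     = there (∈-pows u lt)
  ... | inj₂ ≡.refl = here ≡.refl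

  All-pows : ∀ {P : Seq → Set} {d u} → (∀ j → j ℕ.< d → P (xpow j u)) → All P (pows d u)
  All-pows {d = zero}  h = []
  All-pows {d = suc d} h = h d ℕ.≤-refl ∷ All-pows (λ j lt → h j (ℕ.m≤n⇒m≤1+n lt))

  der : Seq → Seq
  der u n = ι (suc n) * u (suc n)

  der-cong : ∀ {u v} → u ≋ v → der u ≋ der v
  der-cong e n = *-congˡ (e (suc n))

  der-lin : ∀ a u → der (lin a ⊛ u) ≋ u S.+ lin a ⊛ der u
  der-lin a u zero = begin
    ι 1 * (lin a ⊛ u) 1            ≈⟨ *-cong (+-identityʳ 1#) (lin-⊛-suc a u 0) ⟩
    1# * (u 0 + - a * u 1)         ≈⟨ *-identityˡ _ ⟩
    u 0 + - a * u 1                ≈⟨ +-congˡ (*-congˡ (trans (*-congʳ (+-identityʳ 1#)) (*-identityˡ _))) ⟨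
    u 0 + - a * (ι 1 * u 1)        ≈⟨ +-congˡ (lin-⊛-zero a (der u)) ⟨
    u 0 + (lin a ⊛ der u) 0 ∎
  der-lin a u (suc n) = begin
    (1# + ι (suc n)) * (lin a ⊛ u) (suc (suc n))      ≈⟨ *-congˡ (lin-⊛-suc a u (suc n)) ⟩
    (1# + ι (suc n)) * (u (suc n) + - a * u (suc (suc n)))
      ≈⟨ trans (solve 5 (λ o i x a y → ((o :+ i) :* (x :+ (:- a) :* y)) :=
                 (o :* x :+ (i :* x :+ (:- a) :* ((o :+ i) :* y)))) refl 1# (ι (suc n)) _ a _)
               (+-congʳ (*-identityˡ _)) ⟩
    u (suc n) + (der u n + - a * der u (suc n))       ≈⟨ +-congˡ (lin-⊛-suc a (der u) n) ⟨
    u (suc n) + (lin a ⊛ der u) (suc n) ∎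

  const-suc : ∀ n → const (ι (suc n)) ≋ S.1# S.+ const (ι n)
  const-suc n zero    = refl
  const-suc n (suc k) = sym (+-identityˡ _)

  const-* : ∀ a b → const (a * b) ≋ const a ⊛ const b
  const-* a b n = trans (help n) (sym (const-⊛ a (const b) n))
    where
    help : const (a * b) ≋ λ k → a * const b k
    help zero    = refl
    help (suc k) = sym (zeroʳ a)

  const-- : ∀ a b → const (a - b) ≋ const a S.- const b
  const-- a b zero    = refl
  const-- a b (suc n) = sym (trans (+-congˡ -0#≈0#) (+-identityʳ _))

  der-pw : ∀ a e u → der (pw a (suc e) ⊛ u) ≋ const (ι (suc e)) ⊛ (pw a e ⊛ u) S.+ pw a (suc e) ⊛ der u
  der-pw a zero u = SR.begin
    der ((lin a ⊛ S.1#) ⊛ u)     SR.≈⟨ der-cong (S.*-congʳ {u} (S.*-identityʳ (lin a))) ⟩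
    der (lin a ⊛ u)              SR.≈⟨ der-lin a u ⟩
    u S.+ lin a ⊛ der u          SR.≈⟨ S.+-cong
      (S.sym (S.trans (S.*-cong (λ { zero → +-identityʳ 1# ; (suc n) → refl }) (S.*-identityˡ u)) (S.*-identityˡ u)))
      (S.*-congʳ {der u} (S.sym (S.*-identityʳ (lin a)))) ⟩
    const (ι 1) ⊛ (S.1# ⊛ u) S.+ (lin a ⊛ S.1#) ⊛ der u SR.∎
  der-pw a (suc e) u = SR.begin
    der ((lin a ⊛ P) ⊛ u)      SR.≈⟨ der-cong (S.*-assoc (lin a) P u) ⟩
    der (lin a ⊛ (P ⊛ u))      SR.≈⟨ der-lin a (P ⊛ u) ⟩
    P ⊛ u S.+ lin a ⊛ der (P ⊛ u) SR.≈⟨ S.+-congˡ {P ⊛ u} (S.*-congˡ {lin a} (der-pw a e u)) ⟩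
    P ⊛ u S.+ lin a ⊛ (const (ι (suc e)) ⊛ (pw a e ⊛ u) S.+ P ⊛ der u)
      SR.≈⟨ S.+-congʳ (S.sym (S.*-identityˡ (P ⊛ u))) ⟩
    S.1# ⊛ (P ⊛ u) S.+ lin a ⊛ (const (ι (suc e)) ⊛ (pw a e ⊛ u) S.+ P ⊛ der u)
      SR.≈⟨ solveˢ 6 (λ o l c q u v → (o ⊠ ((l ⊠ q) ⊠ u) ⊞ l ⊠ (c ⊠ (q ⊠ u) ⊞ (l ⊠ q) ⊠ v))
                  ⊜ ((o ⊞ c) ⊠ ((l ⊠ q) ⊠ u) ⊞ (l ⊠ (l ⊠ q)) ⊠ v))
            (λ _ → refl) S.1# (lin a) (const (ι (suc e))) (pw a e) u (der u) ⟩
    (S.1# S.+ const (ι (suc e))) ⊛ (P ⊛ u) S.+ (lin a ⊛ P) ⊛ der u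
      SR.≈⟨ S.+-congʳ {(lin a ⊛ P) ⊛ der u} (S.*-congʳ {P ⊛ u} (S.sym (const-suc (suc e)))) ⟩
    const (ι (suc (suc e))) ⊛ (P ⊛ u) S.+ (lin a ⊛ P) ⊛ der u SR.∎
    where P = pw a (suc e)

  Factors : Set
  Factors = List (Carrier × ℕ)

  P : Factors → Seq
  P []            = S.1#
  P ((y , e) ∷ L) = pw y e ⊛ P L

  rad : Factors → Seq
  rad []            = S.1#
  rad ((y , e) ∷ L) = lin y ⊛ rad L

  degP : Factors → ℕ
  degP []            = 0
  degP ((y , e) ∷ L) = e ℕ.+ degP L

  diffs : Carrier → List Carrier → Carrier
  diffs a []       = 1#
  diffs a (y ∷ ys) = (a - y) * diffs a ys

  Δ : List Carrier → Carrier
  Δ []       = 1#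
  Δ (x ∷ xs) = diffs x xs * Δ xs

  roots : Factors → List Carrier
  roots = map proj₁

  Monic-1 : Monic 0 S.1#
  Monic-1 = refl , λ { (suc n) _ → refl }

  Monic-P : ∀ L → Monic (degP L) (P L)
  Monic-P []            = Monic-1
  Monic-P ((y , e) ∷ L) = Monic-pw y e (Monic-P L)

  Monic-rad : ∀ L → Monic (length L) (rad L)
  Monic-rad []            = Monic-1
  Monic-rad ((y , e) ∷ L) = Monic-lin y (Monic-rad L)

  private
    merge : ∀ y e h H → (lin y ⊛ h) ⊛ (pw y e ⊛ H) ≋ pw y (suc e) ⊛ (h ⊛ H)
    merge y e h H = solveˢ 4 (λ l h q H → ((l ⊠ h) ⊠ (q ⊠ H)) ⊜ ((l ⊠ q) ⊠ (h ⊠ H)))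
      (λ _ → refl) (lin y) h (pw y e) H

  Monic-radP : ∀ L → Monic (length L ℕ.+ degP L) (rad L ⊛ P L)
  Monic-radP []            = Monic-cong (S.sym (S.*-identityˡ S.1#)) Monic-1
  Monic-radP ((y , e) ∷ L) = ≡.subst (λ N → Monic N (rad ((y , e) ∷ L) ⊛ P ((y , e) ∷ L)))
    (≡.cong suc (ℕ+.x∙yz≈y∙xz e (length L) (degP L)))
    (Monic-cong (S.sym (merge y e (rad L) (P L))) (Monic-pw y (suc e) (Monic-radP L)))
    where import Algebra.Properties.CommutativeSemigroup ℕ.+-commutativeSemigroup as ℕ+

  -- Every exponent in `rad L ⊛ P L` is one larger than in `P L`, so each term of the product rule
  -- still contains `P L`. The cofactor is a sum of products with one linear factor of `rad L`
  -- missing, which bounds its degree.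
  log-derivative : ∀ L → ∃ λ q → Deg< (length L) q × der (rad L ⊛ P L) ≋ q ⊛ P L
  log-derivative [] = S.0# , (λ _ _ → refl) ,
    λ n → trans (*-congˡ (trans (S.*-identityˡ S.1# (suc n)) refl))
            (trans (zeroʳ _) (sym (⊛-zeroˡ S.1# n)))
  log-derivative ((y , e) ∷ L) with log-derivative L
  ... | q , dq , eq = const (ι (suc e)) ⊛ rad L S.+ lin y ⊛ q
    , Deg<-+ (Deg<-const (ι (suc e)) (Monic⇒Deg< (Monic-rad L))) (Deg<-lin y dq)
    , (SR.begin
      der ((lin y ⊛ rad L) ⊛ (pw y e ⊛ P L)) SR.≈⟨ der-cong (merge y e (rad L) (P L)) ⟩
      der (pw y (suc e) ⊛ (rad L ⊛ P L))     SR.≈⟨ der-pw y e (rad L ⊛ P L) ⟩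
      const (ι (suc e)) ⊛ (pw y e ⊛ (rad L ⊛ P L)) S.+ pw y (suc e) ⊛ der (rad L ⊛ P L)
        SR.≈⟨ S.+-congˡ {const (ι (suc e)) ⊛ (pw y e ⊛ (rad L ⊛ P L))} (S.*-congˡ {pw y (suc e)} eq) ⟩
      const (ι (suc e)) ⊛ (pw y e ⊛ (rad L ⊛ P L)) S.+ pw y (suc e) ⊛ (q ⊛ P L)
        SR.≈⟨ solveˢ 6 (λ c w h H l q → (c ⊠ (w ⊠ (h ⊠ H)) ⊞ (l ⊠ w) ⊠ (q ⊠ H))
                                 ⊜ ((c ⊠ h ⊞ l ⊠ q) ⊠ (w ⊠ H))) (λ _ → refl)
              (const (ι (suc e))) (pw y e) (rad L) (P L) (lin y) q ⟩
      (const (ι (suc e)) ⊛ rad L S.+ lin y ⊛ q) ⊛ (pw y e ⊛ P L) SR.∎)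

  -- The constant is the value of `rad L` at a. The rest is divisible by x - a, so that after
  -- multiplication by F it is a combination of the columns X^j (x - a)F.
  division : ∀ a L → ∃ λ q → Deg< (length L) q × rad L ≋ const (diffs a (roots L)) S.+ lin a ⊛ q
  division a [] = S.0# , (λ _ _ → refl) ,
    S.sym (S.trans (S.+-congˡ {const 1#} (S.zeroʳ (lin a))) (S.+-identityʳ (const 1#)))
  division a ((y , e) ∷ L) with division a L
  ... | q , dq , eq = rad L S.+ const (a - y) ⊛ q
    , Deg<-+ (Monic⇒Deg< (Monic-rad L)) (Deg<-suc (Deg<-const (a - y) dq))
    , (SR.begin
      lin y ⊛ rad L
        SR.≈⟨ solveˢ 4 (λ x a y h → ((x ⊞ ⊟ y) ⊠ h) ⊜ ((x ⊞ ⊟ a) ⊠ h ⊞ (a ⊞ ⊟ y) ⊠ h))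
              (λ _ → refl) X (const a) (const y) (rad L) ⟩
      lin a ⊛ rad L S.+ (const a S.- const y) ⊛ rad L
        SR.≈⟨ S.+-congˡ {lin a ⊛ rad L} (S.*-cong (S.sym (const-- a y)) eq) ⟩
      lin a ⊛ rad L S.+ const (a - y) ⊛ (const (diffs a (roots L)) S.+ lin a ⊛ q)
        SR.≈⟨ solveˢ 5 (λ l h d c q → (l ⊠ h ⊞ d ⊠ (c ⊞ l ⊠ q)) ⊜ (d ⊠ c ⊞ l ⊠ (h ⊞ d ⊠ q)))
              (λ _ → refl) (lin a) (rad L) (const (a - y)) (const (diffs a (roots L))) q ⟩
      const (a - y) ⊛ const (diffs a (roots L)) S.+ lin a ⊛ (rad L S.+ const (a - y) ⊛ q)
        SR.≈⟨ S.+-congʳ {lin a ⊛ (rad L S.+ const (a - y) ⊛ q)} (S.sym (const-* (a - y) (diffs a (roots L)))) ⟩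
      const ((a - y) * diffs a (roots L)) S.+ lin a ⊛ (rad L S.+ const (a - y) ⊛ q) SR.∎)

-- The recurrence in one exponent in characteristic p

module Step (R : CommutativeRing 0ℓ 0ℓ) (n : ℕ)
            (char : CommutativeRing._≈_ R (Integers.ι R (suc n)) (CommutativeRing.0# R)) where
  open CommutativeRing R hiding (zero)
  open Convolution R using (Seq; _≋_; const; _⊛_; const-⊛; ⊛-zeroˡ)
  open Integers R
  open Signs R
  open Determinants R
  open LinearFactors R
  open SetoidReasoning setoid

  -- This is (i + 1)p - 1, in a form for which `suc (φ i)` reduces to `suc i * suc n`, the factor
  -- that kills the derivative.
  φ : ℕ → ℕ
  φ i = n ℕ.+ i ℕ.* suc n

  Mdet : Seq → ℕ → Carrier
  Mdet F d = D d φ (pows d F)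

  Mdet-cong : ∀ {F G} d → F ≋ G → Mdet F d ≈ Mdet G d
  Mdet-cong d e = D-cong d {φ} (pows-cong d e)

  der-φ : ∀ G i → der G (φ i) ≈ 0#
  der-φ G i = trans (*-congʳ (trans (ι-* (suc i) (suc n)) (trans (*-congˡ char) (zeroʳ _)))) (zeroˡ _)

  -- Horner's scheme: q = q 0 + X q′ moves one power of X from q to the column, so the m
  -- coefficients of q use the columns X^k V, ..., X^(k+m-1) V.
  Span-⊛ : ∀ {us V} m k q → Deg< m q → (∀ j → j ℕ.< k ℕ.+ m → xpow j V ∈ us) →
           Span us (q ⊛ xpow k V)
  Span-⊛ zero k q dq V∈ = zeroˢ (S.trans (S.*-congʳ {xpow k _} (λ i → dq i z≤n)) (⊛-zeroˡ _))
  Span-⊛ {us} {V} (suc m) k q dq V∈ = addˢ (V∈ k (ℕ.m<m+n k (s≤s z≤n)))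
    (Span-⊛ m (suc k) (q ∘ suc) (λ i le → dq (suc i) (s≤s le))
      (λ j lt → V∈ j (≡.subst (j ℕ.<_) (≡.sym (ℕ.+-suc k m)) lt)))
    (SR.begin
      q ⊛ W                                  SR.≈⟨ S.*-congʳ {W} split ⟩
      (const (q 0) S.+ X ⊛ (q ∘ suc)) ⊛ W    SR.≈⟨ solveˢ 4 (λ c x q w → ((c ⊞ x ⊠ q) ⊠ w) ⊜ (c ⊠ w ⊞ q ⊠ (x ⊠ w)))
                                                   (λ _ → refl) (const (q 0)) X (q ∘ suc) W ⟩
      const (q 0) ⊛ W S.+ (q ∘ suc) ⊛ (X ⊛ W) SR.≈⟨ S.+-congʳ {(q ∘ suc) ⊛ (X ⊛ W)} (const-⊛ (q 0) W) ⟩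
      (λ i → q 0 * W i + ((q ∘ suc) ⊛ (X ⊛ W)) i) SR.∎)
    where
    open Integers (powerSeries R) using ()
      renaming (solve to solveˢ; _:=_ to _⊜_; _:+_ to _⊞_; _:*_ to _⊠_)
    W : Seq
    W = xpow k V
    split : q ≋ const (q 0) S.+ X ⊛ (q ∘ suc)
    split zero    = sym (trans (+-congˡ (zeroˡ _)) (+-identityʳ _))
    split (suc i) = sym (trans (+-identityˡ _) (X-⊛-suc (q ∘ suc) i))

  -- Since X^m (X - a)F = X^(m+1) F - a X^m F, this column may become X^(m+1) F as soon as X^m F is
  -- another column. The lower columns are converted first to provide it; for m = 0 it is F itself.
  D-pows-lin : ∀ N {ρ} m a {F us} → F ∈ us → D N ρ (us ++ pows m (lin a ⊛ F)) ≈ D N ρ (us ++ pows m (X ⊛ F))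
  D-pows-lin N zero a F∈ = refl
  D-pows-lin N {ρ} (suc m) a {F} {us} F∈ = begin
    D N ρ (us ++ U ∷ pows m (lin a ⊛ F))         ≡⟨ ≡.cong (D N ρ) (List.++-assoc us [ U ] _) ⟨
    D N ρ ((us ++ [ U ]) ++ pows m (lin a ⊛ F))  ≈⟨ D-pows-lin N m a (∈-++⁺ˡ F∈) ⟩
    D N ρ ((us ++ [ U ]) ++ pows m (X ⊛ F))      ≡⟨ ≡.cong (D N ρ) (List.++-assoc us [ U ] _) ⟩
    D N ρ (us ++ U ∷ pows m (X ⊛ F))
      ≈⟨ D-replace N us (addˢ (mem m) (zeroˢ {v = λ _ → 0#} (λ _ → refl)) (λ _ → sym (+-identityʳ _)))
           (S.trans (xpow-lin m a F) (λ i → +-congʳ (sym (*-identityˡ _)))) ⟩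
    1# * D N ρ (us ++ xpow (suc m) F ∷ pows m (X ⊛ F)) ≈⟨ *-identityˡ _ ⟩
    D N ρ (us ++ xpow (suc m) F ∷ pows m (X ⊛ F))
      ≡⟨ ≡.cong (λ V → D N ρ (us ++ V ∷ pows m (X ⊛ F))) (xpow-X m F) ⟨
    D N ρ (us ++ pows (suc m) (X ⊛ F)) ∎
    where
    U : Seq
    U = xpow m (lin a ⊛ F)
    mem : ∀ m → xpow m F ∈ us ++ pows m (X ⊛ F)
    mem zero    = ∈-++⁺ˡ F∈
    mem (suc m) = ∈-++⁺ʳ us (here (≡.sym (xpow-X m F)))

  -- The determinant with columns Y, X^{m-1}V, …, V, where V = (X - a)F and Y is
  -- the derivative of (X - a) · rad · F, and with the extra row N = deg F + m, is
  -- computed in two ways: Y vanishes in the rows φ i, and Y is congruent to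
  -- (e + 1) ∏ (a - y) · F modulo the other columns.
  step : ∀ a e L → let m = length L in
         ι (suc (e ℕ.+ (m ℕ.+ degP L))) * Mdet (lin a ⊛ (pw a e ⊛ P L)) m
           ≈± (ι (suc e) * diffs a (roots L)) * Mdet (pw a e ⊛ P L) m
  step a e L = ≈±-trans (inj₁ (trans (sym byY) byF)) (≈±-*ˡ κ toF)
    where
    open Integers (powerSeries R) using ()
      renaming (solve to solveˢ; _:=_ to _⊜_; _:+_ to _⊞_; _:*_ to _⊠_)
    m = length L
    N = e ℕ.+ (m ℕ.+ degP L)
    F V G Y : Seq
    F = pw a e ⊛ P L
    V = lin a ⊛ F
    G = pw a (suc e) ⊛ (rad L ⊛ P L)
    Y = der G
    κ = ι (suc e) * diffs a (roots L)
    ρ : ℕ → ℕ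
    ρ zero    = N
    ρ (suc i) = φ i
    mF : Monic (e ℕ.+ degP L) F
    mF = Monic-pw a e (Monic-P L)
    mG : Monic (suc N) G
    mG = Monic-pw a (suc e) (Monic-radP L)

    N≡ : N ≡ m ℕ.+ (e ℕ.+ degP L)
    N≡ = ℕ+.x∙yz≈y∙xz e m (degP L)
      where import Algebra.Properties.CommutativeSemigroup ℕ.+-commutativeSemigroup as ℕ+

    -- In the presence of F the columns X^j V may be replaced by X^(j+1) F. Among the resulting X^m
    -- F, ..., F only the monic X^m F reaches the degree N of the extra row.
    toF : D (suc m) ρ (F ∷ pows m V) ≈± Mdet F m
    toF = ≈±-trans (inj₁ (D-pows-lin (suc m) {ρ} m a {us = [ F ]} (here ≡.refl)))
      (≈±-trans (D-↭ (suc m) {ρ} (↭-trans (∷↭∷ʳ F (pows m (X ⊛ F))) (↭-reflexive (≡.sym (pows-suc m F)))))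
      (inj₁ (trans (D-first-row m {ρ} (All-pows low))
        (trans (*-congʳ (trans (reflexive (≡.cong (xpow m F) N≡)) (trans (xpow-+ m F _) (proj₁ mF))))
          (*-identityˡ _)))))
      where
      low : ∀ j → j ℕ.< m → xpow j F N ≈ 0#
      low j lt = xpow-Deg< j (Monic⇒Deg< mF) N (ℕ.≤-trans
        (ℕ.≤-reflexive (ℕ.+-suc j _)) (ℕ.≤-trans (ℕ.+-monoˡ-≤ _ lt) (ℕ.≤-reflexive (≡.sym N≡))))

    byY : D (suc m) ρ (Y ∷ pows m V) ≈ ι (suc N) * Mdet V m
    byY = trans (D-first-column m {ρ} {Y} {pows m V} (der-φ G))
      (*-congʳ (trans (*-congˡ (proj₁ mG)) (*-identityʳ _)))

    byF : D (suc m) ρ (Y ∷ pows m V) ≈ κ * D (suc m) ρ (F ∷ pows m V)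
    byF with log-derivative L | division a L
    ... | q , dq , eq | q₂ , dq₂ , eq₂ = D-replace (suc m) {ρ} []
      (Span-⊛ {V = V} m 0 Q (Deg<-+ (Deg<-const (ι (suc e)) dq₂) dq) (λ j lt → ∈-pows V lt))
      (SR.begin
        Y SR.≈⟨ der-pw a e (rad L ⊛ P L) ⟩
        const (ι (suc e)) ⊛ (pw a e ⊛ (rad L ⊛ P L)) S.+ pw a (suc e) ⊛ der (rad L ⊛ P L)
          SR.≈⟨ S.+-cong (S.*-congˡ {const (ι (suc e))} (S.*-congˡ {pw a e} (S.*-congʳ {P L} eq₂)))
                         (S.*-congˡ {pw a (suc e)} eq) ⟩
        const (ι (suc e)) ⊛ (pw a e ⊛ ((const c S.+ lin a ⊛ q₂) ⊛ P L)) S.+ pw a (suc e) ⊛ (q ⊛ P L)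
          SR.≈⟨ solveˢ 7 (λ i w c l r H q → (i ⊠ (w ⊠ ((c ⊞ l ⊠ r) ⊠ H)) ⊞ (l ⊠ w) ⊠ (q ⊠ H))
                                     ⊜ ((i ⊠ c) ⊠ (w ⊠ H) ⊞ (i ⊠ r ⊞ q) ⊠ (l ⊠ (w ⊠ H))))
                (λ _ → refl) (const (ι (suc e))) (pw a e) (const c) (lin a) q₂ (P L) q ⟩
        (const (ι (suc e)) ⊛ const c) ⊛ F S.+ Q ⊛ V
          SR.≈⟨ S.+-congʳ {Q ⊛ V} (S.trans (S.*-congʳ {F} (S.sym (const-* (ι (suc e)) c))) (const-⊛ κ F)) ⟩
        (λ k → κ * F k + (Q ⊛ V) k) SR.∎)
      where
      c = diffs a (roots L)
      Q : Seq
      Q = const (ι (suc e)) ⊛ q₂ S.+ q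

  -- The equation amounts to M = (d + 1)n and places the leading coefficient of X^d F exactly in the
  -- last row.
  top-row : ∀ {F M} d → Monic M F → φ d ≡ d ℕ.+ M → Mdet F (suc d) ≈± Mdet F d
  top-row {F} {M} d mF eq = ≈±-trans (D-last-row d {φ} (All-pows low))
    (inj₁ (trans (*-congʳ (trans (reflexive (≡.cong (xpow d F) eq)) (trans (xpow-+ d F M) (proj₁ mF))))
      (*-identityˡ _)))
    where
    low : ∀ j → j ℕ.< d → xpow j F (φ d) ≈ 0#
    low j lt = xpow-Deg< j (Monic⇒Deg< mF) (φ d) (ℕ.≤-trans
      (ℕ.≤-reflexive (ℕ.+-suc j M)) (ℕ.≤-trans (ℕ.+-monoˡ-≤ M lt) (ℕ.≤-reflexive (≡.sym eq))))

-- Proportionality by constants prime to p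

module PrimeNat (n : ℕ) (prime : Prime (suc n)) where
  p = suc n

  p∤*  : ∀ {s t} → ¬ p ∣ s → ¬ p ∣ t → ¬ p ∣ s ℕ.* t
  p∤* {s} {t} ¬s ¬t d = [ ¬s , ¬t ]′ (euclidsLemma s t prime d)

  small∤ : ∀ {s} → 1 ℕ.≤ s → s ℕ.≤ n → ¬ p ∣ s
  small∤ {suc s} _ le d = ℕ.<-irrefl ≡.refl (ℕ.≤-trans (s≤s le) (∣⇒≤ d))

  1≤n : 1 ℕ.≤ n
  1≤n with ℕ.nonTrivial⇒n>1 (suc n) ⦃ prime⇒nonTrivial prime ⦄
  ... | s≤s le = le

  1∤ : ¬ p ∣ 1
  1∤ = small∤ ℕ.≤-refl 1≤n

  n∤ : ¬ p ∣ n
  n∤ = small∤ 1≤n ℕ.≤-refl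

  +-multiple∤ : ∀ {s} c → ¬ p ∣ s → ¬ p ∣ (s ℕ.+ c ℕ.* p)
  +-multiple∤ {s} c ¬s d = ¬s (∣m+n∣m⇒∣n (≡.subst (p ∣_) (ℕ.+-comm s _) d) (divides c ≡.refl))

  complement∤ : ∀ {s t} c → t ℕ.+ s ≡ c ℕ.* p → ¬ p ∣ s → ¬ p ∣ t
  complement∤ {s} {t} c eq ¬s d = ¬s (∣m+n∣m⇒∣n (divides c eq) d)

module Associates (R : CommutativeRing 0ℓ 0ℓ) (n : ℕ) (prime : Prime (suc n))
            (char : CommutativeRing._≈_ R (Integers.ι R (suc n)) (CommutativeRing.0# R)) where
  open CommutativeRing R hiding (zero)
  open PrimeNat n prime
  open Integers R
  open Signs R
  open SetoidReasoning setoid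
  open import Algebra.Properties.Ring ring using (x≈z//y)
  open import Algebra.Properties.Semiring.Exp semiring using (_^_)

  infix 4 _∼_

  _∼_ : Carrier → Carrier → Set
  a ∼ b = ∃ λ s → ∃ λ t → ¬ p ∣ s × ¬ p ∣ t × ι s * a ≈ ι t * b

  ι1* : ∀ x → ι 1 * x ≈ x
  ι1* x = trans (*-congʳ (+-identityʳ 1#)) (*-identityˡ x)

  scaled-∼ : ∀ {s t a b} → ¬ p ∣ s → ¬ p ∣ t → ι s * a ≈ ι t * b → a ∼ b
  scaled-∼ ¬s ¬t e = _ , _ , ¬s , ¬t , e

  ≈⇒∼ : ∀ {a b} → a ≈ b → a ∼ b
  ≈⇒∼ e = scaled-∼ 1∤ 1∤ (*-congˡ e)

  ∼-refl : ∀ {a} → a ∼ a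
  ∼-refl = ≈⇒∼ refl

  ∼-sym : ∀ {a b} → a ∼ b → b ∼ a
  ∼-sym (s , t , ¬s , ¬t , e) = t , s , ¬t , ¬s , sym e

  ∼-trans : ∀ {a b c} → a ∼ b → b ∼ c → a ∼ c
  ∼-trans {a} {b} {c} (s , t , ¬s , ¬t , e) (s′ , t′ , ¬s′ , ¬t′ , e′) =
    s′ ℕ.* s , t ℕ.* t′ , p∤* ¬s′ ¬s , p∤* ¬t ¬t′ , (begin
      ι (s′ ℕ.* s) * a   ≈⟨ trans (*-congʳ (ι-* s′ s)) (*-assoc _ _ _) ⟩
      ι s′ * (ι s * a)   ≈⟨ *-congˡ e ⟩
      ι s′ * (ι t * b)   ≈⟨ solve 3 (λ x y z → (x :* (y :* z)) := (y :* (x :* z))) refl _ _ _ ⟩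
      ι t * (ι s′ * b)   ≈⟨ *-congˡ e′ ⟩
      ι t * (ι t′ * c)   ≈⟨ trans (*-congʳ (ι-* t t′)) (*-assoc _ _ _) ⟨
      ι (t ℕ.* t′) * c ∎)

  ∼-* : ∀ {a b c d} → a ∼ b → c ∼ d → a * c ∼ b * d
  ∼-* {a} {b} {c} {d} (s , t , ¬s , ¬t , e) (s′ , t′ , ¬s′ , ¬t′ , e′) =
    s ℕ.* s′ , t ℕ.* t′ , p∤* ¬s ¬s′ , p∤* ¬t ¬t′ , (begin
      ι (s ℕ.* s′) * (a * c)   ≈⟨ *-congʳ (ι-* s s′) ⟩
      ι s * ι s′ * (a * c)     ≈⟨ swap4 _ _ _ _ ⟩
      ι s * a * (ι s′ * c)     ≈⟨ *-cong e e′ ⟩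
      ι t * b * (ι t′ * d)     ≈⟨ swap4 _ _ _ _ ⟩
      ι t * ι t′ * (b * d)     ≈⟨ *-congʳ (ι-* t t′) ⟨
      ι (t ℕ.* t′) * (b * d) ∎)
    where
    swap4 : ∀ w x y z → w * x * (y * z) ≈ w * y * (x * z)
    swap4 = solve 4 (λ w x y z → (w :* x :* (y :* z)) := (w :* y :* (x :* z))) refl

  ∼-^ : ∀ k {a b} → a ∼ b → a ^ k ∼ b ^ k
  ∼-^ zero    e = ∼-refl
  ∼-^ (suc k) e = ∼-* e (∼-^ k e)

  -- As n + 1 vanishes, -1 is the number n, which is prime to p; this makes signs a case of `∼`.
  -1≈ιn : ∀ x → - x ≈ ι n * x
  -1≈ιn x = sym (trans (x≈z//y _ _ _ (begin
    ι n * x + x        ≈⟨ +-congˡ (*-identityˡ x) ⟨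
    ι n * x + 1# * x   ≈⟨ solve 3 (λ i x o → (i :* x :+ o :* x) := ((o :+ i) :* x)) refl (ι n) x 1# ⟩
    ι p * x            ≈⟨ *-congʳ char ⟩
    0# * x             ≈⟨ zeroˡ x ⟩
    0# ∎)) (+-identityˡ _))

  ≈±⇒∼ : ∀ {a b} → a ≈± b → a ∼ b
  ≈±⇒∼ (inj₁ e) = ≈⇒∼ e
  ≈±⇒∼ (inj₂ e) = scaled-∼ 1∤ n∤ (trans (ι1* _) (trans e (-1≈ιn _)))

-- Raising and lowering the exponents

module Recursion (R : CommutativeRing 0ℓ 0ℓ) (n : ℕ) (prime : Prime (suc n))
            (char : CommutativeRing._≈_ R (Integers.ι R (suc n)) (CommutativeRing.0# R)) where
  open CommutativeRing R hiding (zero)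
  open Convolution R using (_≋_; _⊛_)
  open PrimeNat n prime
  open Integers R
  open Signs R
  open Determinants R using (D)
  open LinearFactors R
  open Step R n char
  open Associates R n prime char
  open import Algebra.Properties.Semiring.Exp semiring using (_^_)
  open import Algebra.Properties.CommutativeSemiring.Exp commutativeSemiring using (^-distrib-*)
  open SetoidReasoning setoid

  -- The two conditions concern the numbers in `step`: the increased exponent of a on the right and
  -- the sum over all roots on the left. Both must be prime to p for a step to be a proportionality.
  chain : ∀ a L s e →
    (∀ k → e ℕ.≤ k → k ℕ.< s ℕ.+ e → ¬ p ∣ suc k × ¬ p ∣ suc (k ℕ.+ (length L ℕ.+ degP L))) →
    Mdet (pw a (s ℕ.+ e) ⊛ P L) (length L) ∼ diffs a (roots L) ^ s * Mdet (pw a e ⊛ P L) (length L)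
  chain a L zero    e ok = ≈⇒∼ (sym (*-identityˡ _))
  chain a L (suc s) e ok = ∼-trans once (∼-trans
    (∼-* ∼-refl (chain a L s e (λ k le lt → ok k le (ℕ.m≤n⇒m≤1+n lt)))) (≈⇒∼ (sym (*-assoc _ _ _))))
    where
    k = s ℕ.+ e
    m = length L
    c = diffs a (roots L)
    once : Mdet (pw a (suc k) ⊛ P L) m ∼ c * Mdet (pw a k ⊛ P L) m
    once with ok k (ℕ.m≤n+m e s) ℕ.≤-refl
    ... | ¬1 , ¬2 = ∼-trans
      (scaled-∼ ¬2 1∤ (trans (*-congˡ (Mdet-cong m (S.*-assoc (lin a) (pw a k) (P L)))) (sym (ι1* _))))
      (∼-trans (≈±⇒∼ (step a k L)) (scaled-∼ 1∤ ¬1 (trans (ι1* _) (*-assoc _ _ _))))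

  withExp : ℕ → List Carrier → Factors
  withExp e = map (_, e)

  roots-withExp : ∀ e xs → roots (withExp e xs) ≡ xs
  roots-withExp e xs = ≡.trans (≡.sym (List.map-∘ xs)) (List.map-id xs)

  degP-++ : ∀ L L′ → degP (L ++ L′) ≡ degP L ℕ.+ degP L′
  degP-++ []            L′ = ≡.refl
  degP-++ ((y , e) ∷ L) L′ = ≡.trans (≡.cong (e ℕ.+_) (degP-++ L L′)) (≡.sym (ℕ.+-assoc e _ _))

  degP-withExp : ∀ e xs → degP (withExp e xs) ≡ length xs ℕ.* e
  degP-withExp e []       = ≡.refl
  degP-withExp e (x ∷ xs) = ≡.cong (e ℕ.+_) (degP-withExp e xs)

  P-↭ : ∀ {L L′} → L ↭ L′ → P L ≋ P L′
  P-↭ Perm.refl                    = S.refl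
  P-↭ (prep (y , e) q)             = S.*-congˡ (P-↭ q)
  P-↭ (swap {L} {L′} (y , e) (z , f) q) = S.trans
    (S.*-congˡ {pw y e} (S.*-congˡ {pw z f} (P-↭ q)))
    (solveˢ 3 (λ a b c → (a ⊠ (b ⊠ c)) ⊜ (b ⊠ (a ⊠ c))) (λ _ → refl) (pw y e) (pw z f) (P L′))
    where open Integers (powerSeries R) using () renaming (solve to solveˢ; _:=_ to _⊜_; _:*_ to _⊠_)
  P-↭ (Perm.trans q r)             = S.trans (P-↭ q) (P-↭ r)

  -- The exponent of x is traced back to 0, where this root disappears. The m remaining roots give
  -- degree m(p - 1), so M_m shrinks to M_(m-1) and the induction on the roots continues.
  base : ∀ x xs → Mdet (P (withExp n (x ∷ xs))) (length xs) ∼ Δ (x ∷ xs) ^ n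
  base x xs = ∼-trans first (∼-trans (∼-* ∼-refl (rest xs)) (≈⇒∼ (sym (^-distrib-* (diffs x xs) (Δ xs) n))))
    where
    L = withExp n xs
    len : length L ≡ length xs
    len = List.length-map _ xs
    ok : ∀ k → 0 ℕ.≤ k → k ℕ.< n ℕ.+ 0 → ¬ p ∣ suc k × ¬ p ∣ suc (k ℕ.+ (length L ℕ.+ degP L))
    ok k _ lt = k∤ , ≡.subst (λ m → ¬ p ∣ m) eq (+-multiple∤ (length xs) k∤)
      where
      k∤ : ¬ p ∣ suc k
      k∤ = small∤ (s≤s z≤n) (≡.subst (k ℕ.<_) (ℕ.+-identityʳ n) lt)
      -- The multiplier is k + 1 + m + m(p - 1), which is k + 1 modulo p.
      eq : suc k ℕ.+ length xs ℕ.* p ≡ suc (k ℕ.+ (length L ℕ.+ degP L))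
      eq = ≡.cong (λ m → suc (k ℕ.+ m)) (≡.trans (ℕ.*-suc (length xs) n)
        (≡.cong₂ ℕ._+_ (≡.sym len) (≡.sym (degP-withExp n xs))))
    first : Mdet (pw x n ⊛ P L) (length xs) ∼ diffs x xs ^ n * Mdet (P L) (length xs)
    first = ≡.subst₂ (λ m ys → Mdet (pw x n ⊛ P L) m ∼ diffs x ys ^ n * Mdet (P L) m) len (roots-withExp n xs)
      (∼-trans (≡.subst (λ s → Mdet (pw x n ⊛ P L) (length L) ∼ Mdet (pw x s ⊛ P L) (length L))
                 (≡.sym (ℕ.+-identityʳ n)) ∼-refl)
        (∼-trans (chain x L n 0 ok) (∼-* ∼-refl (≈⇒∼ (Mdet-cong (length L) (S.*-identityˡ (P L)))))))
    rest : ∀ xs → Mdet (P (withExp n xs)) (length xs) ∼ Δ xs ^ n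
    rest []       = ≈⇒∼ (sym (1^ n))
      where
      1^ : ∀ k → 1# ^ k ≈ 1#
      1^ zero    = refl
      1^ (suc k) = trans (*-identityˡ _) (1^ k)
    rest (y ∷ ys) = ∼-trans (≈±⇒∼ (top-row (length ys) (Monic-P (withExp n (y ∷ ys)))
      (≡.trans (eq (length ys) n) (≡.cong (λ d → length ys ℕ.+ d) (≡.sym (degP-withExp n (y ∷ ys)))))))
      (base y ys)
      where
      eq : ∀ d n → n ℕ.+ d ℕ.* suc n ≡ d ℕ.+ (suc d ℕ.* n)
      eq = solve-∀

  cross : List Carrier → List Carrier → Carrier
  cross done []       = 1#
  cross done (x ∷ xs) = diffs x done * cross done xs

  diffs-++ : ∀ a xs ys → diffs a (xs ++ ys) ≈ diffs a xs * diffs a ys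
  diffs-++ a []       ys = sym (*-identityˡ _)
  diffs-++ a (x ∷ xs) ys = trans (*-congˡ (diffs-++ a xs ys)) (sym (*-assoc _ _ _))

  cross-∷ : ∀ a done xs → cross (a ∷ done) xs ∼ diffs a xs * cross done xs
  cross-∷ a done []       = ≈⇒∼ (sym (*-identityˡ _))
  cross-∷ a done (x ∷ xs) = ∼-trans
    (∼-* (∼-* (≈±⇒∼ (inj₂ (solve 2 (λ x a → (x :+ :- a) := (:- (a :+ :- x))) refl x a))) ∼-refl) (cross-∷ a done xs))
    (≈⇒∼ (solve 4 (λ d u v w → (d :* u :* (v :* w)) := (d :* v :* (u :* w))) refl _ _ _ _))

  -- The factor collected when the exponents of all roots are lowered by one in turn: each x
  -- contributes its differences to all other roots, treated or not. For empty `done` this is the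
  -- discriminant up to sign.
  W : List Carrier → List Carrier → Carrier
  W done []       = 1#
  W done (x ∷ xs) = diffs x (done ++ xs) * W (x ∷ done) xs

  W∼ : ∀ done xs → W done xs ∼ Δ xs * Δ xs * cross done xs
  W∼ done []       = ≈⇒∼ (sym (trans (*-identityʳ _) (*-identityʳ _)))
  W∼ done (x ∷ xs) = ∼-trans
    (∼-* (≈⇒∼ (diffs-++ x done xs)) (∼-trans (W∼ (x ∷ done) xs) (∼-* ∼-refl (cross-∷ x done xs))))
    (≈⇒∼ (solve 4 (λ a b v c → (a :* b :* (v :* v :* (b :* c))) := ((b :* v) :* (b :* v) :* (a :* c))) refl _ _ _ _))

  module Down (e k : ℕ) (k+e≡n : k ℕ.+ e ≡ n) where

    exps : List Carrier → List Carrier → Factors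
    exps done todo = withExp e done ++ withExp n todo

    -- The roots are brought from exponent n down to e one after the other. A finished root is
    -- pushed onto `done`, whence the reversal in the conclusion.
    descend : ∀ done todo d → length done ℕ.+ length todo ≡ suc d → suc d ℕ.* k ℕ.≤ n →
              Mdet (P (exps done todo)) d ∼ W done todo ^ k * Mdet (P (withExp e (todo ʳ++ done))) d
    descend done [] d len le = ∼-trans (≈⇒∼ (Mdet-cong d (λ i →
        reflexive (≡.cong (λ L → P L i) (List.++-identityʳ (withExp e done))))))
      (≈⇒∼ (sym (trans (*-congʳ (1^ k)) (*-identityˡ _))))
      where
      1^ : ∀ k → 1# ^ k ≈ 1#
      1^ zero    = refl
      1^ (suc k) = trans (*-identityˡ _) (1^ k)
    descend done (x ∷ xs) d len le = ∼-trans (≈⇒∼ (Mdet-cong d (P-↭ (shift (x , n) (withExp e done) (withExp n xs)))))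
      (∼-trans first (∼-trans (∼-* ∼-refl (descend (x ∷ done) xs d (≡.trans (≡.sym (ℕ.+-suc (length done)
          (length xs))) len) le))
        (≈⇒∼ (trans (sym (*-assoc _ _ _)) (*-congʳ (sym (^-distrib-* _ _ k)))))))
      where
      open import Data.List.Relation.Binary.Permutation.Propositional.Properties using (shift)
      L = exps done xs
      lenL : length L ≡ d
      lenL = ≡.trans (List.length-++ (withExp e done)) (≡.trans
        (≡.cong₂ ℕ._+_ (List.length-map _ done) (List.length-map _ xs))
        (ℕ.suc-injective (≡.trans (≡.sym (ℕ.+-suc (length done) (length xs))) len)))
      rootsL : roots L ≡ done ++ xs
      rootsL = ≡.trans (List.map-++ proj₁ (withExp e done) (withExp n xs))
        (≡.cong₂ _++_ (roots-withExp e done) (roots-withExp n xs))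
      degL : degP L ≡ length done ℕ.* e ℕ.+ length xs ℕ.* n
      degL = ≡.trans (degP-++ (withExp e done) (withExp n xs))
        (≡.cong₂ ℕ._+_ (degP-withExp e done) (degP-withExp n xs))
      dx : length done ℕ.+ length xs ≡ d
      dx = ℕ.suc-injective (≡.trans (≡.sym (ℕ.+-suc (length done) (length xs))) len)
      ok : ∀ j → e ℕ.≤ j → j ℕ.< k ℕ.+ e → ¬ p ∣ suc j × ¬ p ∣ suc (j ℕ.+ (length L ℕ.+ degP L))
      ok j ge lt with ℕ.m≤n⇒∃[o]m+o≡n lt
      ... | t , eq = small∤ (s≤s z≤n) (ℕ.≤-trans lt (ℕ.≤-reflexive k+e≡n))
        -- The multiplier falls short of (d + 1)p by n - j = suc t for the current root and by k for
        -- each finished one. This deficit is positive and at most (d + 1)k ≤ n.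
        , complement∤ {s = suc t ℕ.+ length done ℕ.* k} (suc d) total
            (small∤ (s≤s z≤n) (ℕ.≤-trans (ℕ.+-mono-≤ st≤k (ℕ.*-monoˡ-≤ k (ℕ.≤-trans (ℕ.m≤m+n (length done)
                (length xs)) (ℕ.≤-reflexive dx)))) le))
        where
        st≤k : suc t ℕ.≤ k
        st≤k = ℕ.+-cancelʳ-≤ e _ _ (ℕ.≤-trans (ℕ.+-monoʳ-≤ (suc t) ge)
          (ℕ.≤-reflexive (≡.trans (≡.cong suc (ℕ.+-comm t j)) eq)))
        n≡ : n ≡ suc (j ℕ.+ t)
        n≡ = ≡.trans (≡.sym k+e≡n) (≡.sym eq)
        total : suc (j ℕ.+ (length L ℕ.+ degP L)) ℕ.+ (suc t ℕ.+ length done ℕ.* k) ≡ suc d ℕ.* p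
        total = ≡.trans (≡.cong₂ (λ l D → suc (j ℕ.+ (l ℕ.+ D)) ℕ.+ (suc t ℕ.+ length done ℕ.* k)) lenL degL)
          (≡.trans (alg₁ j t d (length done) (length xs) e k n)
          (≡.trans (≡.cong₂ (λ a b → suc (suc (j ℕ.+ t)) ℕ.+ (d ℕ.+
              (length done ℕ.* a ℕ.+ length xs ℕ.* b))) k+e≡n ≡.refl)
          (≡.trans (≡.cong₂ (λ a b → suc a ℕ.+ (d ℕ.+ b)) (≡.sym n≡) (≡.trans (≡.sym (ℕ.*-distribʳ-+ n
              (length done) (length xs))) (≡.cong (ℕ._* n) dx)))
            (alg₂ d n))))
          where
          alg₁ : ∀ j t d l x e k n → suc (j ℕ.+ (d ℕ.+ (l ℕ.* e ℕ.+ x ℕ.* n))) ℕ.+ (suc t ℕ.+ l ℕ.* k)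
                   ≡ suc (suc (j ℕ.+ t)) ℕ.+ (d ℕ.+ (l ℕ.* (k ℕ.+ e) ℕ.+ x ℕ.* n))
          alg₁ = solve-∀
          alg₂ : ∀ d n → suc n ℕ.+ (d ℕ.+ d ℕ.* n) ≡ suc d ℕ.* suc n
          alg₂ = solve-∀
      first : Mdet (pw x n ⊛ P L) d ∼ diffs x (done ++ xs) ^ k * Mdet (pw x e ⊛ P L) d
      first = ≡.subst₂ (λ m ys → Mdet (pw x n ⊛ P L) m ∼ diffs x ys ^ k * Mdet (pw x e ⊛ P L) m) lenL rootsL
        (≡.subst (λ s → Mdet (pw x s ⊛ P L) (length L) ∼ diffs x (roots L) ^ k * Mdet (pw x e ⊛ P L) (length L))
          k+e≡n (chain x L k e ok))

    -- The power of Δ² stays beside the determinant, since Δ may be a zero divisor in a general ring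
    -- of characteristic p.
    evaluation : ∀ x xs → suc (length xs) ℕ.* k ℕ.≤ n →
                 (Δ (x ∷ xs) * Δ (x ∷ xs)) ^ k * Mdet (P (withExp e (x ∷ xs))) (length xs) ∼ Δ (x ∷ xs) ^ n
    evaluation x xs le = ∼-trans
      (∼-* (∼-^ k (∼-sym (∼-trans (W∼ [] (x ∷ xs)) (≈⇒∼ (trans (*-congˡ (cross-[] (x ∷ xs))) (*-identityʳ _))))))
           (≈⇒∼ (Mdet-cong (length xs) (P-↭ (map⁺ _ (↭-sym (↭-reverse (x ∷ xs))))))))
      (∼-trans (∼-sym (descend [] (x ∷ xs) (length xs) ≡.refl le)) (base x xs))
      where
      cross-[] : ∀ ys → cross [] ys ≈ 1#
      cross-[] []       = refl
      cross-[] (y ∷ ys) = trans (*-identityˡ _) (cross-[] ys)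

-- Recursive polynomials modulo p as a commutative ring

mkHomomorphism : (A : RawRing 0ℓ 0ℓ) (B : CommutativeRing 0ℓ 0ℓ) →
  let module A = RawRing A; module B = CommutativeRing B in {h : A.Carrier → B.Carrier} →
  (∀ {x y} → x A.≈ y → h x B.≈ h y) → (∀ x y → h (x A.+ y) B.≈ h x B.+ h y) →
  (∀ x y → h (x A.* y) B.≈ h x B.* h y) → (∀ x → h (A.- x) B.≈ B.- h x) →
  h A.0# B.≈ B.0# → h A.1# B.≈ B.1# → IsRingHomomorphism A B.rawRing h
mkHomomorphism A B cong +-h *-h neg-h 0-h 1-h = record
  { isSemiringHomomorphism = record
    { isNearSemiringHomomorphism = record
      { +-isMonoidHomomorphism = record
        { isMagmaHomomorphism = record { isRelHomomorphism = record { cong = cong } ; homo = +-h }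
        ; ε-homo = 0-h }
      ; *-homo = *-h }
    ; 1#-homo = 1-h }
  ; -‿homo = neg-h }

module PolynomialsMod (p : ℕ) where
  open import Data.Fin using (zero; suc)
  open import Data.Integer.Tactic.RingSolver using () renaming (solve-∀ to ℤ-solve-∀)

  infix 4 _≅_
  _≅_ : ℤ → ℤ → Set
  a ≅ b = EqMod p {0} a b

  private
    toSigned : ∀ {a b} → a ≅ b → (+ p) Signed.∣ (a ℤ.- b)
    toSigned = ∣ᵤ⇒∣

    by : ∀ {a b c} → c ≡ a ℤ.- b → (+ p) Signed.∣ c → a ≅ b
    by eq d = ∣⇒∣ᵤ (≡.subst ((+ p) Signed.∣_) eq d)

    ≡⇒≅ : ∀ {a b} → a ≡ b → a ≅ b
    ≡⇒≅ {a} ≡.refl = by {a} {a} (≡.sym (ℤ.+-inverseʳ a)) (divides 0ℤ (≡.sym (ℤ.*-zeroˡ (+ p))))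

  isCommutativeRing₀ : IsCommutativeRing (EqMod p {0}) ℤ._+_ ℤ._*_ ℤ.-_ 0ℤ 1ℤ
  isCommutativeRing₀ = record
    { isRing = record
      { +-isAbelianGroup = record
        { isGroup = record
          { isMonoid = record
            { isSemigroup = record
              { isMagma = record
                { isEquivalence = record
                  { refl  = λ {a} → ≡⇒≅ {a} ≡.refl
                  ; sym   = λ {a} {b} e → by {b} {a} (s a b) (Signed.∣m⇒∣-m (toSigned {a} {b} e))
                  ; trans = λ {a} {b} {c} e f → by {a} {c} (t a b c)
                              (Signed.∣m∣n⇒∣m+n (toSigned {a} {b} e) (toSigned {b} {c} f))
                  }
                ; ∙-cong = λ {a} {b} {c} {d} e f → by {a ℤ.+ c} {b ℤ.+ d} (ac a b c d)
                    (Signed.∣m∣n⇒∣m+n (toSigned {a} {b} e) (toSigned {c} {d} f))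
                }
              ; assoc = λ a b c → ≡⇒≅ (ℤ.+-assoc a b c)
              }
            ; identity = (λ a → ≡⇒≅ (ℤ.+-identityˡ a)) , (λ a → ≡⇒≅ (ℤ.+-identityʳ a))
            }
          ; inverse = (λ a → ≡⇒≅ (ℤ.+-inverseˡ a)) , (λ a → ≡⇒≅ (ℤ.+-inverseʳ a))
          ; ⁻¹-cong = λ {a} {b} e → by {ℤ.- a} {ℤ.- b} (n a b) (Signed.∣m⇒∣-m (toSigned {a} {b} e))
          }
        ; comm = λ a b → ≡⇒≅ (ℤ.+-comm a b)
        }
      ; *-cong = λ {a} {b} {c} {d} e f → by {a ℤ.* c} {b ℤ.* d} (mc a b c d)
          (Signed.∣m∣n⇒∣m+n (Signed.∣n⇒∣m*n c (toSigned {a} {b} e)) (Signed.∣n⇒∣m*n b (toSigned {c} {d} f)))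
      ; *-assoc = λ a b c → ≡⇒≅ (ℤ.*-assoc a b c)
      ; *-identity = (λ a → ≡⇒≅ (ℤ.*-identityˡ a)) , (λ a → ≡⇒≅ (ℤ.*-identityʳ a))
      ; distrib = (λ a b c → ≡⇒≅ (ℤ.*-distribˡ-+ a b c)) , (λ a b c → ≡⇒≅ (ℤ.*-distribʳ-+ a b c))
      }
    ; *-comm = λ a b → ≡⇒≅ (ℤ.*-comm a b)
    }
    where
    s : ∀ a b → ℤ.- (a ℤ.- b) ≡ b ℤ.- a
    s = ℤ-solve-∀
    t : ∀ a b c → (a ℤ.- b) ℤ.+ (b ℤ.- c) ≡ a ℤ.- c
    t = ℤ-solve-∀
    ac : ∀ a b c d → (a ℤ.- b) ℤ.+ (c ℤ.- d) ≡ (a ℤ.+ c) ℤ.- (b ℤ.+ d)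
    ac = ℤ-solve-∀
    n : ∀ a b → ℤ.- (a ℤ.- b) ≡ ℤ.- a ℤ.- ℤ.- b
    n = ℤ-solve-∀
    mc : ∀ a b c d → c ℤ.* (a ℤ.- b) ℤ.+ b ℤ.* (c ℤ.- d) ≡ a ℤ.* c ℤ.- b ℤ.* d
    mc = ℤ-solve-∀

  rawPoly : ℕ → RawRing 0ℓ 0ℓ
  rawPoly m = record
    { Carrier = Poly m ; _≈_ = EqMod p {m} ; _+_ = _⊕_ {m} ; _*_ = _⊗_ {m}
    ; -_ = negP {m} ; 0# = zeroP {m} ; 1# = oneP {m} }

  module Coefficients (m : ℕ)
    (isCR : IsCommutativeRing (EqMod p {m}) (_⊕_ {m}) (_⊗_ {m}) (negP {m}) (zeroP {m}) (oneP {m})) where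
    R : CommutativeRing 0ℓ 0ℓ
    R = record { isCommutativeRing = isCR }
    open CommutativeRing R hiding (zero)
    open Convolution R
    open import Algebra.Properties.Ring ring using (-0#≈0#)

    coeff-EqMod : ∀ a b → EqMod p {suc m} a b → ∀ k → coeff {m} a k ≈ coeff {m} b k
    coeff-EqMod []       []       e        k       = refl
    coeff-EqMod []       (b ∷ bs) (e , es) zero    = e
    coeff-EqMod []       (b ∷ bs) (e , es) (suc k) = coeff-EqMod [] bs es k
    coeff-EqMod (a ∷ as) []       (e , es) zero    = e
    coeff-EqMod (a ∷ as) []       (e , es) (suc k) = coeff-EqMod as [] es k
    coeff-EqMod (a ∷ as) (b ∷ bs) (e , es) zero    = e
    coeff-EqMod (a ∷ as) (b ∷ bs) (e , es) (suc k) = coeff-EqMod as bs es k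

    EqMod-coeff : ∀ a b → (∀ k → coeff {m} a k ≈ coeff {m} b k) → EqMod p {suc m} a b
    EqMod-coeff []       []       e = tt
    EqMod-coeff []       (b ∷ bs) e = e 0 , EqMod-coeff [] bs (e ∘ suc)
    EqMod-coeff (a ∷ as) []       e = e 0 , EqMod-coeff as [] (e ∘ suc)
    EqMod-coeff (a ∷ as) (b ∷ bs) e = e 0 , EqMod-coeff as bs (e ∘ suc)

    coeff-⊕ : ∀ a b k → coeff {m} (_⊕_ {suc m} a b) k ≈ coeff {m} a k + coeff {m} b k
    coeff-⊕ []       b        k       = sym (+-identityˡ _)
    coeff-⊕ (a ∷ as) []       k       = sym (+-identityʳ _)
    coeff-⊕ (a ∷ as) (b ∷ bs) zero    = refl
    coeff-⊕ (a ∷ as) (b ∷ bs) (suc k) = coeff-⊕ as bs k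

    coeff-negP : ∀ a k → coeff {m} (negP {suc m} a) k ≈ - coeff {m} a k
    coeff-negP []       k       = sym -0#≈0#
    coeff-negP (a ∷ as) zero    = refl
    coeff-negP (a ∷ as) (suc k) = coeff-negP as k

    coeff-scale : ∀ c b k → coeff {m} (map (_⊗_ {m} c) b) k ≈ c * coeff {m} b k
    coeff-scale c []       k       = sym (zeroʳ c)
    coeff-scale c (b ∷ bs) zero    = refl
    coeff-scale c (b ∷ bs) (suc k) = coeff-scale c bs k

    coeff-⊗ : ∀ a b → coeff {m} (_⊗_ {suc m} a b) ≋ coeff {m} a ⊛ coeff {m} b
    coeff-⊗ []       b k       = sym (⊛-zeroˡ (coeff {m} b) k)
    coeff-⊗ (a ∷ as) b zero    = trans (coeff-⊕ (map (_⊗_ {m} a) b) _ 0)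
      (trans (+-identityʳ _) (coeff-scale a b 0))
    coeff-⊗ (a ∷ as) b (suc k) = trans (coeff-⊕ (map (_⊗_ {m} a) b) _ (suc k))
      (+-cong (coeff-scale a b (suc k)) (coeff-⊗ as b k))

    coeff-one : coeff {m} (oneP {suc m}) ≋ const 1#
    coeff-one zero    = refl
    coeff-one (suc k) = refl

    coeff-isRingMonomorphism :
      IsRingMonomorphism (rawPoly (suc m)) (CommutativeRing.rawRing (powerSeries R)) (coeff {m})
    coeff-isRingMonomorphism = record
      { isRingHomomorphism = mkHomomorphism (rawPoly (suc m)) (powerSeries R)
          (λ {a} {b} → coeff-EqMod a b) coeff-⊕ coeff-⊗ coeff-negP (λ _ → refl) coeff-one
      ; injective = λ {a} {b} → EqMod-coeff a b
      }

  -- Coefficient lists may end in zeros, so the laws hold up to `EqMod` only. They are pulled back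
  -- along the injection into power series over the ring with one variable less.
  isPolyRing : ∀ m → IsCommutativeRing (EqMod p {m}) (_⊕_ {m}) (_⊗_ {m}) (negP {m}) (zeroP {m}) (oneP {m})
  isPolyRing zero    = isCommutativeRing₀
  isPolyRing (suc m) = RingMonomorphism.isCommutativeRing
    (Coefficients.coeff-isRingMonomorphism m (isPolyRing m))
    (Convolution.isCommutativeRing-⊛ (Coefficients.R m (isPolyRing m)))

  polyRing : ℕ → CommutativeRing 0ℓ 0ℓ
  polyRing m = record { isCommutativeRing = isPolyRing m }

  module Evaluation (B : CommutativeRing 0ℓ 0ℓ) (θ : ℤ → CommutativeRing.Carrier B)
                    (θ-hom : IsRingHomomorphism (rawPoly 0) (CommutativeRing.rawRing B) θ) where
    open CommutativeRing B hiding (zero)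
    open Integers B
    open import Algebra.Properties.Ring ring using (-0#≈0#)
    open SetoidReasoning setoid

    ev : ∀ m → (Fin m → Carrier) → Poly m → Carrier
    ev zero    x c        = θ c
    ev (suc m) x []       = 0#
    ev (suc m) x (a ∷ as) = ev m (x ∘ suc) a + x zero * ev (suc m) x as


    private
      nil : ∀ {c a d e} → c ≈ 0# → d ≈ 0# → c + e * d ≈ a → a ≈ 0#
      nil {e = e} p q r = trans (sym r) (trans (+-cong p (trans (*-congˡ q) (zeroʳ e))) (+-identityˡ _))

    ev-hom : ∀ m x → IsRingHomomorphism (rawPoly m) rawRing (ev m x)
    ev-hom zero    x = θ-hom
    ev-hom (suc m) x = mkHomomorphism (rawPoly (suc m)) B
      (λ {a} {b} → cong a b) plus times neg refl
      (trans (+-cong H.1#-homo (zeroʳ _)) (+-identityʳ 1#))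
      where
      module H = IsRingHomomorphism (ev-hom m (x ∘ suc))
      E = ev (suc m) x
      e₀ = ev m (x ∘ suc)
      cong : ∀ a b → EqMod p {suc m} a b → E a ≈ E b
      cong []       []       _        = refl
      cong []       (b ∷ bs) (e , es) = sym (nil (trans (sym (H.⟦⟧-cong e)) H.0#-homo) (sym (cong [] bs es)) refl)
      cong (a ∷ as) []       (e , es) = nil (trans (H.⟦⟧-cong e) H.0#-homo) (cong as [] es) refl
      cong (a ∷ as) (b ∷ bs) (e , es) = +-cong (H.⟦⟧-cong e) (*-congˡ (cong as bs es))
      plus : ∀ a b → E (_⊕_ {suc m} a b) ≈ E a + E b
      plus []       b        = sym (+-identityˡ _)
      plus (a ∷ as) []       = sym (+-identityʳ _)
      plus (a ∷ as) (b ∷ bs) = trans (+-cong (H.+-homo a b) (*-congˡ (plus as bs)))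
        (solve 5 (λ a b x y z → (a :+ b :+ x :* (y :+ z)) := ((a :+ x :* y) :+ (b :+ x :* z))) refl _ _ _ _ _)
      neg : ∀ a → E (negP {suc m} a) ≈ - E a
      neg []       = sym -0#≈0#
      neg (a ∷ as) = trans (+-cong (H.-‿homo a) (*-congˡ (neg as)))
        (solve 3 (λ a x y → ((:- a) :+ x :* (:- y)) := (:- (a :+ x :* y))) refl _ _ _)
      scale : ∀ c b → E (map (_⊗_ {m} c) b) ≈ e₀ c * E b
      scale c []       = sym (zeroʳ _)
      scale c (b ∷ bs) = trans (+-cong (H.*-homo c b) (*-congˡ (scale c bs)))
        (solve 4 (λ c b x y → (c :* b :+ x :* (c :* y)) := (c :* (b :+ x :* y))) refl _ _ _ _)
      times : ∀ a b → E (_⊗_ {suc m} a b) ≈ E a * E b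
      times []       b = sym (zeroˡ _)
      times (a ∷ as) b = begin
        E (_⊗_ {suc m} (a ∷ as) b)
          ≈⟨ plus (map (_⊗_ {m} a) b) (zeroP {m} ∷ _⊗_ {suc m} as b) ⟩
        E (map (_⊗_ {m} a) b) + (e₀ (zeroP {m}) + x zero * E (_⊗_ {suc m} as b))
          ≈⟨ +-cong (scale a b) (+-cong H.0#-homo (*-congˡ (times as b))) ⟩
        e₀ a * E b + (0# + x zero * (E as * E b))
          ≈⟨ +-congˡ (+-identityˡ _) ⟩
        e₀ a * E b + x zero * (E as * E b)
          ≈⟨ solve 4 (λ a b x y → (a :* b :+ x :* (y :* b)) := ((a :+ x :* y) :* b)) refl _ _ _ _ ⟩
        (e₀ a + x zero * E as) * E b ∎

    ev-var : ∀ m x i → ev m x (var i) ≈ x i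
    ev-var (suc m) x zero = begin
      ev m (x ∘ suc) (zeroP {m}) + x zero * (ev m (x ∘ suc) (oneP {m}) + x zero * 0#)
        ≈⟨ +-cong H.0#-homo (*-congˡ (+-cong H.1#-homo (zeroʳ _))) ⟩
      0# + x zero * (1# + 0#)
        ≈⟨ trans (+-identityˡ _) (trans (*-congˡ (+-identityʳ _)) (*-identityʳ _)) ⟩
      x zero ∎
      where module H = IsRingHomomorphism (ev-hom m (x ∘ suc))
    ev-var (suc m) x (suc i) = trans (+-cong (ev-var m (x ∘ suc) i) (zeroʳ _)) (+-identityʳ _)

    ev-constP : ∀ m x c → ev m x (constP {m} c) ≈ θ c
    ev-constP zero    x c = refl
    ev-constP (suc m) x c = trans (+-cong (ev-constP m (x ∘ suc) c) (zeroʳ _)) (+-identityʳ _)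

-- Images of the matrix and of δ under a ring homomorphism

module Specialization (B : CommutativeRing 0ℓ 0ℓ) (n r : ℕ)
    (θ : Poly r → CommutativeRing.Carrier B)
    (θ-hom : IsRingHomomorphism (PolynomialsMod.rawPoly (suc n) r) (CommutativeRing.rawRing B) θ)
    (x : Fin r → CommutativeRing.Carrier B) (θ-var : ∀ i → CommutativeRing._≈_ B (θ (var i)) (x i)) where
  open import Data.Fin using (zero; suc)
  private p = suc n
  open PolynomialsMod p
  open CommutativeRing B hiding (zero)
  open Convolution B
  open Integers B using (solve; _:=_; _:+_; :-_)
  open Determinants B
  open LinearFactors B
  module θ = IsRingHomomorphism θ-hom
  open import Algebra.Properties.Semiring.Exp semiring using (_^_)
  open import Algebra.Properties.Semiring.Exp S.semiring using (^-congˡ) renaming (_^_ to _^ˢ_)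
  open import Algebra.Properties.CommutativeSemiring.Exp S.commutativeSemiring using (^-distrib-*)
  open import Algebra.Properties.Ring ring using (-0#≈0#)
  open SetoidReasoning setoid

  altSum : ∀ {k} → (Fin k → Carrier) → Carrier
  altSum {zero}  g = 0#
  altSum {suc k} g = g zero - altSum (g ∘ suc)

  altSum-cong : ∀ {k} {g h : Fin k → Carrier} → (∀ j → g j ≈ h j) → altSum g ≈ altSum h
  altSum-cong {zero}  e = refl
  altSum-cong {suc k} e = +-cong (e zero) (-‿cong (altSum-cong (e ∘ suc)))

  private
    sumT : ∀ {k} → (Fin k → Poly r) → Poly r
    sumT f = foldr (_⊕_ {r}) (zeroP {r}) (tabulate f)

    -- Raising all sign exponents by one negates the sum; this converts the explicit signs of `det`
    -- into nested subtractions.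
    sumT-alt-suc : ∀ {k} (m : Fin k → ℕ) (t : Fin k → Poly r) →
      θ (sumT (λ j → alt {r} (suc (m j)) (t j))) ≈ - θ (sumT (λ j → alt {r} (m j) (t j)))
    sumT-alt-suc {zero}  m t = trans θ.0#-homo (sym (trans (-‿cong θ.0#-homo) -0#≈0#))
    sumT-alt-suc {suc k} m t = begin
      θ (sumT (λ j → alt {r} (suc (m j)) (t j)))
        ≈⟨ θ.+-homo _ _ ⟩
      θ (negP {r} (alt {r} (m zero) (t zero))) + θ (sumT (λ j → alt {r} (suc (m (suc j))) (t (suc j))))
        ≈⟨ +-cong (θ.-‿homo _) (sumT-alt-suc (m ∘ suc) (t ∘ suc)) ⟩
      - θ (alt {r} (m zero) (t zero)) - θ (sumT (λ j → alt {r} (m (suc j)) (t (suc j))))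
        ≈⟨ solve 2 (λ a b → ((:- a) :+ (:- b)) := (:- (a :+ b))) refl _ _ ⟩
      - (θ (alt {r} (m zero) (t zero)) + θ (sumT (λ j → alt {r} (m (suc j)) (t (suc j)))))
        ≈⟨ -‿cong (θ.+-homo _ _) ⟨
      - θ (sumT (λ j → alt {r} (m j) (t j))) ∎

    sumT-alt : ∀ {k} (t : Fin k → Poly r) → θ (sumT (λ j → alt {r} (toℕ j) (t j))) ≈ altSum (θ ∘ t)
    sumT-alt {zero}  t = θ.0#-homo
    sumT-alt {suc k} t = trans (θ.+-homo _ _)
      (+-congˡ (trans (sumT-alt-suc toℕ (t ∘ suc)) (-‿cong (sumT-alt (t ∘ suc)))))

  -- The bridge between two ways of deleting a column: leaving it out of a list, and reindexing by
  -- `punchIn`.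
  expand-tabulate : ∀ {k} h (cols : Fin (suc k) → Seq) →
    expand h (tabulate cols) ≈ altSum (λ j → h (cols j) (tabulate (cols ∘ punchIn j)))
  expand-tabulate {zero}  h cols = refl
  expand-tabulate {suc k} h cols = +-congˡ (-‿cong (expand-tabulate (λ v vs → h v (cols zero ∷ vs)) (cols ∘ suc)))

  θ-det : ∀ k (M : Fin k → Fin k → Poly r) {ρ} (cols : Fin k → Seq) →
          (∀ a b → θ (M a b) ≈ cols b (ρ (toℕ a))) → θ (det {r} M) ≈ D k ρ (tabulate cols)
  θ-det zero    M cols e = θ.1#-homo
  θ-det (suc k) M {ρ} cols e = begin
    θ (det {r} M)
      ≡⟨ ≡.cong (θ ∘ foldr (_⊕_ {r}) (zeroP {r}))
           (List.map-tabulate id (λ j → alt {r} (toℕ j) (term j))) ⟩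
    θ (sumT (λ j → alt {r} (toℕ j) (term j)))   ≈⟨ sumT-alt term ⟩
    altSum (θ ∘ term)                            ≈⟨ altSum-cong (λ j → trans (θ.*-homo _ _)
                                                     (*-cong (e zero j) (θ-det k _ (cols ∘ punchIn j) (λ a b → e
                                                         (suc a) (punchIn j b))))) ⟩
    altSum (λ j → cols j (ρ 0) * D k (ρ ∘ suc) (tabulate (cols ∘ punchIn j)))
                                                 ≈⟨ expand-tabulate (λ v vs → v (ρ 0) * D k (ρ ∘ suc) vs) cols ⟨
    D (suc k) ρ (tabulate cols) ∎
    where
    term : Fin (suc k) → Poly r
    term j = _⊗_ {r} (M zero j) (det {r} (λ a b → M (suc a) (punchIn j b)))

  product : List Carrier → Carrier
  product = foldr _*_ 1#

  θ-prodP : ∀ {k} (f : Fin k → Poly r) → θ (prodP {r} f) ≈ product (tabulate (θ ∘ f))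
  θ-prodP f = trans (reflexive (≡.cong (θ ∘ foldr (_⊗_ {r}) (oneP {r})) (List.map-tabulate id f))) (go f)
    where
    go : ∀ {k} (f : Fin k → Poly r) → θ (foldr (_⊗_ {r}) (oneP {r}) (tabulate f)) ≈ product (tabulate (θ ∘ f))
    go {zero}  f = θ.1#-homo
    go {suc k} f = trans (θ.*-homo _ _) (*-congˡ (go (f ∘ suc)))

  product-cong : ∀ {k} {f g : Fin k → Carrier} → (∀ i → f i ≈ g i) → product (tabulate f) ≈ product (tabulate g)
  product-cong {zero}  e = refl
  product-cong {suc k} e = *-cong (e zero) (product-cong (e ∘ suc))

  θ-^P : ∀ q e → θ (_^P_ {r} q e) ≈ θ q ^ e
  θ-^P q zero    = θ.1#-homo
  θ-^P q (suc e) = trans (θ.*-homo _ _) (*-congˡ (θ-^P q e))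

  private
    factor : ∀ {k} (y : Fin k → Carrier) (i j : Fin k) → Carrier
    factor y i j = if toℕ i ℕ.<ᵇ toℕ j then y i - y j else 1#

    diffs-tabulate : ∀ {k} a (y : Fin k → Carrier) → product (tabulate (λ j → a - y j)) ≈ diffs a (tabulate y)
    diffs-tabulate {zero}  a y = refl
    diffs-tabulate {suc k} a y = *-congˡ (diffs-tabulate a (y ∘ suc))

    Δ-tabulate : ∀ {k} (y : Fin k → Carrier) →
      product (tabulate (λ i → product (tabulate (factor y i)))) ≈ Δ (tabulate y)
    Δ-tabulate {zero}  y = refl
    Δ-tabulate {suc k} y = *-cong (trans (*-identityˡ _) (diffs-tabulate (y zero) (y ∘ suc)))
      (trans (product-cong {g = λ i → product (tabulate (factor (y ∘ suc) i))} (λ i → *-identityˡ _))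
        (Δ-tabulate (y ∘ suc)))

  θ-δ : θ (δ r) ≈ Δ (tabulate x)
  θ-δ = trans (θ-prodP {r} _) (trans (product-cong (λ i → trans (θ-prodP {r} _) (product-cong (entry i))))
      (Δ-tabulate x))
    where
    entry : ∀ i j → θ (if ⌊ toℕ i ℕ.<? toℕ j ⌋ then _⊖_ {r} (var i) (var j) else oneP {r}) ≈ factor x i j
    entry i j rewrite isYes≗does (toℕ i ℕ.<? toℕ j) with toℕ i ℕ.<ᵇ toℕ j
    ... | true  = trans (θ.+-homo _ _) (+-cong (θ-var i) (trans (θ.-‿homo _) (-‿cong (θ-var j))))
    ... | false = θ.1#-homo

  private
    η : Poly (suc r) → Seq
    η q k = θ (coeff {r} q k)

    mapSeq-⊛ : ∀ u v k → θ (Convolution._⊛_ (polyRing r) u v k) ≈ ((θ ∘ u) ⊛ (θ ∘ v)) k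
    mapSeq-⊛ u v zero    = θ.*-homo _ _
    mapSeq-⊛ u v (suc k) = trans (θ.+-homo _ _) (+-cong (θ.*-homo _ _) (mapSeq-⊛ (u ∘ suc) v k))

    module C = Coefficients r (isPolyRing r)

    η-⊗ : ∀ a b → η (_⊗_ {suc r} a b) ≋ η a ⊛ η b
    η-⊗ a b k = trans (θ.⟦⟧-cong (C.coeff-⊗ a b k)) (mapSeq-⊛ (coeff {r} a) (coeff {r} b) k)

    η-one : η (oneP {suc r}) ≋ S.1#
    η-one zero    = θ.1#-homo
    η-one (suc k) = θ.0#-homo

    η-linear : ∀ i → η (_⊖_ {suc r} (var zero) (var (suc i))) ≋ lin (x i)
    η-linear i k = trans (θ.⟦⟧-cong (C.coeff-⊕ (var {suc r} zero) (negP {suc r} (var {suc r} (suc i))) k))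
      (trans (θ.+-homo _ _) (+-cong (X-part k)
        (trans (θ.⟦⟧-cong (C.coeff-negP (var {suc r} (suc i)) k)) (trans (θ.-‿homo _) (-‿cong (c-part k))))))
      where
      X-part : η (var {suc r} zero) ≋ X
      X-part zero          = θ.0#-homo
      X-part (suc zero)    = θ.1#-homo
      X-part (suc (suc k)) = θ.0#-homo
      c-part : η (var {suc r} (suc i)) ≋ const (x i)
      c-part zero    = θ-var i
      c-part (suc k) = θ.0#-homo

    rootProduct : List Carrier → Seq
    rootProduct []       = S.1#
    rootProduct (a ∷ as) = lin a ⊛ rootProduct as

    η-fpoly : η (fpoly r) ≋ rootProduct (tabulate x)
    η-fpoly = S.trans
      (λ k → reflexive (≡.cong (λ fs → η (foldr (_⊗_ {suc r}) (oneP {suc r}) fs) k)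
        (List.map-tabulate {n = r} id (λ i → _⊖_ {suc r} (var zero) (var (suc i))))))
      (go id)
      where
      go : ∀ {k} (c : Fin k → Fin r) →
           η (foldr (_⊗_ {suc r}) (oneP {suc r}) (tabulate (λ i → _⊖_ {suc r} (var zero) (var (suc (c i))))))
             ≋ rootProduct (tabulate (x ∘ c))
      go {zero}  c = η-one
      go {suc k} c = S.trans
        (η-⊗ (_⊖_ {suc r} (var zero) (var (suc (c zero))))
             (foldr (_⊗_ {suc r}) (oneP {suc r}) (tabulate (λ i → _⊖_ {suc r} (var zero) (var (suc (c (suc i))))))))
        (S.*-cong (η-linear (c zero)) (go (c ∘ suc)))

    η-^P : ∀ q e → η (_^P_ {suc r} q e) ≋ η q ^ˢ e
    η-^P q zero    = η-one
    η-^P q (suc e) = S.trans (η-⊗ q (_^P_ {suc r} q e)) (S.*-congˡ {η q} (η-^P q e))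

    rootProduct-^ : ∀ e as → rootProduct as ^ˢ e ≋ P (map (_, e) as)
    rootProduct-^ e []       = 1^ e
      where
      1^ : ∀ e → S.1# ^ˢ e ≋ S.1#
      1^ zero    = S.refl
      1^ (suc e) = S.trans (S.*-identityˡ (S.1# ^ˢ e)) (1^ e)
    rootProduct-^ e (a ∷ as) = S.trans (^-distrib-* (lin a) (rootProduct as) e)
      (S.*-cong (lin-^ e) (rootProduct-^ e as))
      where
      lin-^ : ∀ e → lin a ^ˢ e ≋ pw a e
      lin-^ zero    = S.refl
      lin-^ (suc e) = S.*-congˡ {lin a} (lin-^ e)

  F : ℕ → Seq
  F e = P (map (_, e) (tabulate x))

  θ-coeff : ∀ e k → θ (coeff {r} (_^P_ {suc r} (fpoly r) e) k) ≈ F e k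
  θ-coeff e = S.trans (η-^P (fpoly r) e)
    (S.trans (^-congˡ e η-fpoly) (rootProduct-^ e (tabulate x)))

  pows-tabulate : ∀ d u → pows d u ≡ tabulate {n = d} (λ b → xpow (d ∸ suc (toℕ b)) u)
  pows-tabulate zero    u = ≡.refl
  pows-tabulate (suc d) u = ≡.cong (xpow d u ∷_) (pows-tabulate d u)

  -- Column b is X^(d-1-b) f^e: its coefficient of index (a + 1)p - 1 is that of f^e of index (a +
  -- 1)p + b - d. As d ≤ p, no subtraction is truncated.
  θ-detMat : ∀ e d → d ℕ.≤ p →
             θ (det {r} (Mat p r e d)) ≈ D d (λ i → n ℕ.+ i ℕ.* p) (pows d (F e))
  θ-detMat e d d≤p = trans (θ-det d (Mat p r e d) (λ b → xpow (d ∸ suc (toℕ b)) (F e)) entry)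
    (reflexive (≡.cong (D d _) (≡.sym (pows-tabulate d (F e)))))
    where
    entry : ∀ a b → θ (Mat p r e d a b) ≈ xpow (d ∸ suc (toℕ b)) (F e) (n ℕ.+ toℕ a ℕ.* p)
    entry a b = begin
      θ (Mat p r e d a b)                          ≈⟨ θ-coeff e _ ⟩
      F e ((suc (toℕ a) ℕ.* p ℕ.+ toℕ b) ∸ d)      ≈⟨ xpow-+ c (F e) _ ⟨
      xpow c (F e) (c ℕ.+ ((suc (toℕ a) ℕ.* p ℕ.+ toℕ b) ∸ d)) ≡⟨ ≡.cong (xpow c (F e)) idx ⟩
      xpow c (F e) (n ℕ.+ toℕ a ℕ.* p) ∎
      where
      c = d ∸ suc (toℕ b)
      φa = n ℕ.+ toℕ a ℕ.* p
      b<d : suc (toℕ b) ℕ.≤ d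
      b<d = Fin.toℕ<n b
      c≤φ : c ℕ.≤ φa
      c≤φ = ℕ.≤-trans (ℕ.∸-mono d≤p (ℕ.s≤s (ℕ.z≤n {toℕ b}))) (ℕ.m≤m+n n _)
      idx : c ℕ.+ ((suc φa ℕ.+ toℕ b) ∸ d) ≡ φa
      idx = ≡.trans (≡.cong (c ℕ.+_) (≡.trans
        (≡.cong₂ _∸_ (≡.trans (≡.sym (ℕ.+-suc φa (toℕ b))) (ℕ.+-comm φa (suc (toℕ b)))) (≡.sym (ℕ.m+[n∸m]≡n b<d)))
        (ℕ.[m+n]∸[m+o]≡n∸o (suc (toℕ b)) φa c))) (ℕ.m+[n∸m]≡n c≤φ)

-- Piecewise linear orders and the numerical conclusion

module Arithmetic where
  open import Data.Nat
  open import Data.Nat.Properties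
  open ≡ using (refl; sym; trans; cong; cong₂; subst)

  weighted : (ℕ → ℕ) → List ℕ → ℕ
  weighted f []       = 0
  weighted f (a ∷ as) = a * f 0 + weighted (f ∘ suc) as

  bump : ℕ → List ℕ → List ℕ
  bump _       []       = []
  bump zero    (a ∷ as) = suc a ∷ as
  bump (suc m) (a ∷ as) = a ∷ bump m as

  weighted-bump : ∀ f m as → m < length as → weighted f (bump m as) ≡ f m + weighted f as
  weighted-bump f zero    (a ∷ as) _       = +-assoc (f 0) (a * f 0) _
  weighted-bump f (suc m) (a ∷ as) (s≤s h) =
    trans (cong (λ z → a * f 0 + z) (weighted-bump (f ∘ suc) m as h)) (left-comm (a * f 0) (f (suc m)) _)
    where
    left-comm : ∀ x y z → x + (y + z) ≡ y + (x + z)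
    left-comm = solve-∀

  bump-length : ∀ m as → length (bump m as) ≡ length as
  bump-length _       []       = refl
  bump-length zero    (a ∷ as) = refl
  bump-length (suc m) (a ∷ as) = cong suc (bump-length m as)

  bump-positive : ∀ m {as} → All (1 ≤_) as → All (1 ≤_) (bump m as)
  bump-positive _       []       = []
  bump-positive zero    (p ∷ ps) = s≤s z≤n ∷ ps
  bump-positive (suc m) (p ∷ ps) = p ∷ bump-positive m ps

  ones : ℕ → List ℕ
  ones r = replicate r 1

  ones-positive : ∀ r → All (1 ≤_) (ones r)
  ones-positive zero    = []
  ones-positive (suc r) = ≤-refl ∷ ones-positive r

  length-ones : ∀ r → length (ones r) ≡ r
  length-ones zero    = refl
  length-ones (suc r) = cong suc (length-ones r)

  weighted-injective : ∀ r {f g} →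
    (∀ as → length as ≡ r → All (1 ≤_) as → weighted f as ≡ weighted g as) →
    ∀ m → m < r → f m ≡ g m
  weighted-injective r {f} {g} eq m m<r = +-cancelʳ-≡ (weighted g (ones r)) (f m) (g m) (begin-equality
    f m + weighted g (ones r)  ≡⟨ cong (λ z → f m + z) (eq (ones r) (length-ones r) (ones-positive r)) ⟨
    f m + weighted f (ones r)  ≡⟨ weighted-bump f m (ones r) m<len ⟨
    weighted f (bump m (ones r)) ≡⟨ eq (bump m (ones r)) (trans (bump-length m (ones r)) (length-ones r))
        (bump-positive m (ones-positive r)) ⟩
    weighted g (bump m (ones r)) ≡⟨ weighted-bump g m (ones r) m<len ⟩
    g m + weighted g (ones r) ∎)
    where
    open ≤-Reasoning
    m<len : m < length (ones r)
    m<len = subst (m <_) (sym (length-ones r)) m<r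

  weighted-cong : ∀ {f g} as → (∀ k → f k ≡ g k) → weighted f as ≡ weighted g as
  weighted-cong []       e = refl
  weighted-cong (a ∷ as) e = cong₂ _+_ (cong (λ z → a * z) (e 0)) (weighted-cong as (e ∘ suc))

  weighted-+ : ∀ f g as → weighted (λ k → f k + g k) as ≡ weighted f as + weighted g as
  weighted-+ f g []       = refl
  weighted-+ f g (a ∷ as) = trans (cong (λ z → a * (f 0 + g 0) + z) (weighted-+ (f ∘ suc) (g ∘ suc) as))
    (alg a (f 0) (g 0) (weighted (f ∘ suc) as) (weighted (g ∘ suc) as))
    where
    alg : ∀ a x y u v → a * (x + y) + (u + v) ≡ a * x + u + (a * y + v)
    alg = solve-∀

  weighted-* : ∀ c f as → weighted (λ k → c * f k) as ≡ c * weighted f as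
  weighted-* c f []       = sym (*-zeroʳ c)
  weighted-* c f (a ∷ as) = trans (cong (λ z → a * (c * f 0) + z) (weighted-* c (f ∘ suc) as))
    (alg a c (f 0) (weighted (f ∘ suc) as))
    where
    alg : ∀ a c x u → a * (c * x) + c * u ≡ c * (a * x + u)
    alg = solve-∀

  weighted-const1 : ∀ as → weighted (λ _ → 1) as ≡ sum as
  weighted-const1 []       = refl
  weighted-const1 (a ∷ as) = cong₂ _+_ (*-identityʳ a) (weighted-const1 as)

  weighted-mono : ∀ {f g} as → (∀ k → f k ≤ g k) → weighted f as ≤ weighted g as
  weighted-mono []       h = z≤n
  weighted-mono (a ∷ as) h = +-mono-≤ (*-monoʳ-≤ a (h 0)) (weighted-mono as (h ∘ suc))

  private
    ∸-convex-0 : ∀ b x y → (b ∸ x) + (b ∸ y) ≤ b + (b ∸ (x + y))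
    ∸-convex-0 b x y with ≤-total b x
    ... | inj₁ b≤x = begin
      (b ∸ x) + (b ∸ y)     ≡⟨ cong (_+ (b ∸ y)) (m≤n⇒m∸n≡0 b≤x) ⟩
      b ∸ y                 ≤⟨ m∸n≤m b y ⟩
      b                     ≤⟨ m≤m+n b _ ⟩
      b + (b ∸ (x + y)) ∎
      where open ≤-Reasoning
    ... | inj₂ x≤b with m≤n⇒∃[o]m+o≡n x≤b
    ...   | c , refl = begin
      (x + c ∸ x) + (x + c ∸ y)        ≡⟨ cong (_+ (x + c ∸ y)) (m+n∸m≡n x c) ⟩
      c + (x + c ∸ y)                  ≤⟨ +-monoʳ-≤ c (m≤n+o⇒m∸n≤o (x + c) y (begin
        x + c                          ≤⟨ +-monoʳ-≤ x (m≤n+m∸n c y) ⟩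
        x + (y + (c ∸ y))              ≡⟨ left-comm x y _ ⟩
        y + (x + (c ∸ y)) ∎)) ⟩
      c + (x + (c ∸ y))                ≡⟨ alg c x (c ∸ y) ⟩
      x + c + (c ∸ y)                  ≡⟨ cong (λ z → x + c + z) ([m+n]∸[m+o]≡n∸o x c y) ⟨
      x + c + (x + c ∸ (x + y)) ∎
      where
      open ≤-Reasoning
      left-comm : ∀ x y z → x + (y + z) ≡ y + (x + z)
      left-comm = solve-∀
      alg : ∀ c x z → c + (x + z) ≡ x + c + z
      alg = solve-∀

    -- Strict because the kink b of max(0, b - ·) lies strictly between 0 and x + y.
    ∸-convex-strict-0 : ∀ b x y → 1 ≤ x → 1 ≤ y → 1 ≤ b → b < x + y → (b ∸ x) + (b ∸ y) < b
    ∸-convex-strict-0 b x y 1≤x 1≤y 1≤b b<x+y with ≤-total b x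
    ... | inj₁ b≤x = subst (λ z → z + (b ∸ y) < b) (sym (m≤n⇒m∸n≡0 b≤x))
        (m∸n<m b y ⦃ >-nonZero 1≤b ⦄ ⦃ >-nonZero 1≤y ⦄)
      where
      m∸n<m : ∀ m n → ⦃ NonZero m ⦄ → ⦃ NonZero n ⦄ → m ∸ n < m
      m∸n<m (suc m) (suc n) = s≤s (m∸n≤m m n)
    ... | inj₂ x≤b with m≤n⇒∃[o]m+o≡n x≤b
    ...   | c , refl = begin-strict
      (x + c ∸ x) + (x + c ∸ y) ≡⟨ cong (_+ (x + c ∸ y)) (m+n∸m≡n x c) ⟩
      c + (x + c ∸ y)           <⟨ +-monoʳ-< c (m<n+o⇒m∸n<o (x + c) y ⦃ >-nonZero 1≤x ⦄
                                    (subst (x + c <_) (+-comm x y) (+-monoʳ-< x (+-cancelˡ-< x c y b<x+y)))) ⟩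
      c + x                     ≡⟨ +-comm c x ⟩
      x + c ∎
      where open ≤-Reasoning

  ∸-convex : ∀ c k x y → (c ∸ (k + x)) + (c ∸ (k + y)) ≤ (c ∸ k) + (c ∸ (k + (x + y)))
  ∸-convex c k x y
    rewrite sym (∸-+-assoc c k x) | sym (∸-+-assoc c k y) | sym (∸-+-assoc c k (x + y))
    = ∸-convex-0 (c ∸ k) x y

  ∸-convex-strict : ∀ c k x y → 1 ≤ x → 1 ≤ y → k < c → c < k + (x + y) →
                    (c ∸ (k + x)) + (c ∸ (k + y)) < (c ∸ k) + (c ∸ (k + (x + y)))
  ∸-convex-strict c k x y 1≤x 1≤y k<c c<
    rewrite sym (∸-+-assoc c k x) | sym (∸-+-assoc c k y)
    = <-≤-trans (∸-convex-strict-0 (c ∸ k) x y 1≤x 1≤y (m<n⇒0<n∸m k<c)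
        (+-cancelˡ-< k _ _ (subst (_< k + (x + y)) (sym (m+[n∸m]≡n (<⇒≤ k<c))) c<)))
      (m≤m+n (c ∸ k) _)

  -- For c = e, the order at t = 0 of the coefficient of index n in ∏ (x - t^wᵢ)^e,
  -- where wᵢ is the sum of the suffix of as starting at i.  This shape makes it
  -- visibly convex in n and linear in as.
  W : ℕ → ℕ → List ℕ → ℕ → ℕ
  W e c as n = weighted (λ m → (c + m * e) ∸ n) as

  W-∷ : ∀ e c a as n → W e c (a ∷ as) n ≡ a * (c ∸ n) + W e (c + e) as n
  W-∷ e c a as n = cong₂ (λ u v → a * (u ∸ n) + v) (+-identityʳ c)
    (weighted-cong as (λ k → cong (_∸ n) (sym (+-assoc c e (k * e)))))

  -- Moving all kinks by e translates the graph by e. For n < e, where n ∸ e is truncated, no kink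
  -- has been passed and the function is affine of slope - sum as.
  W-shift : ∀ e c as n → W e (c + e) as n ≡ W e c as (n ∸ e) + (e ∸ n) * sum as
  W-shift e c as n = begin-equality
    W e (c + e) as n                                        ≡⟨ weighted-cong as (λ k → term (c + k * e)
        (c + e + k * e) (alg c e (k * e))) ⟩
    weighted (λ k → ((c + k * e) ∸ (n ∸ e)) + (e ∸ n)) as   ≡⟨ weighted-+ _ _ as ⟩
    W e c as (n ∸ e) + weighted (λ _ → e ∸ n) as            ≡⟨ cong (λ z → W e c as (n ∸ e) + z)
      (trans (weighted-cong as (λ _ → sym (*-identityʳ (e ∸ n)))) (trans (weighted-* (e ∸ n) (λ _ → 1) as) (cong
          (λ z → (e ∸ n) * z) (weighted-const1 as)))) ⟩
    W e c as (n ∸ e) + (e ∸ n) * sum as ∎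
    where
    open ≤-Reasoning
    alg : ∀ c e z → c + e + z ≡ c + z + e
    alg = solve-∀
    term : ∀ c d → d ≡ c + e → d ∸ n ≡ (c ∸ (n ∸ e)) + (e ∸ n)
    term c _ refl with ≤-total n e
    ... | inj₁ n≤e rewrite m≤n⇒m∸n≡0 n≤e = +-∸-assoc c n≤e
    ... | inj₂ e≤n with m≤n⇒∃[o]m+o≡n e≤n
    ...   | k , refl rewrite m+n∸m≡n e k | m≤n⇒m∸n≡0 (m≤m+n e k) =
      trans (cong (_∸ (e + k)) (+-comm c e)) (trans ([m+n]∸[m+o]≡n∸o e c k) (sym (+-identityʳ _)))

  W-slope : ∀ e c as n → W e c as n ≤ W e c as (suc n) + sum as
  W-slope e c as n = begin
    W e c as n                                                  ≤⟨ weighted-mono as (λ k → term (c + k * e) n) ⟩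
    weighted (λ k → ((c + k * e) ∸ suc n) + 1) as               ≡⟨ weighted-+ _ _ as ⟩
    W e c as (suc n) + weighted (λ _ → 1) as                    ≡⟨ cong (λ z → W e c as (suc n) + z)
        (weighted-const1 as) ⟩
    W e c as (suc n) + sum as ∎
    where
    open ≤-Reasoning
    term : ∀ c n → c ∸ n ≤ (c ∸ suc n) + 1
    term zero    zero    = z≤n
    term zero    (suc n) = z≤n
    term (suc c) zero    = ≤-reflexive (+-comm 1 c)
    term (suc c) (suc n) = term c n

  W-convex : ∀ e c as k x y → W e c as (k + x) + W e c as (k + y) ≤ W e c as k + W e c as (k + (x + y))
  W-convex e c as k x y = begin
    W e c as (k + x) + W e c as (k + y) ≡⟨ weighted-+ _ _ as ⟨
    weighted (λ m → ((c + m * e) ∸ (k + x)) + ((c + m * e) ∸ (k + y))) as ≤⟨ weighted-mono as (λ m → ∸-convex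
        (c + m * e) k x y) ⟩
    weighted (λ m → ((c + m * e) ∸ k) + ((c + m * e) ∸ (k + (x + y)))) as ≡⟨ weighted-+ _ _ as ⟩
    W e c as k + W e c as (k + (x + y)) ∎
    where open ≤-Reasoning

  -- The kinks c, c + e, c + 2e, ... are spaced by e. The bounds on k say that the first is at most
  -- k + e and the last exceeds k, so the first kink beyond k lies within e of it, hence strictly
  -- inside the interval of length x + y > e.
  W-convex-strict : ∀ e c as k x y → 1 ≤ x → 1 ≤ y → e < x + y → All (1 ≤_) as →
    c ≤ k + e → k + e < c + length as * e →
    W e c as (k + x) + W e c as (k + y) < W e c as k + W e c as (k + (x + y))
  W-convex-strict e c [] k x y _ _ _ _ c≤ <c = ⊥-elim (<-irrefl refl (<-≤-trans <c (≤-trans (≤-reflexive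
      (+-identityʳ c)) c≤)))
  W-convex-strict e c (a ∷ as) k x y 1≤x 1≤y e< (1≤a ∷ pos) c≤ <c
    rewrite W-∷ e c a as (k + x) | W-∷ e c a as (k + y) | W-∷ e c a as k | W-∷ e c a as (k + (x + y))
    = begin-strict
      (a * (c ∸ (k + x)) + W e (c + e) as (k + x)) + (a * (c ∸ (k + y)) + W e (c + e) as (k + y))
        ≡⟨ alg a _ _ _ _ ⟩
      a * ((c ∸ (k + x)) + (c ∸ (k + y))) + (W e (c + e) as (k + x) + W e (c + e) as (k + y))
        <⟨ main ⟩
      a * ((c ∸ k) + (c ∸ (k + (x + y)))) + (W e (c + e) as k + W e (c + e) as (k + (x + y)))
        ≡⟨ alg a _ _ _ _ ⟨
      (a * (c ∸ k) + W e (c + e) as k) + (a * (c ∸ (k + (x + y))) + W e (c + e) as (k + (x + y))) ∎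
    where
    open ≤-Reasoning
    alg : ∀ a u v z w → (a * u + z) + (a * v + w) ≡ a * (u + v) + (z + w)
    alg = solve-∀
    main : a * ((c ∸ (k + x)) + (c ∸ (k + y))) + (W e (c + e) as (k + x) + W e (c + e) as (k + y))
         < a * ((c ∸ k) + (c ∸ (k + (x + y)))) + (W e (c + e) as k + W e (c + e) as (k + (x + y)))
    main with k <? c
    ... | yes k<c = +-mono-<-≤ (*-monoʳ-< a ⦃ >-nonZero 1≤a ⦄ (∸-convex-strict c k x y 1≤x 1≤y k<c
                      (≤-<-trans c≤ (+-monoʳ-< k e<)))) (W-convex e (c + e) as k x y)
    ... | no k≮c = +-mono-≤-< (*-monoʳ-≤ a (∸-convex c k x y))
      (W-convex-strict e (c + e) as k x y 1≤x 1≤y e< pos (+-monoˡ-≤ e (≮⇒≥ k≮c))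
        (<-≤-trans <c (≤-reflexive (sym (+-assoc c e _)))))

  weights : List ℕ → List ℕ
  weights []       = []
  weights (a ∷ as) = sum (a ∷ as) ∷ weights as

  -- For w > v the difference t^w - t^v has order v, so each pair contributes the weight that comes
  -- later in the decreasing list.
  orderΔ : List ℕ → ℕ
  orderΔ []       = 0
  orderΔ (a ∷ as) = sum (weights as) + orderΔ as

  triangle : ℕ → ℕ
  triangle zero    = 0
  triangle (suc m) = suc m + triangle m

  sum-weights : ∀ as → sum (weights as) ≡ weighted suc as
  sum-weights []       = refl
  sum-weights (a ∷ as) = begin-equality
    a + sum as + sum (weights as)                  ≡⟨ cong (λ z → a + sum as + z) (sum-weights as) ⟩
    a + sum as + weighted suc as                   ≡⟨ +-assoc a _ _ ⟩
    a + (sum as + weighted suc as)                 ≡⟨ cong₂ _+_ (sym (*-identityʳ a))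
      (trans (cong (λ z → z + weighted suc as) (sym (weighted-const1 as))) (sym (weighted-+ (λ _ → 1) suc as))) ⟩
    a * 1 + weighted (suc ∘ suc) as ∎
    where open ≤-Reasoning

  -- The entry of index m is part of the weights 0, ..., m, so it is counted once for each pair of
  -- these.
  orderΔ-weighted : ∀ as → orderΔ as ≡ weighted triangle as
  orderΔ-weighted []       = refl
  orderΔ-weighted (a ∷ as) = begin-equality
    sum (weights as) + orderΔ as                 ≡⟨ cong₂ _+_ (sum-weights as) (orderΔ-weighted as) ⟩
    weighted suc as + weighted triangle as       ≡⟨ weighted-+ suc triangle as ⟨
    weighted (triangle ∘ suc) as                 ≡⟨ cong (_+ weighted (triangle ∘ suc) as) (*-zeroʳ a) ⟨
    a * 0 + weighted (triangle ∘ suc) as ∎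
    where open ≤-Reasoning

  -- The coefficient of the entry of index m in the order of the dominant term, restricted to the
  -- rows i, ..., i + N - 1. Both m and i count from 0.
  orders : ℕ → ℕ → ℕ → ℕ → ℕ → ℕ
  orders n e i zero    m = 0
  orders n e i (suc N) m = ((suc m * e) ∸ (suc i * n)) + orders n e (suc i) N m

  2*triangle : ∀ m → 2 * triangle m ≡ m * suc m
  2*triangle zero    = refl
  2*triangle (suc m) = trans (*-distribˡ-+ 2 (suc m) (triangle m)) (trans (cong (λ z → 2 * suc m + z)
      (2*triangle m)) (alg m))
    where
    alg : ∀ m → 2 * suc m + m * suc m ≡ suc m * suc (suc m)
    alg = solve-∀

  orders-zero : ∀ n e i N m → suc m * e ≤ suc i * n → orders n e i N m ≡ 0
  orders-zero n e i zero    m le = refl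
  orders-zero n e i (suc N) m le = cong₂ _+_ (m≤n⇒m∸n≡0 le)
    (orders-zero n e (suc i) N m (≤-trans le (*-monoˡ-≤ n (n≤1+n (suc i)))))

  -- The bound excludes truncation in all N terms, so the subtracted numbers form an arithmetic
  -- progression.
  orders-sum : ∀ n e i N m → (i + N) * n ≤ suc m * e →
               orders n e i N m + n * (i * N + triangle N) ≡ N * (suc m * e)
  orders-sum n e i zero    m le = trans (cong (λ z → n * z) (trans (+-identityʳ _) (*-zeroʳ i))) (*-zeroʳ n)
  orders-sum n e i (suc N) m le = begin-equality
    (E ∸ suc i * n) + orders n e (suc i) N m + n * (i * suc N + (suc N + triangle N))
      ≡⟨ alg (E ∸ suc i * n) (orders n e (suc i) N m) n i N (triangle N) ⟩
    ((E ∸ suc i * n) + suc i * n) + (orders n e (suc i) N m + n * (suc i * N + triangle N))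
      ≡⟨ cong₂ _+_ (m∸n+n≡m (≤-trans (*-monoˡ-≤ n (≤-trans (s≤s (m≤m+n i N)) (≤-reflexive (sym (+-suc i N))))) le))
                   (orders-sum n e (suc i) N m (≤-trans (≤-reflexive (cong (λ z → z * n) (sym (+-suc i N)))) le)) ⟩
    E + N * E ∎
    where
    open ≤-Reasoning
    E = suc m * e
    alg : ∀ a b n i N t → a + b + n * (i * suc N + (suc N + t)) ≡ a + suc i * n + (b + n * (suc i * N + t))
    alg = solve-∀

  orders-step : ∀ n e i N m → orders n e i N (suc m) ≤ orders n e i N m + N * e
  orders-step n e i zero    m = z≤n
  orders-step n e i (suc N) m = begin
    (suc (suc m) * e ∸ suc i * n) + orders n e (suc i) N (suc m)
      ≤⟨ +-mono-≤ (m≤n+o⇒m∸n≤o (e + suc m * e) (suc i * n) (begin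
          e + suc m * e                              ≡⟨ +-comm e _ ⟩
          suc m * e + e                              ≤⟨ +-monoˡ-≤ e (m≤n+m∸n (suc m * e) (suc i * n)) ⟩
          suc i * n + (suc m * e ∸ suc i * n) + e    ≡⟨ +-assoc (suc i * n) _ e ⟩
          suc i * n + ((suc m * e ∸ suc i * n) + e) ∎)) (orders-step n e (suc i) N m) ⟩
    ((suc m * e ∸ suc i * n) + e) + (orders n e (suc i) N m + N * e)
      ≡⟨ alg (suc m * e ∸ suc i * n) e (orders n e (suc i) N m) (N * e) ⟩
    (suc m * e ∸ suc i * n) + orders n e (suc i) N m + (e + N * e) ∎
    where
    open ≤-Reasoning
    alg : ∀ a b c d → (a + b) + (c + d) ≡ a + c + (b + d)
    alg = solve-∀

  -- (d - q) (n d - (q + 1) g) = 0, expanded and with the negative terms moved to the right.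
  factor-quadratic : ∀ n d q g → n * (d * d) + suc q * q * g ≡ d * (suc q * g) + q * (n * d) →
                     d ≡ q ⊎ n * d ≡ suc q * g
  factor-quadratic n d q g eq with <-cmp d q
  ... | tri≈ _ e _ = inj₁ e
  ... | tri< d<q _ _ with m≤n⇒∃[o]m+o≡n d<q
  ...   | s , refl = inj₂ (sym (*-cancelˡ-≡ (suc (suc d + s) * g) (n * d) (suc s) (+-cancelˡ-≡ (n *
      (d * d) + d * (suc (suc d + s) * g)) _ _
          (trans (alg₁ n d s g) (trans eq (alg₂ n d s g))))))
    where
    alg₁ : ∀ n d s g → n * (d * d) + d * (suc (suc d + s) * g) + suc s * (suc (suc d + s) * g)
                        ≡ n * (d * d) + suc (suc d + s) * (suc d + s) * g
    alg₁ = solve-∀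
    alg₂ : ∀ n d s g → d * (suc (suc d + s) * g) + (suc d + s) * (n * d)
                        ≡ n * (d * d) + d * (suc (suc d + s) * g) + suc s * (n * d)
    alg₂ = solve-∀
  factor-quadratic n d q g eq | tri> _ _ q<d with m≤n⇒∃[o]m+o≡n q<d
  ...   | s , refl = inj₂ (*-cancelˡ-≡ (n * (suc q + s)) (suc q * g) (suc s) (+-cancelˡ-≡ (q * (n *
      (suc q + s)) + suc q * q * g) _ _
          (trans (alg₁ n q s g) (trans eq (alg₂ n q s g)))))
    where
    alg₁ : ∀ n q s g → q * (n * (suc q + s)) + suc q * q * g + suc s * (n * (suc q + s))
                        ≡ n * ((suc q + s) * (suc q + s)) + suc q * q * g
    alg₁ = solve-∀
    alg₂ : ∀ n q s g → (suc q + s) * (suc q * g) + q * (n * (suc q + s))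
                        ≡ q * (n * (suc q + s)) + suc q * q * g + suc s * (suc q * g)
    alg₂ = solve-∀

  -- Put N = p - 1, Q = r - 1 and k = N - e, with m counted from 0. The equation for m = 1 gives g =
  -- 2e - N; that for m = Q, where nothing is truncated, gives (d - Q)(N d - r g) = 0. If d = Q, the
  -- bound d N ≤ r e gives r k ≤ N. Otherwise N(r - d) = 2 r k, and the growth from m = Q - 1 to m =
  -- Q again gives r k ≤ N, so r - d is at most 2; its values 0, 1, 2 are the three families.
  ℬ-from-orders : ∀ n r e d g → 2 ≤ r → 1 ≤ d → d ≤ suc n → 1 ≤ g → 1 ≤ n → e ≤ n → d * n ≤ r * e →
                  (∀ m → m < r → orders n e 0 d m ≡ g * triangle m) → ℬ (suc n) r e d
  ℬ-from-orders n (suc zero) e (suc d′) g (s≤s ())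
  ℬ-from-orders n (suc (suc q)) e (suc d′) g 2≤r _ d≤p 1≤g 1≤n e≤n dn≤re eqs with m≤n⇒∃[o]m+o≡n e≤n
  ... | k , refl = conclude (factor-quadratic N d Q g quadratic)
    where
    open ≤-Reasoning
    N = e + k
    d = suc d′
    Q = suc q
    r = suc Q
    g≡ : (2 * e) ∸ N ≡ g
    g≡ = begin-equality
      (2 * e) ∸ N                              ≡⟨ cong ((2 * e) ∸_) (*-identityˡ N) ⟨
      (2 * e) ∸ (1 * N)                        ≡⟨ +-identityʳ _ ⟨
      (2 * e) ∸ (1 * N) + 0                    ≡⟨ cong (λ z → (2 * e) ∸ (1 * N) + z) (orders-zero N e 1 d′ 1
          (*-monoʳ-≤ 2 (m≤m+n e k))) ⟨
      orders N e 0 d 1                         ≡⟨ eqs 1 (s≤s (s≤s z≤n)) ⟩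
      g * 1                                    ≡⟨ *-identityʳ g ⟩
      g ∎
    N<2e : N < 2 * e
    N<2e = m∸n≢0⇒n<m (λ z → <-irrefl refl (subst (1 ≤_) (trans (sym g≡) z) 1≤g))
    2e≡ : 2 * e ≡ N + g
    2e≡ = trans (sym (m+[n∸m]≡n (<⇒≤ N<2e))) (cong (λ z → N + z) g≡)
    e≡ : e ≡ k + g
    e≡ = +-cancelˡ-≡ e _ _ (trans (cong (λ z → e + z) (sym (+-identityʳ e))) (trans 2e≡ (+-assoc e k g)))
    total : g * triangle Q + N * triangle d ≡ d * (r * e)
    total = trans (cong (λ z → z + N * triangle d) (sym (eqs Q ≤-refl))) (orders-sum N e 0 d Q dn≤re)
    quadratic : N * (d * d) + r * Q * g ≡ d * (r * g) + Q * (N * d)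
    quadratic = +-cancelʳ-≡ (N * d) _ _ (begin-equality
      N * (d * d) + r * Q * g + N * d                   ≡⟨ alg₁ N d r Q g ⟩
      g * (Q * r) + N * (d * suc d)                     ≡⟨ cong₂ (λ a b → g * a + N * b) (2*triangle Q)
          (2*triangle d) ⟨
      g * (2 * triangle Q) + N * (2 * triangle d)       ≡⟨ alg₂ g N (triangle Q) (triangle d) ⟩
      2 * (g * triangle Q + N * triangle d)             ≡⟨ cong (λ z → 2 * z) total ⟩
      2 * (d * (r * e))                                 ≡⟨ alg₃ d r e ⟩
      d * (r * (2 * e))                                 ≡⟨ cong (λ a → d * (r * a)) 2e≡ ⟩
      d * (r * (N + g))                                 ≡⟨ alg₄ d Q N g ⟩
      d * (r * g) + Q * (N * d) + N * d ∎)
      where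
      alg₁ : ∀ N d r Q g → N * (d * d) + r * Q * g + N * d ≡ g * (Q * r) + N * (d * suc d)
      alg₁ = solve-∀
      alg₂ : ∀ g N a b → g * (2 * a) + N * (2 * b) ≡ 2 * (g * a + N * b)
      alg₂ = solve-∀
      alg₃ : ∀ d r e → 2 * (d * (r * e)) ≡ d * (r * (2 * e))
      alg₃ = solve-∀
      alg₄ : ∀ d Q N g → d * (suc Q * (N + g)) ≡ d * (suc Q * g) + Q * (N * d) + N * d
      alg₄ = solve-∀
    -- The right sides for m = Q and m = Q - 1 differ by g Q, while each of the d summands on the
    -- left grows by at most e.
    degree : g * Q ≤ d * e
    degree = +-cancelˡ-≤ (g * triangle q) _ _ (begin
      g * triangle q + g * Q       ≡⟨ +-comm (g * triangle q) (g * Q) ⟩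
      g * Q + g * triangle q       ≡⟨ *-distribˡ-+ g Q (triangle q) ⟨
      g * triangle Q               ≡⟨ eqs Q ≤-refl ⟨
      orders N e 0 d Q             ≤⟨ orders-step N e 0 d q ⟩
      orders N e 0 d q + d * e     ≡⟨ cong (λ z → z + d * e) (eqs q (s≤s (n≤1+n q))) ⟩
      g * triangle q + d * e ∎)
    k≡ : N ∸ e ≡ k
    k≡ = m+n∸m≡n e k
    bound : Q * N ≤ r * e → r * k ≤ N
    bound le = +-cancelˡ-≤ (Q * N) _ _ (begin
      Q * N + r * k  ≤⟨ +-monoˡ-≤ (r * k) le ⟩
      r * e + r * k  ≡⟨ alg Q e k ⟩
      Q * N + N ∎)
      where
      alg : ∀ Q e k → suc Q * e + suc Q * k ≡ Q * (e + k) + (e + k)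
      alg = solve-∀
    middle : d ≡ Q → ℬ (suc N) r e d
    middle d≡Q = inj₂ (inj₁ (2≤r , s≤s (subst (_≤ suc N) d≡Q d≤p) , N<2e , e≤n
      , ≤-trans (≤-reflexive (cong (λ z → r * z) k≡)) (bound (subst (λ m → m * N ≤ r * e) d≡Q dn≤re)) , d≡Q))
    rN : N * d ≡ r * g → N * d + 2 * (r * k) ≡ N * r
    rN Nd≡rg = begin-equality
      N * d + 2 * (r * k)        ≡⟨ cong (_+ 2 * (r * k)) Nd≡rg ⟩
      r * g + 2 * (r * k)        ≡⟨ alg r g k ⟩
      (k + g + k) * r            ≡⟨ cong (λ a → (a + k) * r) e≡ ⟨
      N * r ∎
      where
      alg : ∀ r g k → r * g + 2 * (r * k) ≡ (k + g + k) * r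
      alg = solve-∀
    conclude : d ≡ Q ⊎ N * d ≡ r * g → ℬ (suc N) r e d
    conclude (inj₁ d≡Q) = middle d≡Q
    conclude (inj₂ Nd≡rg) with m≤n⇒∃[o]m+o≡n (*-cancelˡ-≤ {d} {r} N ⦃ >-nonZero 1≤n ⦄
                                 (≤-trans (m≤m+n (N * d) _) (≤-reflexive (rN Nd≡rg))))
    ... | c , d+c≡r = by-defect c d+c≡r (+-cancelˡ-≡ (N * d) _ _
                        (trans (rN Nd≡rg) (trans (cong (λ z → N * z) (sym d+c≡r)) (*-distribˡ-+ N d c))))
      where
      rk≤N : r * k ≤ N
      rk≤N = bound (*-cancelˡ-≤ g ⦃ >-nonZero 1≤g ⦄ (begin
        g * (Q * N)        ≡⟨ alg₁ g Q N ⟩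
        N * (g * Q)        ≤⟨ *-monoʳ-≤ N degree ⟩
        N * (d * e)        ≡⟨ *-assoc N d e ⟨
        N * d * e          ≡⟨ cong (λ z → z * e) Nd≡rg ⟩
        r * g * e          ≡⟨ alg₂ r g e ⟩
        g * (r * e) ∎))
        where
        alg₁ : ∀ g Q N → g * (Q * N) ≡ N * (g * Q)
        alg₁ = solve-∀
        alg₂ : ∀ r g e → r * g * e ≡ g * (r * e)
        alg₂ = solve-∀
      by-defect : ∀ c → d + c ≡ r → 2 * (r * k) ≡ N * c → ℬ (suc N) r e d
      by-defect 0 d≡ 2rk = inj₁ (2≤r , subst (_≤ suc N) d≡r d≤p , e≡N , d≡r)
        where
        d≡r : d ≡ r
        d≡r = trans (sym (+-identityʳ d)) d≡
        k≡0 : k ≡ 0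
        k≡0 = m+n≡0⇒m≡0 k (m+n≡0⇒m≡0 (r * k) (trans 2rk (*-zeroʳ N)))
        e≡N : e ≡ N
        e≡N = sym (trans (cong (λ z → e + z) k≡0) (+-identityʳ e))
      by-defect 1 d≡ _   = middle (suc-injective (trans (+-comm 1 d) d≡))
      by-defect 2 d≡ 2rk = inj₂ (inj₂ (2≤r , N<2e , e≤n
        , trans (cong (λ z → r * z) k≡) (*-cancelˡ-≡ _ N 2 (trans 2rk (*-comm N 2)))
        , suc-injective (suc-injective (trans (+-comm 2 d) d≡))))
      by-defect (suc (suc (suc c))) _ 2rk = ⊥-elim (<-irrefl refl (begin-strict
        N * 2                      <⟨ *-monoʳ-< N ⦃ >-nonZero 1≤n ⦄ (s≤s (s≤s (s≤s z≤n))) ⟩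
        N * suc (suc (suc c))      ≡⟨ 2rk ⟨
        2 * (r * k)                ≤⟨ *-monoʳ-≤ 2 rk≤N ⟩
        2 * N                      ≡⟨ *-comm 2 N ⟩
        N * 2 ∎))

open Arithmetic

-- Orders at t = 0 and leading coefficients

NoZeroDivisors : CommutativeRing 0ℓ 0ℓ → Set
NoZeroDivisors k = ∀ {a b} → ¬ a ≈ 0# → ¬ b ≈ 0# → ¬ a * b ≈ 0#
  where open CommutativeRing k

PrimeToNonzero : CommutativeRing 0ℓ 0ℓ → ℕ → Set
PrimeToNonzero k p = ∀ {s} → ¬ p ∣ s → ¬ ι s ≈ 0#
  where
  open CommutativeRing k
  open Integers k

module Leading (k : CommutativeRing 0ℓ 0ℓ) (n : ℕ) (prime : Prime (suc n))
    (no-zero-divisors : NoZeroDivisors k) (ι-nonzero : PrimeToNonzero k (suc n)) where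
  open import Data.Nat.Combinatorics using (_C_; nCn≡1; nCk≡nC[n∸k]; nCk+nC[k+1]≡[n+1]C[k+1]; k![n∸k]!∣n!)
  open CommutativeRing k hiding (zero)
  open PrimeNat n prime
  open Convolution k
  open Integers k
  open import Algebra.Properties.Ring ring using (-0#≈0#; -‿involutive)
  open SetoidReasoning setoid

  K = powerSeries k
  module K = CommutativeRing K
  module L = LinearFactors k
  module LK = LinearFactors K
  module DK = Determinants K
  open import Algebra.Properties.Semiring.Exp K.semiring using () renaming (_^_ to _^ᴷ_)

  NZ : Carrier → Set
  NZ c = ¬ c ≈ 0#

  NZ-resp : ∀ {a b} → a ≈ b → NZ b → NZ a
  NZ-resp e nz z = nz (trans (sym e) z)

  NZ-neg : ∀ {a} → NZ a → NZ (- a)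
  NZ-neg nz z = nz (trans (sym (-‿involutive _)) (trans (-‿cong z) -0#≈0#))

  NZ-1 : NZ 1#
  NZ-1 = NZ-resp (sym (+-identityʳ 1#)) (ι-nonzero 1∤)

  Ord : ℕ → Seq → Set
  Ord m u = ∀ i → i ℕ.< m → u i ≈ 0#

  -- The order is a relation, not a function: it cannot be computed from a series, and for most
  -- terms the lower bound `Ord` suffices.
  Lead : ℕ → Seq → Set
  Lead m u = Ord m u × NZ (u m)

  Ord-cong : ∀ {m u v} → u ≋ v → Ord m v → Ord m u
  Ord-cong e o i lt = trans (e i) (o i lt)

  Lead-cong : ∀ {m u v} → u ≋ v → Lead m v → Lead m u
  Lead-cong {m} e (o , nz) = Ord-cong e o , NZ-resp (e m) nz

  Ord-≤ : ∀ {l m u} → l ℕ.≤ m → Ord m u → Ord l u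
  Ord-≤ le o i lt = o i (ℕ.≤-trans lt le)

  Ord-0 : ∀ m → Ord m K.0#
  Ord-0 m _ _ = refl

  Ord-+ : ∀ {m u v} → Ord m u → Ord m v → Ord m (u K.+ v)
  Ord-+ o o′ i lt = trans (+-cong (o i lt) (o′ i lt)) (+-identityˡ _)

  Ord-neg : ∀ {m u} → Ord m u → Ord m (K.- u)
  Ord-neg o i lt = trans (-‿cong (o i lt)) -0#≈0#

  Lead-+ : ∀ {m u v} → Lead m u → Ord (suc m) v → Lead m (u K.+ v)
  Lead-+ (o , nz) o′ = Ord-+ o (Ord-≤ (ℕ.n≤1+n _) o′)
                     , NZ-resp (trans (+-congˡ (o′ _ ℕ.≤-refl)) (+-identityʳ _)) nz

  Lead-neg : ∀ {m u} → Lead m u → Lead m (K.- u)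
  Lead-neg (o , nz) = Ord-neg o , NZ-neg nz

  private
    ⊛-low : ∀ {l} u {v} → Ord l v → Ord l (u ⊛ v)
    ⊛-low u o zero    lt = trans (*-congˡ (o 0 lt)) (zeroʳ _)
    ⊛-low u o (suc i) lt = trans (+-cong (trans (*-congˡ (o _ lt)) (zeroʳ _))
      (⊛-low (u ∘ suc) o i (ℕ.<⇒≤ lt))) (+-identityˡ _)

    ⊛-at : ∀ l u {v} → Ord l v → (u ⊛ v) l ≈ u 0 * v l
    ⊛-at zero    u o = refl
    ⊛-at (suc l) u o = trans (+-congˡ (⊛-low (u ∘ suc) o l ℕ.≤-refl)) (+-identityʳ _)

  Ord-⊛ : ∀ m {l u v} → Ord m u → Ord l v → Ord (m ℕ.+ l) (u ⊛ v)
  Ord-⊛ zero    {u = u} o o′ = ⊛-low u o′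
  Ord-⊛ (suc m) o o′ zero    lt       = trans (*-congʳ (o 0 (s≤s z≤n))) (zeroˡ _)
  Ord-⊛ (suc m) o o′ (suc i) (s≤s lt) = trans (+-cong (trans (*-congʳ (o 0 (s≤s z≤n))) (zeroˡ _))
    (Ord-⊛ m (λ j lt → o (suc j) (s≤s lt)) o′ i lt)) (+-identityˡ _)

  ⊛-leading : ∀ m {l u v} → Ord m u → Ord l v → (u ⊛ v) (m ℕ.+ l) ≈ u m * v l
  ⊛-leading zero    {l} {u} o o′ = ⊛-at l u o′
  ⊛-leading (suc m) o o′ = trans (+-cong (trans (*-congʳ (o 0 (s≤s z≤n))) (zeroˡ _))
    (⊛-leading m (λ j lt → o (suc j) (s≤s lt)) o′)) (+-identityˡ _)

  Lead-⊛ : ∀ {m l u v} → Lead m u → Lead l v → Lead (m ℕ.+ l) (u ⊛ v)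
  Lead-⊛ {m} (o , nz) (o′ , nz′) = Ord-⊛ m o o′ , NZ-resp (⊛-leading m o o′) (no-zero-divisors nz nz′)

  Lead-1 : Lead 0 K.1#
  Lead-1 = (λ _ ()) , NZ-1

  Lead-^ : ∀ g {m u} → Lead m u → Lead (g ℕ.* m) (u ^ᴷ g)
  Lead-^ zero    l = Lead-1
  Lead-^ (suc g) l = Lead-⊛ l (Lead-^ g l)

  Lead-unique : ∀ {m l u} → Lead m u → Lead l u → m ≡ l
  Lead-unique {m} {l} (o , nz) (o′ , nz′) with ℕ.<-cmp m l
  ... | tri< m<l _ _ = ⊥-elim (nz (o′ m m<l))
  ... | tri≈ _ e _   = e
  ... | tri> _ _ l<m = ⊥-elim (nz′ (o l l<m))

  t : ℕ → Seq
  t w = L.xpow w K.1#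

  t-⊛ : ∀ w v → t w ⊛ v ≋ L.xpow w v
  t-⊛ zero    v = K.*-identityˡ v
  t-⊛ (suc w) v = K.trans (K.*-assoc L.X (t w) v) (K.*-congˡ {L.X} (t-⊛ w v))

  Ord-xpow : ∀ w {m u} → Ord m u → Ord (w ℕ.+ m) (L.xpow w u)
  Ord-xpow zero    o = o
  Ord-xpow (suc w) o zero    lt       = zeroˡ _
  Ord-xpow (suc w) o (suc i) (s≤s lt) = trans (L.X-⊛-suc _ i) (Ord-xpow w o i lt)

  Lead-t : ∀ w → Lead w (t w)
  Lead-t w = ≡.subst (λ m → Lead m (t w)) (ℕ.+-identityʳ w)
    (Ord-xpow w (λ _ ()) , NZ-resp (L.xpow-+ w K.1# 0) NZ-1)

  -t-⊛ : ∀ w v → (K.- t w) ⊛ v ≋ K.- L.xpow w v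
  -t-⊛ w v = K.trans (solveᴷ 2 (λ a b → ((⊟ a) ⊠ b) ⊜ (⊟ (a ⊠ b))) (λ _ → refl) (t w) v)
    (K.-‿cong (t-⊛ w v))
    where open Integers K using () renaming (solve to solveᴷ; _:=_ to _⊜_; _:*_ to _⊠_; :-_ to ⊟_)

  -- The binomial divides e !, a product of numbers below p.
  binomial∤ : ∀ {e i} → i ℕ.≤ e → e ℕ.≤ n → ¬ p ∣ e C i
  binomial∤ {e} {i} i≤e e≤n d = factorial∤ e e≤n (∣-trans d
    (≡.subst (_∣ e !) (≡.sym (nCk≡n!/k![n-k]! i≤e)) (m/n∣m ⦃ i ℕ.!* (e ∸ i) !≢0 ⦄ (k![n∸k]!∣n! i≤e))))
    where
    factorial∤ : ∀ m → m ℕ.≤ n → ¬ p ∣ m !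
    factorial∤ zero    le = 1∤
    factorial∤ (suc m) le = p∤* (small∤ (s≤s z≤n) le) (factorial∤ m (ℕ.<⇒≤ le))

  -- In (x - t^w)^s · H the coefficient of index s + j is led by x^s · H j, and
  -- that of index i with s = i + j by binom(s, i) x^i (- t^w)^j · H 0.
  module Multiply (w : ℕ) (H : LK.S.Carrier) (w₀ : ℕ → ℕ)
      (ordH : ∀ j → Ord (w₀ j) (H j)) (slope : ∀ j → w₀ j ℕ.< w ℕ.+ w₀ (suc j)) where

    G : ℕ → LK.S.Carrier
    G s = LK.pw (t w) s LK.S.* H

    G-suc : ∀ s m → G (suc s) (suc m) ≋ G s m K.+ (K.- L.xpow w (G s (suc m)))
    G-suc s m = K.trans (LK.S.*-assoc (LK.lin (t w)) (LK.pw (t w) s) H (suc m))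
      (K.trans (LK.lin-⊛-suc (t w) (G s) m) (K.+-congˡ {G s m} (-t-⊛ w (G s (suc m)))))

    G-zero : ∀ s → G (suc s) 0 ≋ K.- L.xpow w (G s 0)
    G-zero s = K.trans (LK.S.*-assoc (LK.lin (t w)) (LK.pw (t w) s) H 0)
      (K.trans (LK.lin-⊛-zero (t w) (G s)) (-t-⊛ w (G s 0)))

    -- By `slope` the second term of `G-suc` has order at least w + w₀ (j + 1) > w₀ j, so it cannot
    -- disturb the first.
    above : ∀ s j → Ord (w₀ j) (G s (s ℕ.+ j)) × G s (s ℕ.+ j) (w₀ j) ≈ H j (w₀ j)
    above zero    j = Ord-cong (LK.S.*-identityˡ H j) (ordH j) , LK.S.*-identityˡ H j (w₀ j)
    above (suc s) j with above s j | ≡.subst (λ m → Ord (w₀ (suc j)) (G s m)) (ℕ.+-suc s j) (proj₁ (above s (suc j)))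
    ... | o , v | o′ = Ord-cong (G-suc s (s ℕ.+ j)) (Ord-+ o (Ord-≤ (ℕ.<⇒≤ (slope j)) o″))
      , trans (G-suc s (s ℕ.+ j) (w₀ j)) (trans (+-cong v (o″ (w₀ j) (slope j))) (+-identityʳ _))
      where
      o″ : Ord (w ℕ.+ w₀ (suc j)) (K.- L.xpow w (G s (suc (s ℕ.+ j))))
      o″ = Ord-neg (Ord-xpow w o′)

    signed : ℕ → Carrier
    signed zero    = H 0 (w₀ 0)
    signed (suc j) = - signed j

    order : ℕ → ℕ
    order j = j ℕ.* w ℕ.+ w₀ 0

    -- Here both terms of `G-suc` are known to the same order, and their coefficients there add up
    -- by Pascal's rule.
    below : ∀ j i → Ord (order j) (G (i ℕ.+ j) i) × G (i ℕ.+ j) i (order j) ≈ ι ((i ℕ.+ j) C i) * signed j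
    below zero i with above i 0
    ... | o , v = ≡.subst (λ m → Ord (w₀ 0) (G m i)) (≡.sym (ℕ.+-identityʳ i))
        (≡.subst (λ m → Ord (w₀ 0) (G i m)) (ℕ.+-identityʳ i) o)
      , (begin
        G (i ℕ.+ 0) i (w₀ 0)            ≡⟨ ≡.cong (λ m → G m i (w₀ 0)) (ℕ.+-identityʳ i) ⟩
        G i i (w₀ 0)                    ≡⟨ ≡.cong (λ m → G i m (w₀ 0)) (ℕ.+-identityʳ i) ⟨
        G i (i ℕ.+ 0) (w₀ 0)            ≈⟨ v ⟩
        H 0 (w₀ 0)                      ≈⟨ trans (*-congʳ (+-identityʳ 1#)) (*-identityˡ _) ⟨
        ι 1 * H 0 (w₀ 0)                ≡⟨ ≡.cong (λ m → ι m * H 0 (w₀ 0)) (≡.sym (≡.trans (≡.cong (_C i)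
            (ℕ.+-identityʳ i)) (nCn≡1 i))) ⟩
        ι ((i ℕ.+ 0) C i) * H 0 (w₀ 0) ∎)
    below (suc j) zero with below j 0
    ... | o , v = ≡.subst (λ m → Ord m (G (suc j) 0)) (≡.sym (ℕ.+-assoc w (j ℕ.* w) (w₀ 0)))
        (Ord-cong (G-zero j) (Ord-neg (Ord-xpow w o)))
      , (begin
        G (suc j) 0 (order (suc j))              ≡⟨ ≡.cong (G (suc j) 0) (ℕ.+-assoc w (j ℕ.* w) (w₀ 0)) ⟩
        G (suc j) 0 (w ℕ.+ order j)              ≈⟨ G-zero j _ ⟩
        - L.xpow w (G j 0) (w ℕ.+ order j)       ≈⟨ -‿cong (trans (L.xpow-+ w (G j 0) (order j)) v) ⟩
        - (ι (j C 0) * signed j)                 ≈⟨ solve 2 (λ c s → (:- (c :* s)) := (c :* (:- s))) refl _ _ ⟩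
        ι (j C 0) * - signed j                   ≡⟨ ≡.cong (λ m → ι m * - signed j) (≡.trans (C0 j) (≡.sym (C0
            (suc j)))) ⟩
        ι (suc j C 0) * signed (suc j) ∎)
      where
      C0 : ∀ m → m C 0 ≡ 1
      C0 m = ≡.trans (nCk≡nC[n∸k] {0} {m} z≤n) (nCn≡1 m)
    below (suc j) (suc i) with below (suc j) i | below j (suc i)
    ... | o , v | o′ , v′ = ≡.subst (λ m → Ord m (G (suc s) (suc i))) (≡.sym assoc)
        (Ord-cong (G-suc s i) (Ord-+ (≡.subst (λ m → Ord m (G s i)) assoc o) (Ord-neg (Ord-xpow w o″))))
      , (begin
        G (suc s) (suc i) (order (suc j))        ≡⟨ ≡.cong (G (suc s) (suc i)) assoc ⟩
        G (suc s) (suc i) (w ℕ.+ order j)        ≈⟨ G-suc s i _ ⟩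
        G s i (w ℕ.+ order j) - L.xpow w (G s (suc i)) (w ℕ.+ order j)
          ≈⟨ +-cong (trans (reflexive (≡.cong (G s i) (≡.sym assoc))) v)
                    (-‿cong (trans (L.xpow-+ w (G s (suc i)) (order j)) v″)) ⟩
        ι (s C i) * - signed j - ι (s C suc i) * signed j
          ≈⟨ solve 3 (λ a b c → (a :* (:- c) :+ :- (b :* c)) := ((a :+ b) :* (:- c))) refl _ _ _ ⟩
        (ι (s C i) + ι (s C suc i)) * - signed j ≈⟨ *-congʳ (ι-+ (s C i) (s C suc i)) ⟨
        ι (s C i ℕ.+ s C suc i) * - signed j     ≡⟨ ≡.cong (λ m → ι m * - signed j) (nCk+nC[k+1]≡[n+1]C[k+1] s i) ⟩
        ι (suc s C suc i) * signed (suc j) ∎)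
      where
      s = i ℕ.+ suc j
      assoc : order (suc j) ≡ w ℕ.+ order j
      assoc = ℕ.+-assoc w (j ℕ.* w) (w₀ 0)
      o″ : Ord (order j) (G s (suc i))
      o″ = ≡.subst (λ m → Ord (order j) (G m (suc i))) (≡.sym (ℕ.+-suc i j)) o′
      v″ : G s (suc i) (order j) ≈ ι (s C suc i) * signed j
      v″ = ≡.subst (λ m → G m (suc i) (order j) ≈ ι (m C suc i) * signed j) (≡.sym (ℕ.+-suc i j)) v′

    NZ-signed : NZ (H 0 (w₀ 0)) → ∀ j → NZ (signed j)
    NZ-signed nz zero    = nz
    NZ-signed nz (suc j) = NZ-neg (NZ-signed nz j)

  module Power (e : ℕ) (e≤n : e ℕ.≤ n) where

    F : List ℕ → LK.S.Carrier
    F as = LK.P (map (_, e) (map t (weights as)))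

    -- The first root has the largest weight, and since a ≥ 1 it exceeds the steepest slope of the
    -- order function of the other factors; this is the condition `slope`. Indices below e fall into
    -- the binomial range, the others are shifted by e.
    coefficient : ∀ as → All (1 ℕ.≤_) as → ∀ i →
      Ord (W e e as i) (F as i) × (i ℕ.≤ length as ℕ.* e → NZ (F as i (W e e as i)))
    coefficient [] [] i = (λ _ ()) , λ { z≤n → NZ-1 }
    coefficient (a ∷ as) (1≤a ∷ pos) i = by-position (i ℕ.<? e)
      where
      w = sum (a ∷ as)
      IH = coefficient as pos
      open Multiply w (F as) (W e e as) (λ j → proj₁ (IH j))
        (λ j → ℕ.≤-<-trans (W-slope e e as j) (≡.subst (ℕ._< w ℕ.+ W e e as (suc j)) (ℕ.+-comm (sum as) _)
          (ℕ.+-monoˡ-< _ (ℕ.+-monoˡ-< (sum as) 1≤a))))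
      by-position : Dec (i ℕ.< e) → Ord (W e e (a ∷ as) i) (F (a ∷ as) i) ×
        (i ℕ.≤ length (a ∷ as) ℕ.* e → NZ (F (a ∷ as) i (W e e (a ∷ as) i)))
      by-position (yes i<e) with ℕ.m≤n⇒∃[o]m+o≡n (ℕ.<⇒≤ i<e)
      ... | j , ≡.refl = ≡.subst (λ m → Ord m (G e i) × (i ℕ.≤ length (a ∷ as) ℕ.* e → NZ (G e i m))) (≡.sym ord≡)
        (proj₁ (below j i) , λ _ → NZ-resp (proj₂ (below j i))
          (no-zero-divisors (ι-nonzero (binomial∤ (ℕ.m≤m+n i j) e≤n)) (NZ-signed (proj₂ (IH 0) z≤n) j)))
        where
        ord≡ : W e e (a ∷ as) i ≡ order j
        ord≡ = ≡.trans (W-∷ e e a as i) (≡.trans (≡.cong (a ℕ.* (e ∸ i) ℕ.+_) (W-shift e e as i))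
          (≡.trans (≡.cong₂ (λ u v → a ℕ.* u ℕ.+ (W e e as v ℕ.+ u ℕ.* sum as)) (ℕ.m+n∸m≡n i j) (ℕ.m≤n⇒m∸n≡0
              (ℕ.<⇒≤ i<e)))
            (alg a j (W e e as 0) (sum as))))
          where
          alg : ∀ a j u s → a ℕ.* j ℕ.+ (u ℕ.+ j ℕ.* s) ≡ j ℕ.* (a ℕ.+ s) ℕ.+ u
          alg = solve-∀
      by-position (no i≮e) with ℕ.m≤n⇒∃[o]m+o≡n (ℕ.≮⇒≥ i≮e)
      ... | j , ≡.refl = ≡.subst (λ m → Ord m (G e (e ℕ.+ j)) × (e ℕ.+ j ℕ.≤ length (a ∷ as) ℕ.* e → NZ (G e
          (e ℕ.+ j) m))) (≡.sym ord≡)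
        (proj₁ (above e j) , λ le → NZ-resp (proj₂ (above e j)) (proj₂ (IH j) (ℕ.+-cancelˡ-≤ e j _ le)))
        where
        ord≡ : W e e (a ∷ as) (e ℕ.+ j) ≡ W e e as j
        ord≡ = ≡.trans (W-∷ e e a as (e ℕ.+ j)) (≡.trans (≡.cong (a ℕ.* (e ∸ (e ℕ.+ j)) ℕ.+_) (W-shift e e as
            (e ℕ.+ j)))
          (≡.trans (≡.cong₂ (λ u v → a ℕ.* u ℕ.+ (W e e as v ℕ.+ u ℕ.* sum as)) (ℕ.m≤n⇒m∸n≡0 (ℕ.m≤m+n e j))
              (ℕ.m+n∸m≡n e j))
            (alg a (W e e as j))))
          where
          alg : ∀ a u → a ℕ.* 0 ℕ.+ (u ℕ.+ 0) ≡ u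
          alg = solve-∀

  -- The series a is left general because it is later a higher power of t in one place and 0 in
  -- another.
  Lead-diffs : ∀ {a} ws → All (λ w → Ord (suc w) a) ws → Lead (sum ws) (LK.diffs a (map t ws))
  Lead-diffs []       []       = Lead-1
  Lead-diffs {a} (w ∷ ws) (o ∷ os) = Lead-⊛ (Lead-cong (K.+-comm a (K.- t w)) (Lead-+ (Lead-neg (Lead-t w)) o))
      (Lead-diffs ws os)

  weights-< : ∀ a as → 1 ℕ.≤ a → All (1 ℕ.≤_) as → All (ℕ._< sum (a ∷ as)) (weights as)
  weights-< a as 1≤a pos = All.map (λ le → ℕ.≤-<-trans le (ℕ.m<n+m (sum as) 1≤a)) (weights-≤ as)
    where
    weights-≤ : ∀ as → All (ℕ._≤ sum as) (weights as)
    weights-≤ []       = []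
    weights-≤ (a ∷ as) = ℕ.≤-refl ∷ All.map (λ le → ℕ.≤-trans le (ℕ.m≤n+m (sum as) a)) (weights-≤ as)

  Lead-Δ : ∀ as → All (1 ℕ.≤_) as → Lead (orderΔ as) (LK.Δ (map t (weights as)))
  Lead-Δ []       []         = Lead-1
  Lead-Δ (a ∷ as) (1≤a ∷ pos) = Lead-⊛ (Lead-diffs (weights as)
    (All.map (λ lt → Ord-≤ lt (proj₁ (Lead-t (sum (a ∷ as))))) (weights-< a as 1≤a pos))) (Lead-Δ as pos)

-- Optimal matchings under a Monge inequality

from : ℕ → ℕ → List ℕ
from i zero    = []
from i (suc N) = i ∷ from (suc i) N

length-from : ∀ i N → length (from i N) ≡ N
length-from i zero    = ≡.refl
length-from i (suc N) = ≡.cong suc (length-from (suc i) N)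

from-snoc : ∀ i N → from i (suc N) ≡ from i N ++ [ i ℕ.+ N ]
from-snoc i zero    = ≡.cong [_] (≡.sym (ℕ.+-identityʳ i))
from-snoc i (suc N) = ≡.cong (i ∷_) (≡.trans (from-snoc (suc i) N)
  (≡.cong (λ m → from (suc i) N ++ [ m ]) (≡.sym (ℕ.+-suc i N))))

from-> : ∀ u i N → u ℕ.< i → All (u ℕ.<_) (from i N)
from-> u i zero    lt = []
from-> u i (suc N) lt = lt ∷ from-> u (suc i) N (ℕ.m≤n⇒m≤1+n lt)

from-ascending : ∀ i N → AllPairs ℕ._<_ (from i N)
from-ascending i zero    = []
from-ascending i (suc N) = from-> i (suc i) N ℕ.≤-refl ∷ from-ascending (suc i) N

from-< : ∀ i N d → i ℕ.+ N ℕ.≤ d → All (ℕ._< d) (from i N)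
from-< i zero    d le = []
from-< i (suc N) d le = ℕ.≤-trans (ℕ.m<m+n i (s≤s z≤n)) le
  ∷ from-< (suc i) N d (ℕ.≤-trans (ℕ.≤-reflexive (≡.sym (ℕ.+-suc i N))) le)

ascending-split : ∀ pre {v post} → AllPairs ℕ._<_ (pre ++ v ∷ post) →
                  All (ℕ._< v) pre × AllPairs ℕ._<_ (pre ++ post)
ascending-split []        (_ ∷ ps) = [] , ps
ascending-split (u ∷ pre) (p ∷ ps) with ascending-split pre ps
... | lt , qs = middle pre p ∷ lt , delete pre p ∷ qs
  where
  middle : ∀ pre {v post u} → All (u ℕ.<_) (pre ++ v ∷ post) → u ℕ.< v
  middle []        (p ∷ _)  = p
  middle (_ ∷ pre) (_ ∷ ps) = middle pre ps
  delete : ∀ {P : ℕ → Set} pre {v post} → All P (pre ++ v ∷ post) → All P (pre ++ post)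
  delete []        (_ ∷ ps) = ps
  delete (_ ∷ pre) (p ∷ ps) = p ∷ delete pre ps

All-split : ∀ {P : ℕ → Set} pre {v post} → All P (pre ++ v ∷ post) → P v × All P (pre ++ post)
All-split []        (p ∷ ps) = p , ps
All-split (_ ∷ pre) (p ∷ ps) = proj₁ (All-split pre ps) , p ∷ proj₂ (All-split pre ps)

matched : (ℕ → ℕ → ℕ) → ℕ → List ℕ → ℕ
matched w i []       = 0
matched w i (v ∷ vs) = w i v ℕ.+ matched w (suc i) vs

length-delete : ∀ (pre : List ℕ) {v post} → length (pre ++ v ∷ post) ≡ suc (length (pre ++ post))
length-delete []        = ≡.refl
length-delete (u ∷ pre) = ≡.cong suc (length-delete pre)

module Exchange (w : ℕ → ℕ → ℕ) (d : ℕ)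
  (monge : ∀ {i u v} → suc i ℕ.< d → u ℕ.< v → v ℕ.< d → w i u ℕ.+ w (suc i) v ℕ.< w i v ℕ.+ w (suc i) u) where

  mutual
    -- Moving v to the front crosses the columns of `pre` one at a time. Each crossing inverts an
    -- ascending pair in consecutive rows and raises the total, so the sorted matching is minimal,
    -- strictly once `pre` is nonempty.
    exchange : ∀ i pre v post → All (ℕ._< v) pre → v ℕ.< d → i ℕ.+ length (pre ++ v ∷ post) ℕ.≤ d →
               matched w i (pre ++ v ∷ post) ℕ.≤ w i v ℕ.+ matched w (suc i) (pre ++ post)
    exchange i []        v post _ _ _ = ℕ.≤-refl
    exchange i (u ∷ pre) v post (u<v ∷ lt) v<d le = ℕ.<⇒≤ (exchange-strict i u pre v post (u<v ∷ lt) v<d le)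

    exchange-strict : ∀ i u pre v post → All (ℕ._< v) (u ∷ pre) → v ℕ.< d →
      i ℕ.+ length (u ∷ pre ++ v ∷ post) ℕ.≤ d →
      matched w i (u ∷ pre ++ v ∷ post) ℕ.< w i v ℕ.+ matched w (suc i) (u ∷ pre ++ post)
    exchange-strict i u pre v post (u<v ∷ lt) v<d le = begin-strict
      w i u ℕ.+ matched w (suc i) (pre ++ v ∷ post)
        ≤⟨ ℕ.+-monoʳ-≤ (w i u) (exchange (suc i) pre v post lt v<d le′) ⟩
      w i u ℕ.+ (w (suc i) v ℕ.+ matched w (suc (suc i)) (pre ++ post))
        ≡⟨ ℕ.+-assoc (w i u) _ _ ⟨
      w i u ℕ.+ w (suc i) v ℕ.+ matched w (suc (suc i)) (pre ++ post)
        <⟨ ℕ.+-monoˡ-< _ (monge i<d u<v v<d) ⟩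
      w i v ℕ.+ w (suc i) u ℕ.+ matched w (suc (suc i)) (pre ++ post)
        ≡⟨ ℕ.+-assoc (w i v) _ _ ⟩
      w i v ℕ.+ (w (suc i) u ℕ.+ matched w (suc (suc i)) (pre ++ post)) ∎
      where
      open ℕ.≤-Reasoning
      le′ : suc i ℕ.+ length (pre ++ v ∷ post) ℕ.≤ d
      le′ = ℕ.≤-trans (ℕ.≤-reflexive (≡.sym (ℕ.+-suc i _))) le
      i<d : suc i ℕ.< d
      i<d = ℕ.≤-trans (≡.subst (λ m → suc (suc i) ℕ.≤ suc i ℕ.+ m) (≡.sym (length-delete pre))
        (≡.subst (suc (suc i) ℕ.≤_) (≡.sym (ℕ.+-suc (suc i) _)) (s≤s (ℕ.m≤m+n (suc i) _)))) le′

-- The dominant term of the determinant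

module DetLeading (k : CommutativeRing 0ℓ 0ℓ) (n : ℕ) (prime : Prime (suc n))
    (no-zero-divisors : NoZeroDivisors k) (ι-nonzero : PrimeToNonzero k (suc n)) where
  open Leading k n prime no-zero-divisors ι-nonzero
  open DK using (D; expand)
  private p = suc n

  expand-Ord : ∀ {m} (col : ℕ → LK.S.Carrier) h vs →
    (∀ pre v post → vs ≡ pre ++ v ∷ post → Ord m (h (col v) (map col (pre ++ post)))) →
    Ord m (expand h (map col vs))
  expand-Ord col h []       o = Ord-0 _
  expand-Ord col h (v ∷ vs) o = Ord-+ (o [] v vs ≡.refl)
    (Ord-neg (expand-Ord col (λ u us → h u (col v ∷ us)) vs (λ pre u post eq → o (v ∷ pre) u post (≡.cong
        (v ∷_) eq))))

  module Matching (w : ℕ → ℕ → ℕ) (col : ℕ → LK.S.Carrier) (φ : ℕ → ℕ) (d : ℕ)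
    (monge : ∀ {i u v} → suc i ℕ.< d → u ℕ.< v → v ℕ.< d → w i u ℕ.+ w (suc i) v ℕ.< w i v ℕ.+ w (suc i) u)
    (ordE : ∀ {i v} → i ℕ.< d → v ℕ.< d → Ord (w i v) (col v (φ i)))
    (nzE : ∀ {i} → i ℕ.< d → NZ (col i (φ i) (w i i))) where
    open Exchange w d monge

    private
      rows : ∀ {ρ : ℕ → ℕ} {i} → (∀ j → ρ j ≡ φ (i ℕ.+ j)) → ∀ j → ρ (suc j) ≡ φ (suc i ℕ.+ j)
      rows {i = i} eq j = ≡.trans (eq (suc j)) (≡.cong φ (ℕ.+-suc i j))

      row₀ : ∀ {ρ : ℕ → ℕ} {i} → (∀ j → ρ j ≡ φ (i ℕ.+ j)) → φ i ≡ ρ 0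
      row₀ {i = i} eq = ≡.sym (≡.trans (eq 0) (≡.cong φ (ℕ.+-identityʳ i)))

      next : ∀ {i N} → i ℕ.+ suc N ℕ.≤ d → suc i ℕ.+ N ℕ.≤ d
      next {i} {N} = ≡.subst (ℕ._≤ d) (ℕ.+-suc i N)

      bound : ∀ {i N} → i ℕ.+ suc N ℕ.≤ d → i ℕ.< d
      bound {i} le = ℕ.≤-trans (ℕ.m<m+n i (s≤s z≤n)) le

    -- A lower bound for every ascending choice of columns is enough: cancellation in a minor off
    -- the diagonal does no harm.
    Ord-D : ∀ N i vs {ρ} → (∀ j → ρ j ≡ φ (i ℕ.+ j)) → AllPairs ℕ._<_ vs → All (ℕ._< d) vs →
            length vs ≡ N → i ℕ.+ N ℕ.≤ d → Ord (matched w i vs) (D N ρ (map col vs))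
    Ord-D zero    i []       eq asc lt len le = λ _ ()
    Ord-D (suc N) i vs {ρ} eq asc lt len le = expand-Ord col _ vs term
      where
      term : ∀ pre v post → vs ≡ pre ++ v ∷ post →
             Ord (matched w i vs) (col v (ρ 0) K.* D N (ρ ∘ suc) (map col (pre ++ post)))
      term pre v post ≡.refl with ascending-split pre asc | All-split pre lt
      ... | lt-v , asc′ | v<d , lt′ = Ord-≤
        (exchange i pre v post lt-v v<d (≡.subst (λ m → i ℕ.+ m ℕ.≤ d) (≡.sym len) le))
        (Ord-⊛ (w i v) (≡.subst (λ m → Ord (w i v) (col v m)) (row₀ {ρ} eq) (ordE (bound le) v<d))
          (Ord-D N (suc i) (pre ++ post) (rows {ρ} eq) asc′ lt′
            (ℕ.suc-injective (≡.trans (≡.sym (length-delete pre)) len)) (next le)))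

    -- Choosing a column other than the first for row i costs at least one crossing, so those terms
    -- have order at least one higher than the diagonal.
    Lead-D : ∀ N i {ρ} → (∀ j → ρ j ≡ φ (i ℕ.+ j)) → i ℕ.+ N ℕ.≤ d →
             Lead (matched w i (from i N)) (D N ρ (map col (from i N)))
    Lead-D zero    i eq le = Lead-1
    Lead-D (suc N) i {ρ} eq le = Lead-+
      (Lead-⊛ (≡.subst (λ m → Lead (w i i) (col i m)) (row₀ {ρ} eq) (ordE (bound le) (bound le) , nzE (bound le)))
        (Lead-D N (suc i) (rows {ρ} eq) (next le)))
      (Ord-neg (expand-Ord col _ (from (suc i) N) term))
      where
      lt = from-< i (suc N) d le
      term : ∀ pre v post → from (suc i) N ≡ pre ++ v ∷ post →
             Ord (suc (matched w i (from i (suc N)))) (col v (ρ 0) K.* D N (ρ ∘ suc) (col i ∷ map col (pre ++ post)))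
      term pre v post split with ascending-split (i ∷ pre) (≡.subst (AllPairs ℕ._<_) (≡.cong (i ∷_) split)
          (from-ascending i (suc N)))
                            | All-split (i ∷ pre) (≡.subst (All (ℕ._< d)) (≡.cong (i ∷_) split) lt)
      ... | lt-v , asc′ | v<d , lt′ = Ord-≤
        (≡.subst (λ vs → suc (w i i ℕ.+ matched w (suc i) vs) ℕ.≤ w i v ℕ.+ matched w (suc i) (i ∷ pre ++ post))
            (≡.sym split)
          (exchange-strict i i pre v post lt-v v<d (≡.subst (λ m → i ℕ.+ m ℕ.≤ d) (≡.sym len) le)))
        (Ord-⊛ (w i v) (≡.subst (λ m → Ord (w i v) (col v m)) (row₀ {ρ} eq) (ordE (bound le) v<d))
          (Ord-D N (suc i) (i ∷ pre ++ post) (rows {ρ} eq) asc′ lt′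
            (≡.trans (≡.sym (length-delete pre)) (ℕ.suc-injective len)) (next le)))
        where
        len : suc (length (pre ++ v ∷ post)) ≡ suc N
        len = ≡.cong suc (≡.trans (≡.cong length (≡.sym split)) (length-from (suc i) N))

  -- Reversing the columns makes the powers ascend and turns the antidiagonal of M_d into the
  -- diagonal.
  pows-↭ : ∀ d u → LK.pows d u ↭ map (λ v → LK.xpow v u) (from 0 d)
  pows-↭ zero    u = Perm.refl
  pows-↭ (suc d) u = ↭-trans (prep (LK.xpow d u) (pows-↭ d u)) (↭-trans (∷↭∷ʳ _ _)
    (↭-reflexive (≡.sym (≡.trans (≡.cong (map (λ v → LK.xpow v u)) (from-snoc 0 d))
      (List.map-++ (λ v → LK.xpow v u) (from 0 d) [ d ])))))

  module Degenerate (e d : ℕ) (e≤n : e ℕ.≤ n) (d≤p : d ℕ.≤ p) (as : List ℕ) (pos : All (1 ℕ.≤_) as)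
                    (dn≤re : d ℕ.* n ℕ.≤ length as ℕ.* e) where
    open Power e e≤n

    φ : ℕ → ℕ
    φ i = n ℕ.+ i ℕ.* p

    w : ℕ → ℕ → ℕ
    w i v = W e e as (φ i ∸ v)

    private
      v≤φ : ∀ {v} i → v ℕ.< d → v ℕ.≤ φ i
      v≤φ i v<d = ℕ.≤-trans (ℕ.≤-pred (ℕ.≤-trans v<d d≤p)) (ℕ.m≤m+n n _)

      entry : ∀ i {v} → v ℕ.< d → LK.xpow v (F as) (φ i) K.≈ F as (φ i ∸ v)
      entry i {v} v<d = K.trans
        (K.reflexive (≡.cong (LK.xpow v (F as)) (≡.sym (ℕ.m+[n∸m]≡n (v≤φ i v<d)))))
        (LK.xpow-+ v (F as) (φ i ∸ v))

    diagonal : ∀ i → φ i ∸ i ≡ suc i ℕ.* n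
    diagonal i = ≡.trans (≡.cong (_∸ i) (alg n i)) (ℕ.m+n∸m≡n i _)
      where
      alg : ∀ n i → n ℕ.+ i ℕ.* suc n ≡ i ℕ.+ suc i ℕ.* n
      alg = solve-∀

    private
      monge : ∀ {i u v} → suc i ℕ.< d → u ℕ.< v → v ℕ.< d → w i u ℕ.+ w (suc i) v ℕ.< w i v ℕ.+ w (suc i) u
      monge {i} {u} {v} si<d u<v v<d = ≡.subst₂ ℕ._<_
        (≡.cong₂ ℕ._+_ (≡.cong (W e e as) e₁) (≡.cong (W e e as) e₂))
        (≡.cong (λ m → w i v ℕ.+ W e e as m) e₃)
        (W-convex-strict e e as A x p (ℕ.m<n⇒0<n∸m u<v) (s≤s z≤n) (ℕ.≤-<-trans e≤n (ℕ.m≤n⇒m≤o+n x ℕ.≤-refl)) pos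
          (ℕ.m≤n+m e A) (≡.subst (ℕ._< e ℕ.+ length as ℕ.* e) (ℕ.+-comm e A) (ℕ.+-monoʳ-< e A<re)))
        where
        -- Convexity is used at A, A + x, A + p and A + x + p, which are φ i - v, φ i - u, φ (i + 1)
        -- - v and φ (i + 1) - u. It is strict because the width x + p exceeds the distance e
        -- between kinks.
        A = φ i ∸ v
        x = v ∸ u
        A+v : v ℕ.+ A ≡ φ i
        A+v = ℕ.m+[n∸m]≡n (v≤φ i v<d)
        vux : v ≡ u ℕ.+ x
        vux = ≡.sym (ℕ.m+[n∸m]≡n (ℕ.<⇒≤ u<v))
        φi : φ i ≡ u ℕ.+ (A ℕ.+ x)
        φi = ≡.trans (≡.sym A+v) (≡.trans (≡.cong (ℕ._+ A) vux) (alg u x A))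
          where
          alg : ∀ u x A → u ℕ.+ x ℕ.+ A ≡ u ℕ.+ (A ℕ.+ x)
          alg = solve-∀
        φsi : φ (suc i) ≡ φ i ℕ.+ p
        φsi = alg n i
          where
          alg : ∀ n i → n ℕ.+ suc i ℕ.* suc n ≡ n ℕ.+ i ℕ.* suc n ℕ.+ suc n
          alg = solve-∀
        e₁ : A ℕ.+ x ≡ φ i ∸ u
        e₁ = ≡.sym (≡.trans (≡.cong (_∸ u) φi) (ℕ.m+n∸m≡n u _))
        e₂ : A ℕ.+ p ≡ φ (suc i) ∸ v
        e₂ = ≡.sym (≡.trans (≡.cong (_∸ v) (≡.trans φsi (≡.trans (≡.cong (ℕ._+ p) (≡.sym A+v))
            (ℕ.+-assoc v A p)))) (ℕ.m+n∸m≡n v _))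
        e₃ : A ℕ.+ (x ℕ.+ p) ≡ φ (suc i) ∸ u
        e₃ = ≡.sym (≡.trans (≡.cong (_∸ u) (≡.trans φsi (≡.trans (≡.cong (ℕ._+ p) φi) (alg u A x p))))
            (ℕ.m+n∸m≡n u _))
          where
          alg : ∀ u A x p → u ℕ.+ (A ℕ.+ x) ℕ.+ p ≡ u ℕ.+ (A ℕ.+ (x ℕ.+ p))
          alg = solve-∀
        -- A is at most φ i = i + (i + 1)n, and i < n makes this less than (i + 2)n ≤ d n.
        A<re : A ℕ.< length as ℕ.* e
        A<re = ℕ.<-≤-trans (ℕ.≤-<-trans (ℕ.m∸n≤m (φ i) v) (begin-strict
          n ℕ.+ i ℕ.* suc n        ≡⟨ alg n i ⟩
          i ℕ.+ (suc i) ℕ.* n      <⟨ ℕ.+-monoˡ-< _ (ℕ.≤-pred (ℕ.≤-trans si<d d≤p)) ⟩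
          n ℕ.+ suc i ℕ.* n        ≤⟨ ℕ.*-monoˡ-≤ n si<d ⟩
          d ℕ.* n ∎)) dn≤re
          where
          open ℕ.≤-Reasoning
          alg : ∀ n i → n ℕ.+ i ℕ.* suc n ≡ i ℕ.+ suc i ℕ.* n
          alg = solve-∀

      module M = Matching w (λ v → LK.xpow v (F as)) φ d monge
        (λ {i} {v} i<d v<d → Ord-cong (entry i v<d) (proj₁ (coefficient as pos (φ i ∸ v))))
        (λ {i} i<d → NZ-resp (entry i i<d (w i i)) (proj₂ (coefficient as pos (φ i ∸ i))
          (ℕ.≤-trans (ℕ.≤-reflexive (diagonal i)) (ℕ.≤-trans (ℕ.*-monoˡ-≤ n i<d) dn≤re))))

    Lead-Mdet : Lead (matched w 0 (from 0 d)) (D d φ (LK.pows d (F as)))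
    Lead-Mdet with DK.D-↭ d {φ} (pows-↭ d (F as)) | M.Lead-D d 0 {φ} (λ _ → ≡.refl) ℕ.≤-refl
    ... | inj₁ e | l = Lead-cong e l
    ... | inj₂ e | l = Lead-cong e (Lead-neg l)

    matched-weighted : ∀ i N → matched w i (from i N) ≡ weighted (orders n e i N) as
    matched-weighted i zero    = zeros as
      where
      zeros : ∀ as → 0 ≡ weighted (λ _ → 0) as
      zeros []       = ≡.refl
      zeros (a ∷ as) = ≡.trans (zeros as) (≡.cong (ℕ._+ weighted (λ _ → 0) as) (≡.sym (ℕ.*-zeroʳ a)))
    matched-weighted i (suc N) = ≡.trans (≡.cong₂ ℕ._+_ (≡.cong (W e e as) (diagonal i)) (matched-weighted (suc i) N))
      (≡.sym (weighted-+ (λ m → (suc m ℕ.* e) ∸ (suc i ℕ.* n)) (orders n e (suc i) N) as))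

-- Constants, substitutions and the inclusion of 𝒜 in ℬ

module Constants (p m : ℕ) where
  open PolynomialsMod p
  open CommutativeRing (polyRing m) hiding (zero)
  open Integers (polyRing m) using (ι)

  constP-⊕ : ∀ m a b → _⊕_ {m} (constP {m} a) (constP {m} b) ≡ constP {m} (a ℤ.+ b)
  constP-⊕ zero    a b = ≡.refl
  constP-⊕ (suc m) a b = ≡.cong (_∷ []) (constP-⊕ m a b)

  constP-0 : ∀ m c → EqMod p {0} c 0ℤ → EqMod p {m} (constP {m} c) (zeroP {m})
  constP-0 zero    c e = e
  constP-0 (suc m) c e = constP-0 m c e , tt

  ι-constP : ∀ s → ι s ≈ constP {m} (+ s)
  ι-constP zero    = sym (constP-0 m 0ℤ (CommutativeRing.refl (polyRing 0) {0ℤ}))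
  ι-constP (suc s) = trans (+-congˡ (ι-constP s)) (reflexive (constP-⊕ m 1ℤ (+ s)))

  divisible : ∀ {a} → p ∣ ℤ.∣ a ∣ → EqMod p {0} a 0ℤ
  divisible {a} = ≡.subst (λ z → p ∣ ℤ.∣ z ∣) (≡.sym (ℤ.+-identityʳ a))

  divides′ : ∀ {a} → EqMod p {0} a 0ℤ → p ∣ ℤ.∣ a ∣
  divides′ {a} = ≡.subst (λ z → p ∣ ℤ.∣ z ∣) (ℤ.+-identityʳ a)

  char : ι p ≈ 0#
  char = trans (ι-constP p) (constP-0 m (+ p) (divisible {+ p} (ℕDiv.∣-refl)))
    where import Data.Nat.Divisibility as ℕDiv

-- Substitutions of series in t for the variables. The last component keeps nonzero constants at
-- order 0, so ε does not affect the comparison of orders.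
Specializations : (k : CommutativeRing 0ℓ 0ℓ) (n : ℕ) (prime : Prime (suc n)) →
                  NoZeroDivisors k → PrimeToNonzero k (suc n) → Set
Specializations k n pr no-zero-divisors ι-nonzero = ∀ r (x : Fin r → Carrier) → Σ (Poly r → Carrier) λ θ →
  IsRingHomomorphism (PolynomialsMod.rawPoly (suc n) r) rawRing θ × (∀ i → θ (var i) ≈ x i) ×
  (∀ ε → 1 ℕ.≤ ε → ε ℕ.< suc n → Lead 0 (θ (constP {r} (+ ε))))
  where
  open CommutativeRing (powerSeries k)
  open Leading k n pr no-zero-divisors ι-nonzero using (Lead)

module NecessityOver (k : CommutativeRing 0ℓ 0ℓ) (n : ℕ) (prime : Prime (suc n))
    (no-zero-divisors : NoZeroDivisors k) (ι-nonzero : PrimeToNonzero k (suc n))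
    (ev : Specializations k n prime no-zero-divisors ι-nonzero) where
  private p = suc n
  open PrimeNat n prime using (1≤n)
  open DetLeading k n prime no-zero-divisors ι-nonzero
  open Leading k n prime no-zero-divisors ι-nonzero
  open DK using (D)

  module _ (r e d ε g : ℕ) (d≤p : d ℕ.≤ p) (1≤ε : 1 ℕ.≤ ε) (ε<p : ε ℕ.< p)
    (eq : EqMod p {r} (det {r} (Mat p r e d)) (_⊗_ {r} (constP {r} (+ ε)) (_^P_ {r} (δ r) g))) where

    module At (x : Fin r → K.Carrier) where
      private
        θ = proj₁ (ev r x)
        θ-hom = proj₁ (proj₂ (ev r x))
      open Specialization K n r θ θ-hom x (proj₁ (proj₂ (proj₂ (ev r x)))) hiding (module θ)
      module H = IsRingHomomorphism θ-hom

      specialized : ∀ {M} → Lead M (LK.Δ (tabulate x)) → Lead (g ℕ.* M) (D d (λ i → n ℕ.+ i ℕ.* p) (LK.pows d (F e)))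
      specialized l = Lead-cong
        (K.trans (K.sym (θ-detMat e d d≤p)) (K.trans (H.⟦⟧-cong eq) (K.trans (H.*-homo (constP {r} (+ ε))
            (_^P_ {r} (δ r) g))
          (K.*-congˡ {θ (constP {r} (+ ε))} (K.trans (θ-^P (δ r) g) (^ᴷ-congˡ g θ-δ))))))
        (Lead-⊛ {0} (proj₂ (proj₂ (proj₂ (ev r x))) ε 1≤ε ε<p) (Lead-^ g l))
        where
        open import Algebra.Properties.Semiring.Exp K.semiring using () renaming (^-congˡ to ^ᴷ-congˡ)

    specialized-list : ∀ xs → length xs ≡ r → ∀ {M} → Lead M (LK.Δ xs) →
      Lead (g ℕ.* M) (D d (λ i → n ℕ.+ i ℕ.* p) (LK.pows d (LK.P (map (_, e) xs))))
    specialized-list xs ≡.refl {M} l = ≡.subst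
      (λ ys → Lead (g ℕ.* M) (D d (λ i → n ℕ.+ i ℕ.* p) (LK.pows d (LK.P (map (_, e) ys)))))
      (List.tabulate-lookup xs) (At.specialized (List.lookup xs) (≡.subst (λ ys → Lead M (LK.Δ ys)) (≡.sym
          (List.tabulate-lookup xs)) l))

  length-points : ∀ as → length (map t (weights as)) ≡ length as
  length-points as = ≡.trans (List.length-map t (weights as)) (length-weights as)
    where
    length-weights : ∀ as → length (weights as) ≡ length as
    length-weights []       = ≡.refl
    length-weights (a ∷ as) = ≡.cong suc (length-weights as)

  Lead-nonzero : ∀ {m u} → Lead m u → u K.≈ K.0# → ⊥
  Lead-nonzero {m} (_ , nz) z = nz (z m)

  pw-0-low : ∀ e H i → i ℕ.< e → (LK.pw K.0# e LK.S.* H) i K.≈ K.0#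
  pw-0-low (suc e) H i lt = K.trans (LK.S.*-assoc (LK.lin K.0#) (LK.pw K.0# e) H i) (go i lt)
    where
    -0* : ∀ u → (K.- K.0#) K.* u K.≈ K.0#
    -0* u = K.trans (K.*-congʳ {u} (-0#≈0#)) (K.zeroˡ u)
      where open import Algebra.Properties.Ring K.ring using (-0#≈0#)
    go : ∀ i → i ℕ.< suc e → (LK.lin K.0# LK.S.* (LK.pw K.0# e LK.S.* H)) i K.≈ K.0#
    go zero    _        = K.trans (LK.lin-⊛-zero K.0# (LK.pw K.0# e LK.S.* H)) (-0* _)
    go (suc i) (s≤s lt) = K.trans (LK.lin-⊛-suc K.0# (LK.pw K.0# e LK.S.* H) i)
      (K.trans (K.+-cong (pw-0-low e H i lt) (-0* _)) (K.+-identityˡ K.0#))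

  xpow-low : ∀ {e} u → (∀ i → i ℕ.< e → u i K.≈ K.0#) → ∀ j i → i ℕ.< e → LK.xpow j u i K.≈ K.0#
  xpow-low u z zero    i       lt = z i lt
  xpow-low u z (suc j) zero    lt = K.zeroˡ _
  xpow-low u z (suc j) (suc i) lt = K.trans (LK.X-⊛-suc (LK.xpow j u) i) (xpow-low u z j i (ℕ.<⇒≤ lt))

  degP-points : ∀ e (xs : List K.Carrier) → LK.degP (map (_, e) xs) ≡ length xs ℕ.* e
  degP-points e []       = ≡.refl
  degP-points e (x ∷ xs) = ≡.cong (e ℕ.+_) (degP-points e xs)

  necessity : ∀ r e d → 𝒜 p r e d → ℬ p r e d
  necessity (suc r′) e (suc d′) (2≤r , 1≤e , 1≤d , d≤p , ε , 1≤ε , ε<p , g , 1≤g , eq) =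
    ℬ-from-orders n r e d g 2≤r 1≤d d≤p 1≤g 1≤n e≤n dn≤re
      (weighted-injective r compare)
    where
    r = suc r′
    d = suc d′
    φ : ℕ → ℕ
    φ i = n ℕ.+ i ℕ.* p

    at : ∀ xs → length xs ≡ r → ∀ {M} → Lead M (LK.Δ xs) → Lead (g ℕ.* M) (D d φ (LK.pows d (LK.P (map (_, e) xs))))
    at = specialized-list r e d ε g d≤p 1≤ε ε<p eq

    -- If e ≥ p, set the first variable to 0 and the others to distinct powers of t. Then x^e
    -- divides f^e, and the first row, which involves only indices up to p - 1 < e, vanishes
    -- although δ does not.
    e≤n : e ℕ.≤ n
    e≤n with e ℕ.≤? n
    ... | yes le = le
    ... | no ¬le = ⊥-elim (Lead-nonzero
      (at (K.0# ∷ ys) (≡.cong suc (≡.trans (length-points (ones r′)) (length-ones r′)))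
        (Lead-⊛ (Lead-diffs (weights (ones r′)) (All.universal (λ _ → Ord-0 _) _)) (Lead-Δ (ones r′)
            (ones-positive r′))))
      (DK.D-zero-first-row d′ {φ} (LK.All-pows {λ v → v (φ 0) K.≈ K.0#} {d} (λ j _ → xpow-low _ (pw-0-low e
          (LK.P (map (_, e) ys))) j (φ 0)
        (≡.subst (ℕ._< e) (≡.sym (ℕ.+-identityʳ n)) (ℕ.≰⇒> ¬le))))))
      where
      ys = map t (weights (ones r′))

    -- If d n > r e, the last row has index d′ + d n, beyond the degree of every column, and
    -- vanishes.
    dn≤re : d ℕ.* n ℕ.≤ r ℕ.* e
    dn≤re with d ℕ.* n ℕ.≤? r ℕ.* e
    ... | yes le = le
    ... | no ¬le = ⊥-elim (Lead-nonzero (at ys len (Lead-Δ (ones r) (ones-positive r)))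
      (DK.D-zero-last-row d′ {φ} (LK.All-pows {λ v → v (φ d′) K.≈ K.0#} {d} (λ j j<d → LK.xpow-Deg< j
          (LK.Monic⇒Deg< (LK.Monic-P (map (_, e) ys))) (φ d′)
        (begin
          j ℕ.+ suc (LK.degP (map (_, e) ys)) ≡⟨ ≡.cong (λ m → j ℕ.+ suc m) (≡.trans (degP-points e ys) (≡.cong
              (ℕ._* e) len)) ⟩
          j ℕ.+ suc (r ℕ.* e)     ≤⟨ ℕ.+-mono-≤ (ℕ.≤-pred j<d) (ℕ.≰⇒> ¬le) ⟩
          d′ ℕ.+ d ℕ.* n          ≡⟨ alg d′ n ⟩
          φ d′ ∎)))))
      where
      open ℕ.≤-Reasoning
      ys = map t (weights (ones r))
      len : length ys ≡ r
      len = ≡.trans (length-points (ones r)) (length-ones r)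
      alg : ∀ d n → d ℕ.+ suc d ℕ.* n ≡ n ℕ.+ d ℕ.* suc n
      alg = solve-∀

    compare : ∀ as → length as ≡ r → All (1 ℕ.≤_) as →
              weighted (orders n e 0 d) as ≡ weighted (λ m → g ℕ.* triangle m) as
    compare as len pos = ≡.trans (≡.sym (matched-weighted 0 d)) (≡.trans
      (Lead-unique Lead-Mdet (at (map t (weights as)) (≡.trans (length-points as) len) (Lead-Δ as pos)))
      (≡.trans (≡.cong (g ℕ.*_) (orderΔ-weighted as)) (≡.sym (weighted-* g triangle as))))
      where open Degenerate e d e≤n d≤p as pos (≡.subst (λ m → d ℕ.* n ℕ.≤ m ℕ.* e) (≡.sym len) dn≤re)


module Necessity (n : ℕ) (prime : Prime (suc n)) where
  private p = suc n
  open PrimeNat n prime using (small∤)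
  open PolynomialsMod p
  open Constants p 0 using (divisible; divides′; ι-constP)

  -- The integers with congruence modulo p as equality, that is, F_p.
  k = polyRing 0
  module k = CommutativeRing k

  no-zero-divisors : ∀ {a b} → ¬ a k.≈ 0ℤ → ¬ b k.≈ 0ℤ → ¬ (a ℤ.* b) k.≈ 0ℤ
  no-zero-divisors {a} {b} ¬a ¬b z =
    [ ¬a ∘ divisible {a} , ¬b ∘ divisible {b} ]′
      (euclidsLemma ℤ.∣ a ∣ ℤ.∣ b ∣ prime (≡.subst (p ∣_) (ℤ.abs-* a b) (divides′ {a ℤ.* b} z)))

  nonzero : ∀ {s} → ¬ p ∣ s → ¬ (+ s) k.≈ 0ℤ
  nonzero {s} ¬s z = ¬s (divides′ {+ s} z)

  ι-nonzero : ∀ {s} → ¬ p ∣ s → ¬ Integers.ι k s k.≈ 0ℤ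
  ι-nonzero {s} ¬s z = nonzero ¬s (k.trans {+ s} {Integers.ι k s} {0ℤ} (k.sym {Integers.ι k s} {+ s} (ι-constP s)) z)

  open Leading k n prime (λ {a} {b} → no-zero-divisors {a} {b}) (λ {s} → ι-nonzero {s}) using (K)
  open Convolution k using (const)

  const-hom : IsRingHomomorphism (rawPoly 0) K.rawRing const
  const-hom = mkHomomorphism (rawPoly 0) K
    (λ { e zero → e ; _ (suc i) → k.refl {0ℤ} })
    (λ { a b zero → k.refl {a ℤ.+ b} ; _ _ (suc i) → k.refl {0ℤ} })
    (λ a b → LinearFactors.const-* k a b)
    (λ { a zero → k.refl {ℤ.- a} ; _ (suc i) → k.refl {0ℤ} })
    (λ { zero → k.refl {0ℤ} ; (suc i) → k.refl {0ℤ} })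
    (λ i → k.refl {const 1ℤ i})

  open Evaluation K const const-hom

  necessity : ∀ r e d → 𝒜 p r e d → ℬ p r e d
  necessity = NecessityOver.necessity k n prime (λ {a} {b} → no-zero-divisors {a} {b}) (λ {s} → ι-nonzero {s})
    λ r x → ev r x , ev-hom r x , ev-var r x , λ ε 1≤ε ε<p →
      (λ _ ()) , λ z → nonzero {ε} (small∤ 1≤ε (ℕ.≤-pred ε<p)) (k.trans {+ ε} {ev r x (constP {r} (+ ε)) 0} {0ℤ}
        (k.sym {ev r x (constP {r} (+ ε)) 0} {+ ε} (ev-constP r x (+ ε) 0)) z)

-- The inclusion of ℬ in 𝒜

double-complement : ∀ {n k e} → k ℕ.+ e ≡ n → n ℕ.< 2 ℕ.* e → 2 ℕ.* k ℕ.< n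
double-complement {n} {k} {e} eq lt = ℕ.+-cancelʳ-< (2 ℕ.* e) _ _ (ℕ.≤-<-trans (ℕ.≤-reflexive (≡.trans
  (≡.sym (ℕ.*-distribˡ-+ 2 k e)) (≡.trans (≡.cong (2 ℕ.*_) eq) (≡.cong (n ℕ.+_) (ℕ.+-identityʳ n)))))
      (ℕ.+-monoʳ-< n lt))

positive : ∀ {m e} → m ℕ.< 2 ℕ.* e → 1 ℕ.≤ e
positive {e = suc e} _ = s≤s z≤n

Cancellable : (R : CommutativeRing 0ℓ 0ℓ) → CommutativeRing.Carrier R → Set
Cancellable R a = ∀ u → a * u ≈ 0# → u ≈ 0#
  where open CommutativeRing R

module SufficiencyOver (n : ℕ) (prime : Prime (suc n)) (r′ : ℕ) (R : CommutativeRing 0ℓ 0ℓ)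
    (char : CommutativeRing._≈_ R (Integers.ι R (suc n)) (CommutativeRing.0# R))
    (θ : Poly (suc r′) → CommutativeRing.Carrier R)
    (θ-hom : IsRingHomomorphism (PolynomialsMod.rawPoly (suc n) (suc r′)) (CommutativeRing.rawRing R) θ)
    (x : Fin (suc r′) → CommutativeRing.Carrier R)
    (θ-var : ∀ i → CommutativeRing._≈_ R (θ (var i)) (x i))
    (ι-θ : ∀ s → CommutativeRing._≈_ R (Integers.ι R s) (θ (constP {suc r′} (+ s))))
    (cancel : ∀ i j → toℕ i ℕ.< toℕ j → Cancellable R (CommutativeRing._-_ R (x i) (x j))) where
  private
    p = suc n
    r = suc r′
  open CommutativeRing R hiding (zero)
  open Integers R using (ι; solve; _:=_; _:+_; _:*_; :-_; ι-+; ι-*)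
  open import Data.Fin using (zero; suc)
  open PrimeNat n prime using (1≤n; n∤; 1∤; p∤*)
  open Associates R n prime char
  open Recursion R n prime char
  open Step R n char
  open LinearFactors R
  open import Algebra.Properties.Semiring.Exp semiring using (_^_; ^-congˡ; ^-homo-*)
  open import Algebra.Properties.CommutativeSemiring.Exp commutativeSemiring using (^-distrib-*)
  open import Algebra.Properties.Ring ring using (x≈z//y; -‿involutive)
  open import Relation.Binary.Reasoning.Setoid setoid

  open Specialization R n r θ θ-hom x θ-var hiding (module θ)
  module H = IsRingHomomorphism θ-hom

  cancel-* : ∀ {a b} → Cancellable R a → Cancellable R b → Cancellable R (a * b)
  cancel-* {a} {b} ca cb u e = cb u (ca (b * u) (trans (sym (*-assoc a b u)) e))

  cancel-1 : Cancellable R 1#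
  cancel-1 u e = trans (sym (*-identityˡ u)) e

  cancel-^ : ∀ k {a} → Cancellable R a → Cancellable R (a ^ k)
  cancel-^ zero    ca = cancel-1
  cancel-^ (suc k) {a} ca = cancel-* {a} {a ^ k} ca (cancel-^ k ca)

  cancel-Δ : ∀ {k} (x : Fin k → Carrier) → (∀ i j → toℕ i ℕ.< toℕ j → Cancellable R (x i - x j)) →
             Cancellable R (Δ (tabulate x))
  cancel-Δ {zero}  x c = cancel-1
  cancel-Δ {suc k} x c = cancel-* {diffs (x zero) (tabulate (x ∘ suc))} {Δ (tabulate (x ∘ suc))}
    (cancel-diffs (x ∘ suc) (λ j → c zero (suc j) (s≤s z≤n)))
    (cancel-Δ (x ∘ suc) (λ i j lt → c (suc i) (suc j) (s≤s lt)))
    where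
    cancel-diffs : ∀ {k a} (y : Fin k → Carrier) → (∀ j → Cancellable R (a - y j)) → Cancellable R (diffs a
        (tabulate y))
    cancel-diffs {zero}      y c = cancel-1
    cancel-diffs {suc k} {a} y c = cancel-* {a - y zero} {diffs a (tabulate (y ∘ suc))} (c zero) (cancel-diffs
        (y ∘ suc) (c ∘ suc))

  x-y≈0⇒x≈y : ∀ {x y} → x - y ≈ 0# → x ≈ y
  x-y≈0⇒x≈y e = trans (x≈z//y _ _ _ e) (trans (+-identityˡ _) (-‿involutive _))

  Δx : Carrier
  Δx = Δ (tabulate x)

  -- From n = g + 2k one has Δ^n = (Δ²)^k Δ^g, and the first factor can be cancelled as a product of
  -- cancellable differences.
  cancelled : ∀ e k g → k ℕ.+ e ≡ n → r ℕ.* k ℕ.≤ n → g ℕ.+ 2 ℕ.* k ≡ n → Mdet (F e) r′ ∼ Δx ^ g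
  cancelled e k g k+e≡n rk≤n g+2k≡n = cancel-∼ evaluated
    where
    A = (Δx * Δx) ^ k
    Δ^n : Δx ^ n ≈ A * Δx ^ g
    Δ^n = begin
      Δx ^ n                        ≡⟨ ≡.cong (Δx ^_) (≡.trans (≡.sym g+2k≡n) (alg g k)) ⟩
      Δx ^ ((k ℕ.+ k) ℕ.+ g)        ≈⟨ ^-homo-* Δx (k ℕ.+ k) g ⟩
      Δx ^ (k ℕ.+ k) * Δx ^ g       ≈⟨ *-congʳ (trans (^-homo-* Δx k k) (sym (^-distrib-* Δx Δx k))) ⟩
      A * Δx ^ g ∎
      where
      alg : ∀ g k → g ℕ.+ 2 ℕ.* k ≡ (k ℕ.+ k) ℕ.+ g
      alg = solve-∀
    len : length (tabulate {n = r′} (λ i → x (suc i))) ≡ r′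
    len = List.length-tabulate _
    evaluated : A * Mdet (F e) r′ ∼ A * Δx ^ g
    evaluated = ∼-trans (≡.subst (λ m → A * Mdet (F e) m ∼ Δx ^ n) len
      (Down.evaluation e k k+e≡n (x zero) (tabulate (λ i → x (suc i)))
        (≡.subst (λ m → suc m ℕ.* k ℕ.≤ n) (≡.sym len) rk≤n))) (≈⇒∼ Δ^n)
    cancelA : Cancellable R A
    cancelA = cancel-^ k {Δx * Δx} (cancel-* {Δx} {Δx} cΔ cΔ)
      where
      cΔ : Cancellable R Δx
      cΔ = cancel-Δ x cancel
    cancel-∼ : ∀ {a b} → A * a ∼ A * b → a ∼ b
    cancel-∼ {a} {b} (s , t , ¬s , ¬t , eq) = scaled-∼ ¬s ¬t (x-y≈0⇒x≈y (cancelA (ι s * a - ι t * b) (begin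
      A * (ι s * a - ι t * b)
        ≈⟨ solve 5 (λ A s a t b → (A :* (s :* a :+ (:- (t :* b)))) := (s :* (A :* a) :+ (:- (t :*
            (A :* b))))) refl A (ι s) a (ι t) b ⟩
      ι s * (A * a) - ι t * (A * b) ≈⟨ +-congʳ eq ⟩
      ι t * (A * b) - ι t * (A * b) ≈⟨ -‿inverseʳ _ ⟩
      0# ∎)))

  ι-multiple : ∀ x → ι (x ℕ.* p) ≈ 0#
  ι-multiple x = trans (ι-* x p) (trans (*-congˡ char) (zeroʳ _))

  -- Here s is finally inverted: Bézout gives u with u s = 1 modulo p, and ε is the remainder of u
  -- t, nonzero because p divides neither factor.
  ∼⇒constant : ∀ {a b} → a ∼ b → ∃ λ ε → 1 ℕ.≤ ε × ε ℕ.< p × a ≈ ι ε * b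
  ∼⇒constant {a} {b} (s , t , ¬s , ¬t , eq) = ε
    , ℕ.n≢0⇒n>0 (λ z → p∤* ¬u ¬t (m%n≡0⇒n∣m (u ℕ.* t) p z)) , m%n<n (u ℕ.* t) p , (begin
      a                            ≈⟨ trans (*-congʳ us≈1) (*-identityˡ a) ⟨
      ι u * ι s * a                ≈⟨ *-assoc _ _ _ ⟩
      ι u * (ι s * a)              ≈⟨ *-congˡ eq ⟩
      ι u * (ι t * b)              ≈⟨ *-assoc _ _ _ ⟨
      ι u * ι t * b                ≈⟨ *-congʳ (ι-* u t) ⟨
      ι (u ℕ.* t) * b              ≈⟨ *-congʳ ι-mod ⟩
      ι ε * b ∎)
    where
    inverse : ∃ λ u → ¬ p ∣ u × ι u * ι s ≈ 1#
    inverse with coprime-Bézout {p} {s} coprime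
      where
      coprime : Coprime p s
      coprime (d∣p , d∣s) with prime⇒irreducible prime d∣p
      ... | inj₁ d≡1    = d≡1
      ... | inj₂ ≡.refl = ⊥-elim (¬s d∣s)
    ... | Bézout.-+ x y e = y
      , (λ p∣y → 1∤ (∣m+n∣m⇒∣n (≡.subst (p ∣_) (≡.trans (≡.sym e) (ℕ.+-comm 1 (x ℕ.* p))) (∣m⇒∣m*n s p∣y)) (n∣m*n x)))
      , (begin
        ι y * ι s             ≈⟨ ι-* y s ⟨
        ι (y ℕ.* s)           ≡⟨ ≡.cong ι e ⟨
        1# + ι (x ℕ.* p)      ≈⟨ +-congˡ (ι-multiple x) ⟩
        1# + 0#               ≈⟨ +-identityʳ 1# ⟩
        1# ∎)
    -- Here 1 + y s = x p, so the inverse of s is - y, represented by n y.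
    ... | Bézout.+- x y e = n ℕ.* y
      , p∤* n∤ (λ p∣y → 1∤ (∣m+n∣m⇒∣n (≡.subst (p ∣_) (≡.trans (≡.sym e) (ℕ.+-comm 1 (y ℕ.* s))) (n∣m*n x))
          (∣m⇒∣m*n s p∣y)))
      , (begin
        ι (n ℕ.* y) * ι s     ≈⟨ *-congʳ (ι-* n y) ⟩
        ι n * ι y * ι s       ≈⟨ *-assoc _ _ _ ⟩
        ι n * (ι y * ι s)     ≈⟨ -1≈ιn (ι y * ι s) ⟨
        - (ι y * ι s)         ≈⟨ x-y≈0⇒x≈y (begin
          1# - - (ι y * ι s)    ≈⟨ +-congˡ (trans (-‿involutive _) (sym (ι-* y s))) ⟩
          1# + ι (y ℕ.* s)      ≡⟨ ≡.cong ι e ⟩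
          ι (x ℕ.* p)           ≈⟨ ι-multiple x ⟩
          0# ∎) ⟨
        1# ∎)
    u = proj₁ inverse
    ¬u = proj₁ (proj₂ inverse)
    us≈1 = proj₂ (proj₂ inverse)
    ε = (u ℕ.* t) % p
    ι-mod : ι (u ℕ.* t) ≈ ι ε
    ι-mod = begin
      ι (u ℕ.* t)                          ≡⟨ ≡.cong ι (m≡m%n+[m/n]*n (u ℕ.* t) p) ⟩
      ι (ε ℕ.+ (u ℕ.* t) / p ℕ.* p)        ≈⟨ ι-+ ε _ ⟩
      ι ε + ι ((u ℕ.* t) / p ℕ.* p)        ≈⟨ +-congˡ (ι-multiple ((u ℕ.* t) / p)) ⟩
      ι ε + 0#                             ≈⟨ +-identityʳ _ ⟩
      ι ε ∎

  proportional : ∀ e d g → d ℕ.≤ p → Mdet (F e) d ∼ Δx ^ g → ∃ λ ε → 1 ℕ.≤ ε × ε ℕ.< p ×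
                 θ (det {r} (Mat p r e d)) ≈ θ (_⊗_ {r} (constP {r} (+ ε)) (_^P_ {r} (δ r) g))
  proportional e d g d≤p rel with ∼⇒constant rel
  ... | ε , 1≤ε , ε<p , eq = ε , 1≤ε , ε<p , (begin
    θ (det {r} (Mat p r e d))                   ≈⟨ θ-detMat e d d≤p ⟩
    Mdet (F e) d                                ≈⟨ eq ⟩
    ι ε * Δx ^ g                                ≈⟨ *-cong (ι-θ ε) (sym (trans (θ-^P (δ r) g) (^-congˡ g θ-δ))) ⟩
    θ (constP {r} (+ ε)) * θ (_^P_ {r} (δ r) g) ≈⟨ H.*-homo (constP {r} (+ ε)) (_^P_ {r} (δ r) g) ⟨
    θ (_⊗_ {r} (constP {r} (+ ε)) (_^P_ {r} (δ r) g)) ∎)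

  lower : ∀ e d → φ d ≡ d ℕ.+ r ℕ.* e → Mdet (F e) (suc d) ∼ Mdet (F e) d
  lower e d eq = ≈±⇒∼ (top-row d (Monic-P (map (_, e) (tabulate x))) (≡.trans eq (≡.cong (d ℕ.+_)
    (≡.sym (≡.trans (degP-withExp e (tabulate x)) (≡.cong (ℕ._* e) (List.length-tabulate {n = r} x)))))))

  sufficiency : ∀ e d → ℬ p r e d → 2 ℕ.≤ r × 1 ℕ.≤ e × 1 ℕ.≤ d × d ℕ.≤ p × ∃ λ ε → 1 ℕ.≤ ε × ε ℕ.< p ×
    ∃ λ g → 1 ℕ.≤ g × θ (det {r} (Mat p r e d)) ≈ θ (_⊗_ {r} (constP {r} (+ ε)) (_^P_ {r} (δ r) g))
  sufficiency e d mem with conditions e d mem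
    where
    conditions : ∀ e d → ℬ p r e d → 2 ℕ.≤ r × 1 ℕ.≤ e × 1 ℕ.≤ d × d ℕ.≤ p × ∃ λ g → 1 ℕ.≤ g × Mdet (F e) d ∼ Δx ^ g
    conditions e d (inj₁ (2≤r , r≤p , ≡.refl , ≡.refl)) = 2≤r , 1≤n , s≤s z≤n , r≤p , n , 1≤n
      -- For e = n nothing is lowered: k = 0 and g = n. The last row reduces size r to r - 1.
      , ∼-trans (lower n r′ (alg n r′))
          (cancelled n 0 n ≡.refl (≡.subst (ℕ._≤ n) (≡.sym (ℕ.*-zeroʳ r)) z≤n) (ℕ.+-identityʳ n))
      where
      alg : ∀ n d → n ℕ.+ d ℕ.* suc n ≡ d ℕ.+ suc d ℕ.* n
      alg = solve-∀
    conditions e d (inj₂ (inj₁ (2≤r , r≤1+p , n<2e , e≤n , rk≤n , ≡.refl))) =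
      2≤r , positive n<2e , ℕ.≤-pred 2≤r , ℕ.≤-pred r≤1+p , n ∸ 2 ℕ.* k , ℕ.m<n⇒0<n∸m 2k<n
      , cancelled e k (n ∸ 2 ℕ.* k) k+e≡n rk≤n (ℕ.m∸n+n≡m (ℕ.<⇒≤ 2k<n))
      where
      k = n ∸ e
      k+e≡n : k ℕ.+ e ≡ n
      k+e≡n = ℕ.m∸n+n≡m e≤n
      2k<n : 2 ℕ.* k ℕ.< n
      2k<n = double-complement {n} {k} {e} k+e≡n n<2e
    conditions e d (inj₂ (inj₂ (2≤r , n<2e , e≤n , rk≡n , d≡))) with ℕ.m≤n⇒∃[o]m+o≡n 2≤r
    ... | q , 2+q≡r = 2≤r , positive n<2e , ≡.subst (1 ℕ.≤_) (≡.sym d≡q) 1≤q , ≡.subst (ℕ._≤ p) (≡.sym d≡q) q≤p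
      , n ∸ 2 ℕ.* k , ℕ.m<n⇒0<n∸m 2k<n , ≡.subst (λ m → Mdet (F e) m ∼ Δx ^ (n ∸ 2 ℕ.* k)) (≡.sym d≡q)
        (∼-trans (∼-sym (lower e q top)) (≡.subst (λ m → Mdet (F e) m ∼ Δx ^ (n ∸ 2 ℕ.* k)) (≡.sym 1+q≡r′)
          (cancelled e k (n ∸ 2 ℕ.* k) k+e≡n (ℕ.≤-reflexive rk≡n) (ℕ.m∸n+n≡m (ℕ.<⇒≤ 2k<n)))))
      where
      k = n ∸ e
      1+q≡r′ : suc q ≡ r′
      1+q≡r′ = ℕ.suc-injective 2+q≡r
      d≡q : d ≡ q
      d≡q = ≡.trans d≡ (≡.cong (_∸ 2) (≡.sym 2+q≡r))
      rk : (2 ℕ.+ q) ℕ.* k ≡ n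
      rk = ≡.trans (≡.cong (ℕ._* k) 2+q≡r) rk≡n
      k+e≡n : k ℕ.+ e ≡ n
      k+e≡n = ℕ.m∸n+n≡m e≤n
      2k<n : 2 ℕ.* k ℕ.< n
      2k<n = double-complement {n} {k} {e} k+e≡n n<2e
      -- For q = 0, that is r = 2, the equation r k = n would read 2 k = n, against 2 k < n.
      1≤q : 1 ℕ.≤ q
      1≤q = ℕ.n≢0⇒n>0 (λ q≡0 → ℕ.<-irrefl (≡.trans (≡.cong (λ m → (2 ℕ.+ m) ℕ.* k) (≡.sym q≡0)) rk) 2k<n)
      1≤k : 1 ℕ.≤ k
      1≤k = ℕ.n≢0⇒n>0 (λ k≡0 → ℕ.<-irrefl (≡.trans (≡.sym (ℕ.*-zeroʳ (2 ℕ.+ q)))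
        (≡.trans (≡.cong ((2 ℕ.+ q) ℕ.*_) (≡.sym k≡0)) rk)) 1≤n)
      q≤p : q ℕ.≤ p
      q≤p = ℕ.≤-trans (ℕ.≤-trans (ℕ.m≤n+m q 2) (ℕ.m≤m*n (2 ℕ.+ q) k ⦃ ℕ.>-nonZero 1≤k ⦄))
        (ℕ.≤-trans (ℕ.≤-reflexive rk) (ℕ.n≤1+n n))
      -- With r k = n the degree r e equals (q + 1)n, which is the case in which M_(q+1) and M_q
      -- have the same determinant up to sign.
      top : n ℕ.+ q ℕ.* p ≡ q ℕ.+ r ℕ.* e
      top = ℕ.+-cancelʳ-≡ n _ _ (≡.trans (alg₁ n q) (≡.trans (≡.cong (λ m → q ℕ.+ (2 ℕ.+ q) ℕ.* m) (≡.sym k+e≡n))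
        (≡.trans (alg₂ q (2 ℕ.+ q) k e) (≡.cong₂ (λ a b → q ℕ.+ a ℕ.* e ℕ.+ b) 2+q≡r rk))))
        where
        alg₁ : ∀ n q → n ℕ.+ q ℕ.* suc n ℕ.+ n ≡ q ℕ.+ (2 ℕ.+ q) ℕ.* n
        alg₁ = solve-∀
        alg₂ : ∀ q r k e → q ℕ.+ r ℕ.* (k ℕ.+ e) ≡ q ℕ.+ r ℕ.* e ℕ.+ r ℕ.* k
        alg₂ = solve-∀
  ... | 2≤r , 1≤e , 1≤d , d≤p , g , 1≤g , rel with proportional e d g d≤p rel
  ...   | ε , 1≤ε , ε<p , eq = 2≤r , 1≤e , 1≤d , d≤p , ε , 1≤ε , ε<p , g , 1≤g , eq

module Sufficiency (n : ℕ) (prime : Prime (suc n)) where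
  open import Data.Fin using (zero; suc)
  private p = suc n
  open PolynomialsMod p

  -- If the first variable is the outermost one, the product vanishes only if uᵢ = c uᵢ₊₁ for all i;
  -- a finite list ends in zeros, so the coefficients vanish from the top down. Otherwise the
  -- difference is constant in the outermost variable and acts on each coefficient.
  var-⊖-cancellable : ∀ m (i j : Fin m) → toℕ i ℕ.< toℕ j → Cancellable (polyRing m) (_⊖_ {m} (var i) (var j))
  var-⊖-cancellable (suc m) zero (suc j) _ u e = C.EqMod-coeff u [] (vanish u recurrence)
    where
    module C = Coefficients m (isPolyRing m)
    open CommutativeRing C.R hiding (zero)
    open Convolution C.R
    open Integers C.R using (solve; _:=_; _:+_; _:*_; :-_)
    open import Algebra.Properties.Ring ring using (x≈z//y; -‿involutive)
    c = var j
    recurrence : ∀ i → coeff {m} u i ≈ c * coeff {m} u (suc i)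
    recurrence i = trans (x≈z//y (coeff {m} u i) (- (c * coeff {m} u (suc i))) 0# (begin
      coeff {m} u i - c * coeff {m} u (suc i)
        ≈⟨ solve 3 (λ a c b → (a :+ (:- (c :* b))) := ((:- c) :* b :+ a)) refl _ c _ ⟩
      - c * coeff {m} u (suc i) + coeff {m} u i
        ≈⟨ +-cong (*-congʳ (sym (+-identityˡ (- c)))) (sym (trans (⊛-cong {v = coeff {m} u} C.coeff-one
            (λ _ → refl) i) (⊛-identityˡ (coeff {m} u) i))) ⟩
      (0# - c) * coeff {m} u (suc i) + (coeff {m} (oneP {suc m}) ⊛ coeff {m} u) i
        ≈⟨ C.coeff-⊗ (_⊖_ {suc m} (var zero) (var (suc j))) u (suc i) ⟨
      coeff {m} (_⊗_ {suc m} (_⊖_ {suc m} (var zero) (var (suc j))) u) (suc i)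
        ≈⟨ C.coeff-EqMod (_⊗_ {suc m} (_⊖_ {suc m} (var zero) (var (suc j))) u) [] e (suc i) ⟩
      0# ∎)) (trans (+-identityˡ _) (-‿involutive _))
      where open import Relation.Binary.Reasoning.Setoid setoid
    vanish : ∀ u → (∀ i → coeff {m} u i ≈ c * coeff {m} u (suc i)) → ∀ i → coeff {m} u i ≈ 0#
    vanish []       r i       = refl
    vanish (a ∷ as) r zero    = trans (r 0) (trans (*-congˡ (vanish as (r ∘ suc) 0)) (zeroʳ c))
    vanish (a ∷ as) r (suc i) = vanish as (r ∘ suc) i
  var-⊖-cancellable (suc m) (suc i) (suc j) (s≤s lt) u e = C.EqMod-coeff u [] λ k →
    var-⊖-cancellable m i j lt (coeff {m} u k) (trans (sym (const-⊛ a (coeff {m} u) k))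
      (trans (⊛-cong {v = coeff {m} u} const≋ (λ _ → refl) k)
        (trans (sym (C.coeff-⊗ (a ∷ []) u k)) (C.coeff-EqMod (_⊗_ {suc m} (a ∷ []) u) [] e k))))
    where
    module C = Coefficients m (isPolyRing m)
    open CommutativeRing C.R hiding (zero)
    open Convolution C.R
    a = _⊖_ {m} (var i) (var j)
    const≋ : const a ≋ coeff {m} (a ∷ [])
    const≋ zero    = refl
    const≋ (suc k) = refl


  sufficiency : ∀ r e d → ℬ p r e d → 𝒜 p r e d
  sufficiency zero     e d (inj₁ (() , _))
  sufficiency zero     e d (inj₂ (inj₁ (() , _)))
  sufficiency zero     e d (inj₂ (inj₂ (() , _)))
  -- The polynomial ring is specialised to itself by the identity, so the equality obtained is
  -- already `EqMod`.
  sufficiency (suc r′) e d = SufficiencyOver.sufficiency n prime r′ R (char) id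
      (mkHomomorphism (rawPoly r) R {id} (λ e → e) (λ x y → refl {x + y}) (λ x y → refl {x * y})
        (λ x → refl { - x}) (refl {0#}) (refl {1#}))
      var (λ i → refl {var i}) ι-constP (var-⊖-cancellable r) e d
    where
    r = suc r′
    R = polyRing r
    open CommutativeRing R hiding (zero)
    open Constants p r using (char; ι-constP)


open import Data.Nat using (_+_; _*_)

theorem4 : (p π : ℕ) → Prime p → Prime π → p ≡ 2 * π + 1 →
    (r e d : ℕ) → (𝒜 p r e d → ℬ p r e d) × (ℬ p r e d → 𝒜 p r e d)
theorem4 zero    π pr _ _ r e d = ⊥-elim (¬prime[0] pr)
theorem4 (suc n) π pr _ _ r e d = Necessity.necessity n pr r e d , Sufficiency.sufficiency n pr r e d
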